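{- Let $\mathcal{H}$ be a hereditary property of $3$-graphs such that $k\otimes U(k)\in\mathrm{Trip}(\mathcal{H})$ for all $k\geq1$. Then there are $c>0$ and $\epsilon^*>0$ such that for every $0<\epsilon_1<\epsilon^*$ there exists $\epsilon_2:\mathbb{N}\to(0,1]$ with $T_{\mathcal{H}}(\epsilon_1,\epsilon_2)\geq W(c\,\epsilon_1^{ -1/7})$.
   Context: A $3$-graph is a pair $H=(V,E)$ with $E$ a set of $3$-element subsets of $V$; write $xyz$ for $\{x,y,z\}$ and $\overline{E}=\{(x,y,z)\in V^3: xyz\in E\}$. A hereditary property of $3$-graphs is a class of finite $3$-graphs closed under isomorphism and induced sub-$3$-graphs. For a graph $G=(V,E)$ and $n\geq1$, $n\otimes G$ is the $3$-graph with vertex set $V\cup C$, where $C$ is a new set of $n$ vertices disjoint from $V$, and edge set $\{xyz: xy\in E, z\in C\}$. $U(k)$ is the graph with vertex set $\{a_i:i\in[k]\}\cup\{b_S:S\subseteq[k]\}$ and edge set $\{a_ib_S: i\in S\}$. For a $3$-graph $H=(V,E)$, $\mathrm{Trip}(H)$ is the $3$-graph with vertex set $\{a_v,b_v,c_v:v\in V\}$ (all distinct) and edge set $\{a_vb_{v'}c_{v''}: vv'v''\in E\}$. $\mathrm{Trip}(\mathcal{H})$ is the closure under isomorphism and induced sub-$3$-graphs of $\{\mathrm{Trip}(H):H\in\mathcal{H}\}$. A bigraph is $B=(U,W;E)$ with $E\subseteq U\times W$; density $d_B=|E|/(|U||W|)$. $B$ has $\mathrm{dev}_2(\epsilon,d)$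 if $|d_B-d|\leq\epsilon$ and $\sum_{u_0,u_1\in U}\sum_{w_0,w_1\in W}\prod_{i,j\in\{0,1\}}g(u_i,w_j)\leq\epsilon|U|^2|W|^2$, where $g(u,w)=1-d_B$ if $(u,w)\in E$ and $-d_B$ otherwise; $\mathrm{dev}_2(\epsilon)$ means $\mathrm{dev}_2(\epsilon,d_B)$. A triad is $G=(X,Y,Z;E_{XY},E_{XZ},E_{YZ})$ with $E_{XY}\subseteq X\times Y$, $E_{XZ}\subseteq X\times Z$, $E_{YZ}\subseteq Y\times Z$; $K_3(G)=\{(x,y,z)\in X\times Y\times Z:(x,y)\in E_{XY},(x,z)\in E_{XZ},(y,z)\in E_{YZ}\}$. For a $3$-graph $H=(V,E)$ and triad $G$ with vertex sets in $V$, let $d=|\overline{E}\cap K_3(G)|/|K_3(G)|$; $G$ has $\mathrm{dev}_{2,3}(\epsilon_1,\epsilon_2)$ w.r.t. $H$ if there are $d_{XY},d_{XZ},d_{YZ}>0$ such that $(X,Y;E_{XY}),(X,Z;E_{XZ}),(Y,Z;E_{YZ})$ have $\mathrm{dev}_2(\epsilon_2,d_{XY}),\mathrm{dev}_2(\epsilon_2,d_{XZ}),\mathrm{dev}_2(\epsilon_2,d_{YZ})$ and $\sum_{u_0,u_1\in X}\sum_{w_0,w_1\in Y}\sum_{z_0,z_1\in Z}\prod_{(i,j,k)\in\{0,1\}^3}h(u_i,w_j,z_k)\leq\epsilon_1d_{XY}^4d_{XZ}^4d_{YZ}^4|X|^2|Y|^2|Z|^2$, with $h=1-d$ on $\overline{E}\cap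 K_3(G)$, $h=-d$ on $K_3(G)\setminus\overline{E}$, $h=0$ off $K_3(G)$. A $(t,\ell)$-decomposition $\mathcal{P}$ of $V$: a partition $\{V_1,\ldots,V_t\}$ of $V$ and, for each $1\leq i,j\leq t$, a partition $V_i\times V_j=P_{ij}^1\cup\cdots\cup P_{ij}^\ell$; its triads are $(V_i,V_j,V_k;P_{ij}^\alpha,P_{ik}^\beta,P_{jk}^\gamma)$, whose $K_3$'s partition $V^3$. It is a $(t,\ell,\epsilon_1,\epsilon_2)$-decomposition if for at least $(1-\epsilon_1)|V|^2$ pairs $(x,y)\in V^2$ the part $P_{ij}^\alpha\ni(x,y)$ gives a bigraph $(V_i,V_j;P_{ij}^\alpha)$ with $\mathrm{dev}_2(\epsilon_2)$; it is $\mathrm{dev}_{2,3}(\epsilon_1,\epsilon_2)$-regular w.r.t. $H$ if for all but at most $\epsilon_1|V|^3$ triples $(x,y,z)\in V^3$ the triad $G$ with $(x,y,z)\in K_3(G)$ has $\mathrm{dev}_{2,3}(\epsilon_1,\epsilon_2)$ w.r.t. $H$. $T_{\mathcal{H}}(\epsilon_1,\epsilon_2)$ (for $\epsilon_1>0$, $\epsilon_2:\mathbb{N}\to(0,1]$) is the least $T$ for which there are $L\geq1$ and $n_0$ such that every $H\in\mathcal{H}$ on at least $n_0$ vertices has, for some $1\leq t\leq T$, $1\leq\ell\leq L$, a $(t,\ell,\epsilon_1,\epsilon_2(\ell))$-decomposition of its vertex set that is $\mathrm{dev}_{2,3}(\epsilon_1,\epsilon_2(\ell))$-regular w.r.t.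 $H$. Wowzer function: $T_m(1)=m$, $T_m(x+1)=T_m(x)2^{T_m(x)}$; $W(1)=1$, $W(x+1)=T_2(W(x))$; for real $y>0$, $W(y)$ means $W(\lceil y\rceil)$.
   Formalization: The formal theorem quantifies over rational ε₁ only (c, ε*, the values of ε₂ and the densities d_XY, d_XZ, d_YZ are rational too); real ε₁ follows by monotonicity of T_H in ε₁ after slightly decreasing c. -}

module Defs where

open import Data.Nat as ℕ using (ℕ; zero; suc; _∸_; _^_)
open import Data.Integer using (+_)
open import Data.Rational as ℚ using (ℚ; 0ℚ; 1ℚ; _+_; _*_; _-_; _/_; _≤_; _<_; ∣_∣; -_)
open import Data.Fin using (Fin; zero; suc)
import Data.Fin as F
open import Data.Fin.Subset using (Subset)
open import Data.Vec using (lookup)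
open import Data.Bool using (Bool; true; false; _∧_; _∨_; not; if_then_else_)
open import Data.Product using (Σ; _×_; _,_; ∃)
open import Data.Sum using (_⊎_; inj₁; inj₂)
open import Relation.Nullary.Decidable using (⌊_⌋)
open import Relation.Binary.PropositionalEquality using (_≡_)

∑ : (n : ℕ) → (Fin n → ℚ) → ℚ
∑ zero    f = 0ℚ
∑ (suc n) f = f zero + ∑ n (λ i → f (suc i))

count : (n : ℕ) → (Fin n → Bool) → ℕ
count zero    p = 0
count (suc n) p = (if p zero then 1 else 0) ℕ.+ count n (λ i → p (suc i))

toℚ : ℕ → ℚ
toℚ k = (+ k) / 1

-- a / b as a rational, with the (never used) convention a / 0 = 0
frac : ℕ → ℕ → ℚ
frac a zero    = 0ℚ
frac a (suc b) = (+ a) / suc b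

eqF : ∀ {t} → Fin t → Fin t → Bool
eqF i j = ⌊ i F.≟ j ⌋

-- A 3-graph on vertex set Fin n, given by the indicator of \overline{E}
-- (ordered triples whose underlying set is an edge): symmetric and
-- vanishing on triples with a repeated vertex.
record Graph3 : Set where
  field
    n     : ℕ
    E     : Fin n → Fin n → Fin n → Bool
    sym₁₂ : ∀ x y z → E x y z ≡ E y x z
    sym₂₃ : ∀ x y z → E x y z ≡ E x z y
    irr   : ∀ x z → E x x z ≡ false

-- A general "3-structure" (vertex type + ordered-triple edge indicator),
-- used to describe 3-graphs whose vertex sets are not literally Fin n.
record Str : Set₁ where
  field
    V : Set
    E : V → V → V → Bool

toStr : Graph3 → Str
toStr H = record { V = Fin (Graph3.n H) ; E = Graph3.E H }

Embeds : Str → Str → Set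
Embeds A B = Σ (Str.V A → Str.V B) λ f →
  (∀ a b → f a ≡ f b → a ≡ b) ×
  (∀ a b c → Str.E A a b c ≡ Str.E B (f a) (f b) (f c))

Hereditary : (Graph3 → Set) → Set
Hereditary 𝓗 = ∀ G H → 𝓗 H → Embeds (toStr G) (toStr H) → 𝓗 G

-- Trip(H): vertices (0,v)=a_v, (1,v)=b_v, (2,v)=c_v
distinct3 : Fin 3 → Fin 3 → Fin 3 → Bool
distinct3 i j k = not (eqF i j) ∧ not (eqF i k) ∧ not (eqF j k)

Trip : Graph3 → Str
Trip H = record
  { V = Fin 3 × Fin (Graph3.n H)
  ; E = λ { (i , u) (j , v) (k , w) → distinct3 i j k ∧ Graph3.E H u v w } }

InTrip : (Graph3 → Set) → Str → Set
InTrip 𝓗 A = Σ Graph3 λ H → 𝓗 H × Embeds A (Trip H)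

-- k ⊗ U(k): vertices inj₁ (inj₁ i) = a_i, inj₁ (inj₂ S) = b_S, inj₂ c ∈ C
adjU : ∀ {k} → Fin k ⊎ Subset k → Fin k ⊎ Subset k → Bool
adjU (inj₁ i) (inj₂ S) = lookup S i
adjU (inj₂ S) (inj₁ i) = lookup S i
adjU _        _        = false

isC : ∀ {k} → (Fin k ⊎ Subset k) ⊎ Fin k → Bool
isC (inj₁ _) = false
isC (inj₂ _) = true

adjU' : ∀ {k} → (Fin k ⊎ Subset k) ⊎ Fin k → (Fin k ⊎ Subset k) ⊎ Fin k → Bool
adjU' (inj₁ x) (inj₁ y) = adjU x y
adjU' _        _        = false

kU : ℕ → Str
kU k = record
  { V = (Fin k ⊎ Subset k) ⊎ Fin k
  ; E = λ x y z → (adjU' x y ∧ isC z) ∨ (adjU' y z ∧ isC x) ∨ (adjU' x z ∧ isC y) }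

ind : Bool → ℚ
ind b = if b then 1ℚ else 0ℚ

sq : ℚ → ℚ
sq q = q * q

sumℕ : (n : ℕ) → (Fin n → ℕ) → ℕ
sumℕ zero    f = 0
sumℕ (suc n) f = f zero ℕ.+ sumℕ n (λ i → f (suc i))

count2 : (n : ℕ) → (Fin n → Fin n → Bool) → ℕ
count2 n p = sumℕ n (λ x → count n (p x))

count3 : (n : ℕ) → (Fin n → Fin n → Fin n → Bool) → ℕ
count3 n p = sumℕ n (λ x → count2 n (p x))

-- a bigraph (U, W; E) with U, W ⊆ Fin n (E is intersected with U × W)
record Bigraph (n : ℕ) : Set where
  field
    U W : Fin n → Bool
    E   : Fin n → Fin n → Bool

module _ {n : ℕ} (B : Bigraph n) where
  open Bigraph B

  Eʳ : Fin n → Fin n → Bool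
  Eʳ u w = U u ∧ W w ∧ E u w

  densB : ℚ
  densB = frac (count2 n Eʳ) (count n U ℕ.* count n W)

  gB : Fin n → Fin n → ℚ
  gB u w = if Eʳ u w then 1ℚ - densB else - densB

  octB : ℚ
  octB = ∑ n λ u₀ → ∑ n λ u₁ → ∑ n λ w₀ → ∑ n λ w₁ →
    ind (U u₀ ∧ U u₁ ∧ W w₀ ∧ W w₁) *
    (gB u₀ w₀ * gB u₀ w₁ * gB u₁ w₀ * gB u₁ w₁)

  Dev2 : ℚ → ℚ → Set
  Dev2 ε d = (∣ densB - d ∣ ≤ ε) ×
             (octB ≤ ε * sq (toℚ (count n U)) * sq (toℚ (count n W)))

  Dev2' : ℚ → Set
  Dev2' ε = Dev2 ε densB

record Triad (n : ℕ) : Set where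
  field
    X Y Z : Fin n → Bool
    Exy Exz Eyz : Fin n → Fin n → Bool

module _ {n : ℕ} (G : Triad n) where
  open Triad G

  bXY bXZ bYZ : Bigraph n
  bXY = record { U = X ; W = Y ; E = Exy }
  bXZ = record { U = X ; W = Z ; E = Exz }
  bYZ = record { U = Y ; W = Z ; E = Eyz }

  K3 : Fin n → Fin n → Fin n → Bool
  K3 x y z = X x ∧ Y y ∧ Z z ∧ Exy x y ∧ Exz x z ∧ Eyz y z

  module _ (HE : Fin n → Fin n → Fin n → Bool) where
    densT : ℚ
    densT = frac (count3 n (λ x y z → HE x y z ∧ K3 x y z)) (count3 n K3)

    hT : Fin n → Fin n → Fin n → ℚ
    hT x y z = if K3 x y z then (if HE x y z then 1ℚ - densT else - densT) else 0ℚ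

    octT : ℚ
    octT = ∑ n λ u₀ → ∑ n λ u₁ → ∑ n λ w₀ → ∑ n λ w₁ → ∑ n λ z₀ → ∑ n λ z₁ →
      ind (X u₀ ∧ X u₁ ∧ Y w₀ ∧ Y w₁ ∧ Z z₀ ∧ Z z₁) *
      (hT u₀ w₀ z₀ * hT u₀ w₀ z₁ * hT u₀ w₁ z₀ * hT u₀ w₁ z₁ *
       hT u₁ w₀ z₀ * hT u₁ w₀ z₁ * hT u₁ w₁ z₀ * hT u₁ w₁ z₁)

    Dev23 : ℚ → ℚ → Set
    Dev23 ε₁ ε₂ = Σ ℚ λ dxy → Σ ℚ λ dxz → Σ ℚ λ dyz →
      (0ℚ < dxy) × (0ℚ < dxz) × (0ℚ < dyz) ×
      Dev2 bXY ε₂ dxy × Dev2 bXZ ε₂ dxz × Dev2 bYZ ε₂ dyz ×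
      (octT ≤ ε₁ * sq (sq dxy) * sq (sq dxz) * sq (sq dyz) *
               sq (toℚ (count n X)) * sq (toℚ (count n Y)) * sq (toℚ (count n Z)))

-- (t, ℓ)-decompositions of Fin n
-- part x = i means x ∈ V_i;  for x ∈ V_i, y ∈ V_j, colour x y = α means
-- (x, y) ∈ P_ij^α.

record Decomp (n t ℓ : ℕ) : Set where
  field
    part   : Fin n → Fin t
    colour : Fin n → Fin n → Fin ℓ

module _ {n t ℓ : ℕ} (P : Decomp n t ℓ) where
  open Decomp P

  inV : Fin t → Fin n → Bool
  inV i x = eqF (part x) i

  bigraphAt : Fin n → Fin n → Bigraph n
  bigraphAt x y = record
    { U = inV (part x) ; W = inV (part y)
    ; E = λ u w → eqF (colour u w) (colour x y) }

  triadAt : Fin n → Fin n → Fin n → Triad n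
  triadAt x y z = record
    { X = inV (part x) ; Y = inV (part y) ; Z = inV (part z)
    ; Exy = λ u v → eqF (colour u v) (colour x y)
    ; Exz = λ u w → eqF (colour u w) (colour x z)
    ; Eyz = λ v w → eqF (colour v w) (colour y z) }

  IsDecomp : ℚ → ℚ → Set
  IsDecomp ε₁ ε₂ = Σ (Fin n → Fin n → Bool) λ good →
    ((1ℚ - ε₁) * sq (toℚ n) ≤ toℚ (count2 n good)) ×
    (∀ x y → good x y ≡ true → Dev2' (bigraphAt x y) ε₂)

  IsRegular : (Fin n → Fin n → Fin n → Bool) → ℚ → ℚ → Set
  IsRegular HE ε₁ ε₂ = Σ (Fin n → Fin n → Fin n → Bool) λ good →
    (toℚ (count3 n (λ x y z → not (good x y z))) ≤ ε₁ * toℚ n * sq (toℚ n)) ×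
    (∀ x y z → good x y z ≡ true → Dev23 (triadAt x y z) HE ε₁ ε₂)

-- "T witnesses T_𝓗(ε₁, ε₂) ≤ T with constants L, n₀"
Works : (Graph3 → Set) → ℚ → (ℕ → ℚ) → ℕ → ℕ → ℕ → Set
Works 𝓗 ε₁ ε₂ T L n₀ = ∀ H → 𝓗 H → n₀ ℕ.≤ Graph3.n H →
  Σ ℕ λ t → Σ ℕ λ ℓ → (1 ℕ.≤ t) × (t ℕ.≤ T) × (1 ℕ.≤ ℓ) × (ℓ ℕ.≤ L) ×
  Σ (Decomp (Graph3.n H) t ℓ) λ P →
    IsDecomp P ε₁ (ε₂ ℓ) × IsRegular P (Graph3.E H) ε₁ (ε₂ ℓ)

-- Tower and wowzer functions (meaningful for arguments ≥ 1; value at 0 is junk)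

Tow : ℕ → ℕ → ℕ
Tow m zero          = m
Tow m (suc zero)    = m
Tow m (suc (suc x)) = Tow m (suc x) ℕ.* 2 ^ Tow m (suc x)

Wow : ℕ → ℕ
Wow zero          = 1
Wow (suc zero)    = 1
Wow (suc (suc x)) = Tow 2 (Wow (suc x))

-- m = ⌈ c · ε^{-1/7} ⌉ (for c, ε > 0): m is the least natural number with
-- c · ε^{-1/7} ≤ m, i.e. with c⁷ ≤ m⁷ · ε.
pow7 : ℚ → ℚ
pow7 q = q * q * q * q * q * q * q

IsCeilRoot7 : ℚ → ℚ → ℕ → Set
IsCeilRoot7 c ε m = (pow7 c ≤ pow7 (toℚ m) * ε) ×
                    (∀ m' → m' ℕ.< m → pow7 (toℚ m') * ε < pow7 c)

{-# OPTIONS --safe #-}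
module Submission where

-- Since ε₂ is chosen after ε₁, the number of parts can be forced above any prescribed function R of ε₁,
-- and the exponent 1/7 plays no role (c = 1).  Let N ≥ 2R.  As k ⊗ U(k) ∈ Trip(𝓗) for all k, some large
-- 3-graph in 𝓗 has classes A, B, C of equal size such that A splits into N equal groups, xyz is an edge
-- for (x,y,z) ∈ A × B × C iff the group of x belongs to a set S_y, and every set of groups occurs equally
-- often as S_y.  In a regular triad without sparse bigraphs, the Gowers-Cauchy-Schwarz inequality shows
-- that the edges and the non-edges of A × B × C cannot both occupy a positive proportion of the triangles;
-- as ε₂ is tiny compared to 1/(Nℓ), the triangles are distributed over the groups as expected, so the
-- bipartite pattern {(x,y) : group of x ∈ S_y} is nearly constant on most (V_i ∩ A) × (V_j ∩ B).
-- But a partition into t ≤ N/2 parts separates few groups, so that an average row y has both values in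
-- substantial proportion on the sets V_i ∩ A: a contradiction once ε₁ is below an absolute constant.

open import Defs

-- `ε₁` is fixed before the number N of groups, so nothing that grows with N may be charged to it.
-- The pattern is therefore tested against `hT` as a single relation on pairs, which the
-- Gowers-Cauchy-Schwarz argument allows at the cost of an absolute constant; it is cut into groups
-- only when triangles are counted, where the errors come from dev₂ and are paid by `ε₂`. The
-- estimates must also be relative to the bigraph densities, whose typical size shrinks with ℓ:
-- every Cauchy-Schwarz factor is a count of edges, cherries or four-cycles, so the densities cancel
-- against the scaling in dev₂,₃, and only bigraphs sparser than σ are thrown away. All subsets of
-- the groups serve as rows because then any two groups are separated, in each direction, by exactly
-- a quarter of the rows; each part loses at most one group's worth of A in the mixing estimate.
-- Square and fourth roots need not exist in ℚ, so small quantities enter as powers or are linked by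
-- inequalities between powers.

module Proof where
  open import Data.Bool using (Bool; true; false; _∧_; _∨_; not; if_then_else_)
  import Data.Bool.Properties as Bool
  open import Data.Empty using (⊥; ⊥-elim)
  open import Data.Fin as F using (Fin; zero; suc; splitAt; _↑ˡ_; _↑ʳ_; combine; remQuot; quotient)
  open import Data.Fin.Properties as F using (any?; all?; pigeonhole; ¬∀⟶∃¬)
  open import Data.Fin.Subset using (Subset)
  import Data.Integer as ℤ
  import Data.Integer.Properties as ℤ
  open import Data.Maybe using (Maybe; just; nothing)
  open import Data.Nat as ℕ using (ℕ; zero; suc)
  import Data.Nat.Properties as ℕ
  open import Data.Product using (Σ; _×_; _,_; proj₁; proj₂)
  open import Data.Rational hiding (truncate; floor)
  open import Data.Rational.Properties
  import Data.Rational.Unnormalised as ℚᵘ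
  import Data.Rational.Unnormalised.Properties as ℚᵘ
  open import Data.Sum using (inj₁; inj₂; [_,_]′)
  open import Data.Sum.Properties using (inj₁-injective; inj₂-injective)
  open import Data.Unit using (tt)
  open import Data.Vec using (lookup; tabulate)
  open import Data.Vec.Properties using (lookup∘tabulate)
  open import Relation.Binary.PropositionalEquality
  open import Relation.Nullary using (Dec; yes; no; ¬_; ¬?)
  open import Relation.Nullary.Decidable using (⌊_⌋; toWitness; _→-dec_; decidable-stable)
  open import Tactic.RingSolver using (solve-∀)
  open import Tactic.RingSolver.Core.AlmostCommutativeRing using (AlmostCommutativeRing; fromCommutativeRing)
  open ≤-Reasoning

  -- Rational inequalities, finite sums, and Cauchy-Schwarz for iterated sums.

  module OrderedSums where

    ℚring : AlmostCommutativeRing _ _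
    ℚring = fromCommutativeRing +-*-commutativeRing isZero
      where
      isZero : ∀ x → Maybe (0ℚ ≡ x)
      isZero x with 0ℚ ≟ x
      ... | yes p = just p
      ... | no _  = nothing

    ≤-eq : ∀ {a b} → a ≡ b → a ≤ b
    ≤-eq = ≤-reflexive

    0≤* : ∀ {a b} → 0ℚ ≤ a → 0ℚ ≤ b → 0ℚ ≤ a * b
    0≤* {a} {b} p q = subst (_≤ a * b) (*-zeroʳ a) (*-monoˡ-≤-nonNeg a ⦃ nonNegative p ⦄ q)

    0≤+ : ∀ {a b} → 0ℚ ≤ a → 0ℚ ≤ b → 0ℚ ≤ a + b
    0≤+ {a} {b} p q = subst (_≤ a + b) (+-identityˡ 0ℚ) (+-mono-≤ p q)

    0<* : ∀ {a b} → 0ℚ < a → 0ℚ < b → 0ℚ < a * b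
    0<* {a} {b} p q = subst (_< a * b) (*-zeroʳ a) (*-monoʳ-<-pos a ⦃ positive p ⦄ q)

    0≤1 : 0ℚ ≤ 1ℚ
    0≤1 = nonNegative⁻¹ 1ℚ

    0<1 : 0ℚ < 1ℚ
    0<1 = positive⁻¹ 1ℚ

    ≤⇒0≤- : ∀ {a b} → a ≤ b → 0ℚ ≤ b - a
    ≤⇒0≤- {a} {b} p = subst (_≤ b - a) (+-inverseʳ a) (+-monoˡ-≤ (- a) p)

    ≤-by : ∀ {a b r} → 0ℚ ≤ r → b ≡ a + r → a ≤ b
    ≤-by {a} {b} {r} p e = subst (a ≤_) (sym e) (subst (_≤ a + r) (+-identityʳ a) (+-monoʳ-≤ a p))

    0≤-⇒≤ : ∀ {a b} → 0ℚ ≤ b - a → a ≤ b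
    0≤-⇒≤ {a} {b} p = ≤-by p (eq a b)
      where
      eq : ∀ a b → b ≡ a + (b - a)
      eq = solve-∀ ℚring

    *-monoˡ : ∀ c {a b} → 0ℚ ≤ c → a ≤ b → c * a ≤ c * b
    *-monoˡ c p = *-monoˡ-≤-nonNeg c ⦃ nonNegative p ⦄

    *-monoʳ : ∀ c {a b} → 0ℚ ≤ c → a ≤ b → a * c ≤ b * c
    *-monoʳ c p = *-monoʳ-≤-nonNeg c ⦃ nonNegative p ⦄

    *-mono : ∀ {a b c d} → 0ℚ ≤ b → 0ℚ ≤ c → a ≤ b → c ≤ d → a * c ≤ b * d
    *-mono {a} {b} {c} {d} 0≤b 0≤c p q = ≤-trans (*-monoʳ c 0≤c p) (*-monoˡ b 0≤b q)

    *-cancel : ∀ c {a b} → 0ℚ < c → c * a ≤ c * b → a ≤ b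
    *-cancel c p = *-cancelˡ-≤-pos c ⦃ positive p ⦄

    ≤-cases : ∀ a → ∀ {ℓ} {P : Set ℓ} → (0ℚ ≤ a → P) → (a ≤ 0ℚ → P) → P
    ≤-cases a p q with 0ℚ ≤? a
    ... | yes r = p r
    ... | no r = q (<⇒≤ (≰⇒> r))

    0≤- : ∀ {a} → a ≤ 0ℚ → 0ℚ ≤ - a
    0≤- {a} p = subst (_≤ - a) refl (neg-antimono-≤ p)

    0≤sq : ∀ a → 0ℚ ≤ a * a
    0≤sq a = ≤-cases a (λ p → 0≤* p p) λ p → subst (0ℚ ≤_) (eq a) (0≤* (0≤- p) (0≤- p))
      where
      eq : ∀ a → (- a) * (- a) ≡ a * a
      eq = solve-∀ ℚring

    sq-cancel : ∀ {x y} → 0ℚ ≤ y → x * x ≤ y * y → x ≤ y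
    sq-cancel {x} {y} 0≤y p with x ≤? y
    ... | yes q = q
    ... | no q = ⊥-elim (<-irrefl refl (<-≤-trans lt p))
      where
      y<x = ≰⇒> q
      lt : y * y < x * x
      lt = ≤-<-trans (*-monoˡ y 0≤y (<⇒≤ y<x)) (*-monoˡ-<-pos x ⦃ positive (≤-<-trans 0≤y y<x) ⦄ y<x)

    private variable
      n m : ℕ

    ∑-cong : {f g : Fin n → ℚ} → (∀ i → f i ≡ g i) → ∑ n f ≡ ∑ n g
    ∑-cong {zero}  p = refl
    ∑-cong {suc n} p = cong₂ _+_ (p zero) (∑-cong λ i → p (suc i))

    ∑-mono : {f g : Fin n → ℚ} → (∀ i → f i ≤ g i) → ∑ n f ≤ ∑ n g
    ∑-mono {zero}  p = ≤-refl
    ∑-mono {suc n} p = +-mono-≤ (p zero) (∑-mono λ i → p (suc i))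

    ∑-+ : (f g : Fin n → ℚ) → ∑ n (λ i → f i + g i) ≡ ∑ n f + ∑ n g
    ∑-+ {zero}  f g = refl
    ∑-+ {suc n} f g = trans (cong (f zero + g zero +_) (∑-+ (λ i → f (suc i)) (λ i → g (suc i))))
                            (eq (f zero) (g zero) _ _)
      where
      eq : ∀ a b c d → a + b + (c + d) ≡ a + c + (b + d)
      eq = solve-∀ ℚring

    ∑-*ˡ : ∀ c (f : Fin n → ℚ) → ∑ n (λ i → c * f i) ≡ c * ∑ n f
    ∑-*ˡ {zero}  c f = sym (*-zeroʳ c)
    ∑-*ˡ {suc n} c f = trans (cong (c * f zero +_) (∑-*ˡ c (λ i → f (suc i))))
                             (sym (*-distribˡ-+ c (f zero) _))

    ∑-*ʳ : ∀ c (f : Fin n → ℚ) → ∑ n (λ i → f i * c) ≡ ∑ n f * c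
    ∑-*ʳ c f = trans (∑-cong λ i → *-comm (f i) c) (trans (∑-*ˡ c f) (*-comm c _))

    ∑-0 : ∑ n (λ _ → 0ℚ) ≡ 0ℚ
    ∑-0 {zero}  = refl
    ∑-0 {suc n} = trans (+-identityˡ _) (∑-0 {n})

    0≤∑ : {f : Fin n → ℚ} → (∀ i → 0ℚ ≤ f i) → 0ℚ ≤ ∑ n f
    0≤∑ {n} {f} p = subst (_≤ ∑ n f) (∑-0 {n}) (∑-mono p)

    ∑-- : (f g : Fin n → ℚ) → ∑ n (λ i → f i - g i) ≡ ∑ n f - ∑ n g
    ∑-- {n} f g = trans (∑-+ f (λ i → - g i)) (cong (∑ n f +_)
      (trans (∑-cong λ i → e₁ (g i)) (trans (∑-*ˡ (- 1ℚ) g) (sym (e₁ _)))))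
      where
      e₁ : ∀ a → - a ≡ (- 1ℚ) * a
      e₁ = solve-∀ ℚring

    ∑-swap : (f : Fin n → Fin m → ℚ) → (∑ n λ i → ∑ m λ j → f i j) ≡ (∑ m λ j → ∑ n λ i → f i j)
    ∑-swap {zero}  {m} f = sym (∑-0 {m})
    ∑-swap {suc n} {m} f = trans (cong (∑ m (f zero) +_) (∑-swap λ i → f (suc i)))
                                 (sym (∑-+ (f zero) λ j → ∑ n λ i → f (suc i) j))

    ∑-prod : (f : Fin n → ℚ) (g : Fin m → ℚ) → ∑ n f * ∑ m g ≡ (∑ n λ i → ∑ m λ j → f i * g j)
    ∑-prod {n} {m} f g = trans (sym (∑-*ʳ (∑ m g) f)) (∑-cong λ i → sym (∑-*ˡ (f i) g))

    ∑-single : (f : Fin n → ℚ) → (∀ i → 0ℚ ≤ f i) → ∀ i → f i ≤ ∑ n f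
    ∑-single {suc n} f p zero = ≤-by (0≤∑ λ i → p (suc i)) refl
    ∑-single {suc n} f p (suc i) = ≤-trans (∑-single (λ i → f (suc i)) (λ i → p (suc i)) i)
      (≤-by (p zero) (+-comm (f zero) _))

    -- Positive linear functionals, so that one proof of Cauchy-Schwarz serves sums over any number
    -- of variables: `_⊗_` produces the iterated sums over pairs, triples and quadruples of
    -- vertices.
    record Functional (I : Set) : Set where
      field
        ∫      : (I → ℚ) → ℚ
        ∫-cong : ∀ {f g} → (∀ i → f i ≡ g i) → ∫ f ≡ ∫ g
        ∫-mono : ∀ {f g} → (∀ i → f i ≤ g i) → ∫ f ≤ ∫ g
        ∫-+    : ∀ f g → ∫ (λ i → f i + g i) ≡ ∫ f + ∫ g
        ∫-*    : ∀ c f → ∫ (λ i → c * f i) ≡ c * ∫ f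

      0≤∫ : ∀ {f} → (∀ i → 0ℚ ≤ f i) → 0ℚ ≤ ∫ f
      0≤∫ {f} p = subst (_≤ ∫ f) (trans (∫-* 0ℚ (λ _ → 0ℚ)) (*-zeroˡ (∫ λ _ → 0ℚ))) (∫-mono p)

      -- With S = ∫ a x, the integral of (M x - S a)² and the term S² (M - ∫ a a) are nonnegative
      -- and add up to M (M ∫ x x - S²); then M is cancelled. An upper bound `M` replaces `∫ a a`
      -- because the weights used later are indicators of configurations whose number is in part
      -- only bounded from above.
      cauchy-schwarz : ∀ (a x : I → ℚ) {M} → 0ℚ < M → ∫ (λ i → a i * a i) ≤ M →
        ∫ (λ i → a i * x i) * ∫ (λ i → a i * x i) ≤ M * ∫ (λ i → x i * x i)
      cauchy-schwarz a x {M} 0<M A≤M = *-cancel M 0<M (0≤-⇒≤ (subst (0ℚ ≤_) (sym eq)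
          (0≤+ (0≤∫ (λ i → 0≤sq (M * x i - S * a i))) (0≤* (0≤sq S) (≤⇒0≤- A≤M)))))
        where
        S = ∫ (λ i → a i * x i)
        A = ∫ (λ i → a i * a i)
        Q = ∫ (λ i → x i * x i)
        e₁ : ∀ M S a x → (M * x - S * a) * (M * x - S * a) ≡
               M * M * (x * x) + ((- (M * S + M * S)) * (a * x) + S * S * (a * a))
        e₁ = solve-∀ ℚring
        e₂ : ∀ M S A Q → M * (M * Q) - M * (S * S) ≡
               M * M * Q + ((- (M * S + M * S)) * S + S * S * A) + S * S * (M - A)
        e₂ = solve-∀ ℚring
        expand : ∫ (λ i → (M * x i - S * a i) * (M * x i - S * a i)) ≡
                 M * M * Q + ((- (M * S + M * S)) * S + S * S * A)
        expand = trans (∫-cong λ i → e₁ M S (a i) (x i))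
          (trans (∫-+ (λ i → M * M * (x i * x i)) (λ i → (- (M * S + M * S)) * (a i * x i) + S * S * (a i * a i)))
          (cong₂ _+_ (∫-* (M * M) (λ i → x i * x i))
          (trans (∫-+ (λ i → (- (M * S + M * S)) * (a i * x i)) (λ i → S * S * (a i * a i)))
          (cong₂ _+_ (∫-* (- (M * S + M * S)) (λ i → a i * x i)) (∫-* (S * S) (λ i → a i * a i))))))
        eq : M * (M * Q) - M * (S * S) ≡
             ∫ (λ i → (M * x i - S * a i) * (M * x i - S * a i)) + S * S * (M - A)
        eq = trans (e₂ M S A Q) (cong (_+ S * S * (M - A)) (sym expand))

    open Functional public using (∫; cauchy-schwarz)

    fin : ∀ n → Functional (Fin n)
    fin n = record { ∫ = ∑ n ; ∫-cong = ∑-cong ; ∫-mono = ∑-mono ; ∫-+ = ∑-+ ; ∫-* = ∑-*ˡ }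

    infixr 4 _⊗_

    _⊗_ : ∀ {I J} → Functional I → Functional J → Functional (I × J)
    F ⊗ G = record
      { ∫      = λ f → Φ.∫ λ i → Ψ.∫ λ j → f (i , j)
      ; ∫-cong = λ p → Φ.∫-cong λ i → Ψ.∫-cong λ j → p (i , j)
      ; ∫-mono = λ p → Φ.∫-mono λ i → Ψ.∫-mono λ j → p (i , j)
      ; ∫-+    = λ f g → trans (Φ.∫-cong λ i → Ψ.∫-+ _ _) (Φ.∫-+ _ _)
      ; ∫-*    = λ c f → trans (Φ.∫-cong λ i → Ψ.∫-* c λ j → f (i , j)) (Φ.∫-* c λ i → Ψ.∫ λ j → f (i , j)) }
      where
      module Φ = Functional F
      module Ψ = Functional G

  open OrderedSums public

  -- Discrepancy of quasirandom bigraphs.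

  module QuasiRandomBigraphs where

    0≤ind : ∀ b → 0ℚ ≤ ind b
    0≤ind false = ≤-refl
    0≤ind true = 0≤1

    ind≤1 : ∀ b → ind b ≤ 1ℚ
    ind≤1 false = 0≤1
    ind≤1 true = ≤-refl

    ind-∧ : ∀ a b → ind (a ∧ b) ≡ ind a * ind b
    ind-∧ false b = sym (*-zeroˡ (ind b))
    ind-∧ true b = sym (*-identityˡ (ind b))

    ind-idem : ∀ b → ind b * ind b ≡ ind b
    ind-idem false = refl
    ind-idem true = refl

    ind*≤ : ∀ b {x} → 0ℚ ≤ x → ind b * x ≤ x
    ind*≤ b {x} p = subst (ind b * x ≤_) (*-identityˡ x) (*-monoʳ x p (ind≤1 b))

    private variable
      n : ℕ

    size : (Fin n → Bool) → ℚ
    size {n} X = ∑ n λ u → ind (X u)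

    0≤size : (X : Fin n → Bool) → 0ℚ ≤ size X
    0≤size X = 0≤∑ λ u → 0≤ind (X u)

    swap₃ : (f : Fin n → Fin n → Fin n → ℚ) →
      (∑ n λ w → ∑ n λ u → ∑ n λ v → f u v w) ≡ (∑ n λ u → ∑ n λ v → ∑ n λ w → f u v w)
    swap₃ f = trans (∑-swap λ w u → ∑ _ λ v → f u v w) (∑-cong λ u → ∑-swap λ w v → f u v w)

    -- Subtracting `D` on X × Y only makes this the function g of dev₂ extended by zero, provided
    -- `p` lies inside X × Y, so all sums can range over the full vertex set.
    deviation : (X Y : Fin n → Bool) (p : Fin n → Fin n → Bool) → ℚ → Fin n → Fin n → ℚ
    deviation X Y p D u w = ind (p u w) - D * (ind (X u) * ind (Y w))

    -- The four-cycle error is given as a fourth power because two applications of Cauchy-Schwarz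
    -- take a fourth root; the discrepancy is then at most θ|X||Y|.
    record QuasiRandom {n} (X Y : Fin n → Bool) (p : Fin n → Fin n → Bool) (D θ : ℚ) : Set where
      field
        0≤D : 0ℚ ≤ D
        D≤1 : D ≤ 1ℚ
        0≤θ : 0ℚ ≤ θ
        0<x : 0ℚ < size X
        0<y : 0ℚ < size Y
        supportˡ : ∀ u w → ind (p u w) ≡ ind (X u) * ind (p u w)
        supportʳ : ∀ u w → ind (p u w) ≡ ind (Y w) * ind (p u w)
        total : (∑ n λ u → ∑ n λ w → ind (p u w)) ≡ D * (size X * size Y)
        oct : let g = deviation X Y p D in
              (∑ n λ u₀ → ∑ n λ u₁ → ∑ n λ w₀ → ∑ n λ w₁ →
                 g u₀ w₀ * g u₀ w₁ * g u₁ w₀ * g u₁ w₁) ≤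
              (θ * θ) * (θ * θ) * (size X * size X) * (size Y * size Y)


      dev : Fin n → Fin n → ℚ
      dev = deviation X Y p D

      x y : ℚ
      x = size X
      y = size Y

      0≤x : 0ℚ ≤ x
      0≤x = <⇒≤ 0<x
      0≤y : 0ℚ ≤ y
      0≤y = <⇒≤ 0<y

      dev-supportˡ : ∀ u w → dev u w ≡ ind (X u) * dev u w
      dev-supportˡ u w = begin-equality
        dev u w                                            ≡⟨ cong₂ (λ a b → a - D * (b * iY)) (supportˡ u w) (sym (ind-idem (X u))) ⟩
        iX * ind (p u w) - D * ((iX * iX) * iY)            ≡⟨ e iX iY (ind (p u w)) D ⟩
        iX * dev u w                                       ∎
        where
        iX = ind (X u)
        iY = ind (Y w)
        e : ∀ a b p d → a * p - d * ((a * a) * b) ≡ a * (p - d * (a * b))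
        e = solve-∀ ℚring

      dev-supportʳ : ∀ u w → dev u w ≡ ind (Y w) * dev u w
      dev-supportʳ u w = begin-equality
        dev u w                                            ≡⟨ cong₂ (λ a b → a - D * (iX * b)) (supportʳ u w) (sym (ind-idem (Y w))) ⟩
        iY * ind (p u w) - D * (iX * (iY * iY))            ≡⟨ e iX iY (ind (p u w)) D ⟩
        iY * dev u w                                       ∎
        where
        iX = ind (X u)
        iY = ind (Y w)
        e : ∀ a b p d → b * p - d * (a * (b * b)) ≡ b * (p - d * (a * b))
        e = solve-∀ ℚring

      module Discrepancy (a b : Fin n → Bool) where
        S T : ℚ
        S = ∑ n λ u → ∑ n λ w → ind (a u) * (ind (b w) * dev u w)
        col : Fin n → ℚ
        col w = ∑ n λ u → ind (a u) * dev u w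
        codeg : Fin n → Fin n → ℚ
        codeg u₀ u₁ = ∑ n λ w → dev u₀ w * dev u₁ w
        T = ∑ n λ w → col w * col w

        S-col : S ≡ ∑ n λ w → (ind (b w) * ind (Y w)) * col w
        S-col = trans (∑-swap λ u w → ind (a u) * (ind (b w) * dev u w)) (∑-cong λ w →
          trans (∑-cong λ u → trans (cong (λ z → ind (a u) * (ind (b w) * z)) (dev-supportʳ u w))
                                    (e (ind (a u)) (ind (b w)) (ind (Y w)) (dev u w)))
                (∑-*ˡ (ind (b w) * ind (Y w)) λ u → ind (a u) * dev u w))
          where
          e : ∀ a b y g → a * (b * (y * g)) ≡ (b * y) * (a * g)
          e = solve-∀ ℚring

        ind*-idem : ∀ c d → (ind c * ind d) * (ind c * ind d) ≤ ind d
        ind*-idem c d = ≤-trans (≤-eq (trans (cong₂ _*_ (sym (ind-∧ c d)) (sym (ind-∧ c d)))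
          (trans (ind-idem (c ∧ d)) (ind-∧ c d)))) (ind*≤ c (0≤ind d))

        -- Cauchy-Schwarz over the columns removes the set `b`. As `dev` vanishes off Y, the weight
        -- can be cut down to Y, and the factor is |Y| instead of the number of all vertices.
        S²≤ : S * S ≤ y * T
        S²≤ = subst (λ s → s * s ≤ y * T) (sym S-col)
          (cauchy-schwarz (fin n) (λ w → ind (b w) * ind (Y w)) col 0<y (∑-mono λ w → ind*-idem (b w) (Y w)))

        iaX : Fin n → ℚ
        iaX u = ind (a u) * ind (X u)

        T-codeg : T ≡ ∑ n λ u₀ → ∑ n λ u₁ → (iaX u₀ * iaX u₁) * codeg u₀ u₁
        T-codeg = trans (∑-cong λ w → ∑-prod (λ u → ind (a u) * dev u w) (λ u → ind (a u) * dev u w))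
          (trans (swap₃ λ u₀ u₁ w → (ind (a u₀) * dev u₀ w) * (ind (a u₁) * dev u₁ w))
          (∑-cong λ u₀ → ∑-cong λ u₁ → trans (∑-cong λ w → trans
            (cong₂ (λ s t → (ind (a u₀) * s) * (ind (a u₁) * t)) (dev-supportˡ u₀ w) (dev-supportˡ u₁ w))
            (e (ind (a u₀)) (ind (X u₀)) (dev u₀ w) (ind (a u₁)) (ind (X u₁)) (dev u₁ w)))
            (∑-*ˡ (iaX u₀ * iaX u₁) λ w → dev u₀ w * dev u₁ w)))
          where
          e : ∀ a x g a' x' g' → (a * (x * g)) * (a' * (x' * g')) ≡ ((a * x) * (a' * x')) * (g * g')
          e = solve-∀ ℚring

        -- Cauchy-Schwarz over pairs of rows removes `a`; the sum of the squared codegrees is the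
        -- four-cycle sum bounded by `oct`.
        T²≤ : T * T ≤ (x * x) * ((θ * θ) * (θ * θ) * (x * x) * (y * y))
        T²≤ = begin
          T * T  ≡⟨ cong (λ s → s * s) T-codeg ⟩
          _      ≤⟨ cauchy-schwarz (fin n ⊗ fin n) (λ { (u₀ , u₁) → iaX u₀ * iaX u₁ }) (λ { (u₀ , u₁) → codeg u₀ u₁ })
                      (0<* 0<x 0<x) weights ⟩
          (x * x) * (∑ n λ u₀ → ∑ n λ u₁ → codeg u₀ u₁ * codeg u₀ u₁)
                 ≡⟨ cong ((x * x) *_) (∑-cong λ u₀ → ∑-cong λ u₁ →
                      trans (∑-prod (λ w → dev u₀ w * dev u₁ w) (λ w → dev u₀ w * dev u₁ w))
                            (∑-cong λ w₀ → ∑-cong λ w₁ → e (dev u₀ w₀) (dev u₁ w₀) (dev u₀ w₁) (dev u₁ w₁))) ⟩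
          _      ≤⟨ *-monoˡ (x * x) (0≤sq x) oct ⟩
          _ ∎
          where
          e : ∀ a b c d → (a * b) * (c * d) ≡ a * c * b * d
          e = solve-∀ ℚring
          e' : ∀ a b → (a * b) * (a * b) ≡ (a * a) * (b * b)
          e' = solve-∀ ℚring
          weights : (∑ n λ u₀ → ∑ n λ u₁ → (iaX u₀ * iaX u₁) * (iaX u₀ * iaX u₁)) ≤ x * x
          weights = ≤-trans (∑-mono λ u₀ → ∑-mono λ u₁ → ≤-trans (≤-eq (e' (iaX u₀) (iaX u₁)))
              (*-mono (0≤ind (X u₀)) (0≤sq (iaX u₁)) (ind*-idem (a u₀) (X u₀)) (ind*-idem (a u₁) (X u₁))))
            (≤-eq (sym (∑-prod (λ u → ind (X u)) (λ u → ind (X u)))))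

        T≤ : T ≤ (θ * θ) * (x * x) * y
        T≤ = sq-cancel (0≤* (0≤* (0≤sq θ) (0≤sq x)) 0≤y) (≤-trans T²≤ (≤-eq (e θ x y)))
          where
          e : ∀ θ x y → (x * x) * ((θ * θ) * (θ * θ) * (x * x) * (y * y)) ≡
                        ((θ * θ) * (x * x) * y) * ((θ * θ) * (x * x) * y)
          e = solve-∀ ℚring

        S²≤' : S * S ≤ (θ * (x * y)) * (θ * (x * y))
        S²≤' = ≤-trans S²≤ (≤-trans (*-monoˡ y 0≤y T≤) (≤-eq (e θ x y)))
          where
          e : ∀ θ x y → y * ((θ * θ) * (x * x) * y) ≡ (θ * (x * y)) * (θ * (x * y))
          e = solve-∀ ℚring

        0≤θxy : 0ℚ ≤ θ * (x * y)
        0≤θxy = 0≤* 0≤θ (0≤* 0≤x 0≤y)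

        S≤ : S ≤ θ * (x * y)
        S≤ = sq-cancel 0≤θxy S²≤'

        -S≤ : - S ≤ θ * (x * y)
        -S≤ = sq-cancel 0≤θxy (≤-trans (≤-eq (e S)) S²≤')
          where
          e : ∀ s → (- s) * (- s) ≡ s * s
          e = solve-∀ ℚring

        edges : ℚ
        edges = ∑ n λ u → ∑ n λ w → ind (a u) * (ind (b w) * ind (p u w))

        expected : ℚ
        expected = D * ((∑ n λ u → ind (a u) * ind (X u)) * (∑ n λ w → ind (b w) * ind (Y w)))

        edges-expected : S ≡ edges - expected
        edges-expected = trans (∑-cong λ u → trans
            (∑-cong λ w → e (ind (a u)) (ind (b w)) (ind (p u w)) D (ind (X u)) (ind (Y w)))
            (∑-- (λ w → ind (a u) * (ind (b w) * ind (p u w))) _))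
          (trans (∑-- (λ u → ∑ n λ w → ind (a u) * (ind (b w) * ind (p u w))) _)
          (cong (λ s → edges - s) (trans (∑-cong λ u → ∑-*ˡ D λ w → (ind (a u) * ind (X u)) * (ind (b w) * ind (Y w)))
            (trans (∑-*ˡ D λ u → ∑ n λ w → (ind (a u) * ind (X u)) * (ind (b w) * ind (Y w)))
            (cong (D *_) (sym (∑-prod (λ u → ind (a u) * ind (X u)) (λ w → ind (b w) * ind (Y w)))))))))
          where
          e : ∀ a b p d x y → a * (b * (p - d * (x * y))) ≡ a * (b * p) - d * ((a * x) * (b * y))
          e = solve-∀ ℚring

        edges≤ : edges ≤ expected + θ * (x * y)
        edges≤ = 0≤-⇒≤ (subst (0ℚ ≤_) (trans (cong (λ s → θ * (x * y) - s) edges-expected) (e edges expected (θ * (x * y)))) (≤⇒0≤- S≤))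
          where
          e : ∀ a b c → c - (a - b) ≡ b + c - a
          e = solve-∀ ℚring

        edges≥ : expected - θ * (x * y) ≤ edges
        edges≥ = 0≤-⇒≤ (subst (0ℚ ≤_) (trans (cong (λ s → θ * (x * y) - - s) edges-expected) (e edges expected (θ * (x * y)))) (≤⇒0≤- -S≤))
          where
          e : ∀ a b c → c - - (a - b) ≡ a - (b - c)
          e = solve-∀ ℚring

  open QuasiRandomBigraphs

  -- Upper bounds for cherries, three-edge paths and four-cycles.

  module SubgraphCounts where

    private variable
      n : ℕ

    -- The assumption `θ≤D⁴` keeps the additive discrepancy error below the main term, so that each
    -- count is within a constant factor of its value in a random bigraph, however small the
    -- density.
    module Counting {X Y : Fin n → Bool} {p : Fin n → Fin n → Bool} {D θ : ℚ}
                    (Q : QuasiRandom X Y p D θ) (θ≤D⁴ : θ ≤ (D * D) * (D * D)) where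
      open QuasiRandom Q

      private
        0≤p : ∀ u w → 0ℚ ≤ ind (p u w)
        0≤p u w = 0≤ind (p u w)

      degˡ degʳ : Fin n → ℚ
      degˡ u = ∑ n λ w → ind (p u w)
      degʳ w = ∑ n λ u → ind (p u w)

      degˡ-support : ∀ u → (∑ n λ w → ind (p u w) * ind (Y w)) ≡ degˡ u
      degˡ-support u = ∑-cong λ w → trans (*-comm (ind (p u w)) (ind (Y w))) (sym (supportʳ u w))

      degʳ-support : ∀ w → (∑ n λ u → ind (p u w) * ind (X u)) ≡ degʳ w
      degʳ-support w = ∑-cong λ u → trans (*-comm (ind (p u w)) (ind (X u))) (sym (supportˡ u w))

      ∑degˡ : ∑ n degˡ ≡ D * (x * y)
      ∑degˡ = total

      ∑degʳ : ∑ n degʳ ≡ D * (x * y)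
      ∑degʳ = trans (∑-swap λ w u → ind (p u w)) total

      cherries : ℚ
      cherries = ∑ n λ u₀ → ∑ n λ u₁ → ∑ n λ w → ind (p u₀ w) * ind (p u₁ w)

      cherries≤ : cherries ≤ (1ℚ + 1ℚ) * (D * D) * ((x * x) * y)
      cherries≤ = begin
        cherries                     ≤⟨ ∑-mono fibre ⟩
        (∑ n λ u → (D * x) * degˡ u + (θ * (x * y)) * ind (X u))
          ≡⟨ trans (∑-+ (λ u → (D * x) * degˡ u) (λ u → (θ * (x * y)) * ind (X u)))
                   (cong₂ _+_ (trans (∑-*ˡ (D * x) degˡ) (cong ((D * x) *_) ∑degˡ)) (∑-*ˡ (θ * (x * y)) λ u → ind (X u))) ⟩
        (D * x) * (D * (x * y)) + (θ * (x * y)) * x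
          ≤⟨ ≤-by (0≤* (≤⇒0≤- θ≤D²) (0≤* (0≤sq x) 0≤y)) (e D θ x y) ⟩
        (1ℚ + 1ℚ) * (D * D) * ((x * x) * y) ∎
        where
        D²≤1 : D * D ≤ 1ℚ
        D²≤1 = ≤-trans (*-mono 0≤1 0≤D D≤1 D≤1) (≤-eq refl)
        θ≤D² : θ ≤ D * D
        θ≤D² = ≤-trans θ≤D⁴ (≤-trans (*-monoˡ (D * D) (0≤sq D) D²≤1) (≤-eq (*-identityʳ (D * D))))
        e : ∀ D θ x y → (1ℚ + 1ℚ) * (D * D) * ((x * x) * y) ≡
            ((D * x) * (D * (x * y)) + (θ * (x * y)) * x) + (D * D - θ) * ((x * x) * y)
        e = solve-∀ ℚring
        module _ (u : Fin n) where
          open Discrepancy (λ _ → true) (p u)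
          edges≡ : edges ≡ ∑ n λ u₁ → ∑ n λ w → ind (p u w) * ind (p u₁ w)
          edges≡ = ∑-cong λ u₁ → ∑-cong λ w → *-identityˡ (ind (p u w) * ind (p u₁ w))
          expected≡ : expected ≡ D * (x * degˡ u)
          expected≡ = cong (D *_) (cong₂ _*_ (∑-cong λ v → *-identityˡ (ind (X v))) (degˡ-support u))
          -- Keeping the factor `ind (X u)` makes the error `θ * (x * y)` occur once per vertex of
          -- X, not once per vertex of the whole 3-graph.
          absorb : (∑ n λ u₁ → ∑ n λ w → ind (p u w) * ind (p u₁ w)) ≡
                   ind (X u) * ∑ n λ u₁ → ∑ n λ w → ind (p u w) * ind (p u₁ w)
          absorb = trans (∑-cong λ u₁ → trans (∑-cong λ w →
              trans (cong (_* ind (p u₁ w)) (supportˡ u w)) (*-assoc (ind (X u)) (ind (p u w)) (ind (p u₁ w))))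
              (∑-*ˡ (ind (X u)) λ w → ind (p u w) * ind (p u₁ w)))
            (∑-*ˡ (ind (X u)) λ u₁ → ∑ n λ w → ind (p u w) * ind (p u₁ w))
          deg-absorb : ind (X u) * degˡ u ≡ degˡ u
          deg-absorb = trans (sym (∑-*ˡ (ind (X u)) λ w → ind (p u w))) (∑-cong λ w → sym (supportˡ u w))
          e₁ : ∀ D x i d t → i * (D * (x * d) + t) ≡ (D * x) * (i * d) + t * i
          e₁ = solve-∀ ℚring
          fibre : (∑ n λ u₁ → ∑ n λ w → ind (p u w) * ind (p u₁ w)) ≤ (D * x) * degˡ u + (θ * (x * y)) * ind (X u)
          fibre = begin
            (∑ n λ u₁ → ∑ n λ w → ind (p u w) * ind (p u₁ w))  ≡⟨ trans absorb (cong (ind (X u) *_) (sym edges≡)) ⟩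
            ind (X u) * edges  ≤⟨ *-monoˡ (ind (X u)) (0≤ind (X u)) edges≤ ⟩
            ind (X u) * (expected + θ * (x * y)) ≡⟨ cong (λ s → ind (X u) * (s + θ * (x * y))) expected≡ ⟩
            ind (X u) * (D * (x * degˡ u) + θ * (x * y)) ≡⟨ e₁ D x (ind (X u)) (degˡ u) (θ * (x * y)) ⟩
            (D * x) * (ind (X u) * degˡ u) + (θ * (x * y)) * ind (X u) ≡⟨ cong (λ s → (D * x) * s + (θ * (x * y)) * ind (X u)) deg-absorb ⟩
            (D * x) * degˡ u + (θ * (x * y)) * ind (X u) ∎

      -- Paths and cycles through a pair u, w are the edges between the neighbourhoods of w and u.
      private
        module Between (u w : Fin n) where
          open Discrepancy (λ u' → p u' w) (λ w' → p u w') public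
          expected≡ : expected ≡ D * (degʳ w * degˡ u)
          expected≡ = cong (D *_) (cong₂ _*_ (degʳ-support w) (degˡ-support u))
          bound : edges ≤ D * (degʳ w * degˡ u) + θ * (x * y)
          bound = subst (λ s → edges ≤ s + θ * (x * y)) expected≡ edges≤

        between : Fin n → Fin n → ℚ
        between u w = Between.edges u w

      paths : ℚ
      paths = ∑ n λ u → ∑ n λ w → ind (p u w) * (degʳ w * degˡ u)

      -- The paths, given by their middle edge, are recounted by their two ends: for ends u and w
      -- the middle edge ranges over `between u w`, so discrepancy applies, and the main term
      -- becomes D times a product of two edge counts.
      paths≤ : paths ≤ (D * D * D + θ) * ((x * y) * (x * y))
      paths≤ = begin
        paths    ≡⟨ paths≡ ⟩
        (∑ n λ u → ∑ n λ w → (ind (X u) * ind (Y w)) * between u w)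
                 ≤⟨ (∑-mono λ u → ∑-mono λ w → ≤-trans
                       (*-monoˡ (ind (X u) * ind (Y w)) (0≤* (0≤ind (X u)) (0≤ind (Y w))) (Between.bound u w))
                       (fibre u w)) ⟩
        (∑ n λ u → ∑ n λ w → D * (degˡ u * degʳ w) + (θ * (x * y)) * (ind (X u) * ind (Y w)))
                 ≡⟨ (∑-cong λ u → trans (∑-+ (λ w → D * (degˡ u * degʳ w)) (λ w → (θ * (x * y)) * (ind (X u) * ind (Y w))))
                       (cong₂ _+_ (∑-*ˡ D λ w → degˡ u * degʳ w) (∑-*ˡ (θ * (x * y)) λ w → ind (X u) * ind (Y w)))) ⟩
        (∑ n λ u → D * (∑ n λ w → degˡ u * degʳ w) + (θ * (x * y)) * (∑ n λ w → ind (X u) * ind (Y w)))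
                 ≡⟨ trans (∑-+ (λ u → D * (∑ n λ w → degˡ u * degʳ w)) (λ u → (θ * (x * y)) * (∑ n λ w → ind (X u) * ind (Y w))))
                      (cong₂ _+_ (trans (∑-*ˡ D λ u → ∑ n λ w → degˡ u * degʳ w)
                                   (cong (D *_) (trans (sym (∑-prod degˡ degʳ)) (cong₂ _*_ ∑degˡ ∑degʳ))))
                                 (trans (∑-*ˡ (θ * (x * y)) λ u → ∑ n λ w → ind (X u) * ind (Y w))
                                   (cong ((θ * (x * y)) *_) (sym (∑-prod (λ u → ind (X u)) (λ w → ind (Y w))))))) ⟩
        D * ((D * (x * y)) * (D * (x * y))) + (θ * (x * y)) * (x * y) ≡⟨ e D θ (x * y) ⟩
        (D * D * D + θ) * ((x * y) * (x * y)) ∎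
        where
        e : ∀ D θ s → D * ((D * s) * (D * s)) + (θ * s) * s ≡ (D * D * D + θ) * (s * s)
        e = solve-∀ ℚring
        e₁ : ∀ a i b j c → a * (i * b * (j * c)) ≡ (i * j) * (b * (c * a))
        e₁ = solve-∀ ℚring
        pointwise : ∀ u w u' w' → ind (p u w) * (ind (p u' w) * ind (p u w')) ≡
          (ind (X u') * ind (Y w')) * (ind (p u w') * (ind (p u' w) * ind (p u w)))
        pointwise u w u' w' = trans (cong₂ (λ s t → ind (p u w) * (s * t)) (supportˡ u' w) (supportʳ u w'))
          (trans (e₁ (ind (p u w)) (ind (X u')) (ind (p u' w)) (ind (Y w')) (ind (p u w')))
            (cong ((ind (X u') * ind (Y w')) *_) (e₂ (ind (p u' w)) (ind (p u w')) (ind (p u w)))))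
          where
          e₂ : ∀ b c a → b * (c * a) ≡ c * (b * a)
          e₂ = solve-∀ ℚring
        paths≡ : paths ≡ ∑ n λ u → ∑ n λ w → (ind (X u) * ind (Y w)) * between u w
        paths≡ = begin-equality
          paths ≡⟨ (∑-cong λ u → ∑-cong λ w → trans (cong (ind (p u w) *_) (∑-prod (λ u' → ind (p u' w)) (λ w' → ind (p u w'))))
                     (trans (sym (∑-*ˡ (ind (p u w)) λ u' → ∑ n λ w' → ind (p u' w) * ind (p u w')))
                     (∑-cong λ u' → trans (sym (∑-*ˡ (ind (p u w)) λ w' → ind (p u' w) * ind (p u w')))
                       (∑-cong λ w' → pointwise u w u' w')))) ⟩
          (∑ n λ u → ∑ n λ w → ∑ n λ u' → ∑ n λ w' → F u w u' w')
                ≡⟨ (∑-cong λ u → swap₃ λ u' w' w → F u w u' w') ⟩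
          (∑ n λ u → ∑ n λ u' → ∑ n λ w' → ∑ n λ w → F u w u' w')
                ≡⟨ swap₃ (λ u' w' u → ∑ n λ w → F u w u' w') ⟩
          (∑ n λ u' → ∑ n λ w' → ∑ n λ u → ∑ n λ w → F u w u' w')
                ≡⟨ (∑-cong λ u' → ∑-cong λ w' → trans
                     (∑-cong λ u → ∑-*ˡ (ind (X u') * ind (Y w')) λ w → ind (p u w') * (ind (p u' w) * ind (p u w)))
                     (∑-*ˡ (ind (X u') * ind (Y w')) λ u → ∑ n λ w → ind (p u w') * (ind (p u' w) * ind (p u w)))) ⟩
          _ ∎
          where
          F : Fin n → Fin n → Fin n → Fin n → ℚ
          F u w u' w' = (ind (X u') * ind (Y w')) * (ind (p u w') * (ind (p u' w) * ind (p u w)))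
        fibre : ∀ u w → (ind (X u) * ind (Y w)) * (D * (degʳ w * degˡ u) + θ * (x * y)) ≤
                        D * (degˡ u * degʳ w) + (θ * (x * y)) * (ind (X u) * ind (Y w))
        fibre u w = ≤-trans (≤-eq (e₃ (ind (X u) * ind (Y w)) D (degʳ w) (degˡ u) (θ * (x * y))))
          (+-monoˡ-≤ ((θ * (x * y)) * (ind (X u) * ind (Y w)))
            (≤-trans (≤-eq (cong (_* (D * (degˡ u * degʳ w))) (sym (ind-∧ (X u) (Y w)))))
              (ind*≤ (X u ∧ Y w) (0≤* 0≤D (0≤* (0≤∑ λ w' → 0≤p u w') (0≤∑ λ u' → 0≤p u' w))))))
          where
          e₃ : ∀ i D a b t → i * (D * (a * b) + t) ≡ i * (D * (b * a)) + t * i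
          e₃ = solve-∀ ℚring

      cycles : ℚ
      cycles = ∑ n λ u₀ → ∑ n λ u₁ → ∑ n λ w₀ → ∑ n λ w₁ →
        ind (p u₀ w₀) * ind (p u₀ w₁) * ind (p u₁ w₀) * ind (p u₁ w₁)

      -- A four-cycle is an edge uw together with an edge of `between u w`. Discrepancy for the
      -- latter leaves D times the three-edge paths. The total coefficient is D⁴ + 2Dθ, at most 3D⁴
      -- since D ≤ 1 and θ ≤ D⁴.
      cycles≤ : cycles ≤ (1ℚ + 1ℚ + 1ℚ) * ((D * D) * (D * D)) * ((x * y) * (x * y))
      cycles≤ = begin
        cycles ≡⟨ cycles≡ ⟩
        (∑ n λ u → ∑ n λ w → ind (p u w) * between u w)
               ≤⟨ (∑-mono λ u → ∑-mono λ w → ≤-trans (*-monoˡ (ind (p u w)) (0≤p u w) (Between.bound u w))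
                    (≤-eq (e (ind (p u w)) D (degʳ w) (degˡ u) (θ * (x * y))))) ⟩
        (∑ n λ u → ∑ n λ w → D * (ind (p u w) * (degʳ w * degˡ u)) + (θ * (x * y)) * ind (p u w))
               ≡⟨ (∑-cong λ u → trans (∑-+ (λ w → D * (ind (p u w) * (degʳ w * degˡ u))) (λ w → (θ * (x * y)) * ind (p u w)))
                     (cong₂ _+_ (∑-*ˡ D λ w → ind (p u w) * (degʳ w * degˡ u)) (∑-*ˡ (θ * (x * y)) λ w → ind (p u w)))) ⟩
        (∑ n λ u → D * (∑ n λ w → ind (p u w) * (degʳ w * degˡ u)) + (θ * (x * y)) * degˡ u)
               ≡⟨ trans (∑-+ (λ u → D * (∑ n λ w → ind (p u w) * (degʳ w * degˡ u))) (λ u → (θ * (x * y)) * degˡ u))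
                      (cong₂ _+_ (∑-*ˡ D λ u → ∑ n λ w → ind (p u w) * (degʳ w * degˡ u))
                        (trans (∑-*ˡ (θ * (x * y)) degˡ) (cong ((θ * (x * y)) *_) ∑degˡ))) ⟩
        D * paths + (θ * (x * y)) * (D * (x * y))
               ≤⟨ +-monoˡ-≤ ((θ * (x * y)) * (D * (x * y))) (*-monoˡ D 0≤D paths≤) ⟩
        D * ((D * D * D + θ) * ((x * y) * (x * y))) + (θ * (x * y)) * (D * (x * y))
               ≤⟨ ≤-by (0≤* (0≤+ (0≤+ (≤⇒0≤- θ≤D⁴) (≤⇒0≤- θ≤D⁴)) (0≤* (0≤+ 0≤θ 0≤θ) (≤⇒0≤- D≤1))) (0≤sq (x * y))) (e' D θ (x * y)) ⟩
        (1ℚ + 1ℚ + 1ℚ) * ((D * D) * (D * D)) * ((x * y) * (x * y)) ∎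
        where
        e : ∀ i D a b t → i * (D * (a * b) + t) ≡ D * (i * (a * b)) + t * i
        e = solve-∀ ℚring
        e' : ∀ D θ s → (1ℚ + 1ℚ + 1ℚ) * ((D * D) * (D * D)) * (s * s) ≡
          (D * ((D * D * D + θ) * (s * s)) + (θ * s) * (D * s)) +
          (((D * D) * (D * D) - θ + ((D * D) * (D * D) - θ)) + (θ + θ) * (1ℚ - D)) * (s * s)
        e' = solve-∀ ℚring
        e₁ : ∀ a b c d → a * b * c * d ≡ a * (c * (b * d))
        e₁ = solve-∀ ℚring
        cycles≡ : cycles ≡ ∑ n λ u → ∑ n λ w → ind (p u w) * between u w
        cycles≡ = ∑-cong λ u → trans (∑-swap λ u₁ w₀ → ∑ n λ w₁ → ind (p u w₀) * ind (p u w₁) * ind (p u₁ w₀) * ind (p u₁ w₁))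
          (∑-cong λ w → trans (∑-cong λ u' → trans
              (∑-cong λ w' → e₁ (ind (p u w)) (ind (p u w')) (ind (p u' w)) (ind (p u' w')))
              (∑-*ˡ (ind (p u w)) λ w' → ind (p u' w) * (ind (p u w') * ind (p u' w'))))
            (∑-*ˡ (ind (p u w)) λ u' → ∑ n λ w' → ind (p u' w) * (ind (p u w') * ind (p u' w'))))

  open SubgraphCounts

  -- Lower bound for the triangles of a quasirandom triad on prescribed vertex subsets.

  module TriangleCounts where

    private variable
      n : ℕ

    triangles : (p₁ p₂ p₃ : Fin n → Fin n → Bool) (a b c : Fin n → Bool) → ℚ
    triangles {n} p₁ p₂ p₃ a b c = ∑ n λ u → ∑ n λ w → ∑ n λ z →
      (ind (a u) * (ind (b w) * ind (c z))) * (ind (p₁ u w) * (ind (p₂ u z) * ind (p₃ w z)))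

    restrict : (a X : Fin n → Bool) → ℚ
    restrict {n} a X = ∑ n λ u → ind (a u) * ind (X u)

    restrict≤ : (a X : Fin n → Bool) → restrict a X ≤ size X
    restrict≤ a X = ∑-mono λ u → ind*≤ (a u) (0≤ind (X u))

    0≤restrict : (a X : Fin n → Bool) → 0ℚ ≤ restrict a X
    0≤restrict a X = 0≤∑ λ u → 0≤* (0≤ind (a u)) (0≤ind (X u))

    module _ {X Y Z : Fin n → Bool} {p₁ p₂ p₃ : Fin n → Fin n → Bool} {D₁ D₂ D₃ θ : ℚ}
             (Q₁ : QuasiRandom X Y p₁ D₁ θ) (Q₂ : QuasiRandom X Z p₂ D₂ θ) (Q₃ : QuasiRandom Y Z p₃ D₃ θ)
             (a b c : Fin n → Bool) where
      private
        module Q₁ = QuasiRandom Q₁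
        module Q₂ = QuasiRandom Q₂
        module Q₃ = QuasiRandom Q₃
        x y z A B C : ℚ
        x = size X
        y = size Y
        z = size Z
        A = restrict a X
        B = restrict b Y
        C = restrict c Z

        module E₁ (k : Fin n) = Q₁.Discrepancy (λ u → a u ∧ p₂ u k) (λ w → b w ∧ p₃ w k)
        module E₂ (w : Fin n) = Q₂.Discrepancy a (λ k → c k ∧ p₃ w k)
        module E₃ = Q₃.Discrepancy b c

        α β γ : Fin n → ℚ
        α k = restrict (λ u → a u ∧ p₂ u k) X
        β k = restrict (λ w → b w ∧ p₃ w k) Y
        γ w = restrict (λ k → c k ∧ p₃ w k) Z

        -- What is left of the triangle count when `p₁` has been replaced by its density: cherries
        -- of `p₂` and `p₃` with apex k.
        K' : ℚ
        K' = ∑ n λ k → (ind (c k) * ind (Z k)) * (α k * β k)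

        e₁ : ∀ a b c p₁ p₂ p₃ z → (a * (b * c)) * (p₁ * ((z * p₂) * p₃)) ≡ (c * z) * ((a * p₂) * ((b * p₃) * p₁))
        e₁ = solve-∀ ℚring

        triangles-E₁ : triangles p₁ p₂ p₃ a b c ≡ ∑ n λ k → (ind (c k) * ind (Z k)) * E₁.edges k
        triangles-E₁ = trans (sym (swap₃ F)) (∑-cong λ k → trans
            (∑-cong λ u → trans (∑-cong λ w → pointwise u w k)
              (∑-*ˡ (ind (c k) * ind (Z k)) λ w → ind (a u ∧ p₂ u k) * (ind (b w ∧ p₃ w k) * ind (p₁ u w))))
            (∑-*ˡ (ind (c k) * ind (Z k)) λ u → ∑ n λ w → ind (a u ∧ p₂ u k) * (ind (b w ∧ p₃ w k) * ind (p₁ u w))))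
          where
          F : Fin n → Fin n → Fin n → ℚ
          F u w k = (ind (a u) * (ind (b w) * ind (c k))) * (ind (p₁ u w) * (ind (p₂ u k) * ind (p₃ w k)))
          pointwise : ∀ u w k → F u w k ≡ (ind (c k) * ind (Z k)) * (ind (a u ∧ p₂ u k) * (ind (b w ∧ p₃ w k) * ind (p₁ u w)))
          pointwise u w k = trans
            (cong (λ s → (ind (a u) * (ind (b w) * ind (c k))) * (ind (p₁ u w) * (s * ind (p₃ w k)))) (Q₂.supportʳ u k))
            (trans (e₁ (ind (a u)) (ind (b w)) (ind (c k)) (ind (p₁ u w)) (ind (p₂ u k)) (ind (p₃ w k)) (ind (Z k)))
            (cong ((ind (c k) * ind (Z k)) *_)
              (cong₂ (λ s t → s * (t * ind (p₁ u w))) (sym (ind-∧ (a u) (p₂ u k))) (sym (ind-∧ (b w) (p₃ w k))))))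

        K'-E₂ : K' ≡ ∑ n λ w → (ind (b w) * ind (Y w)) * E₂.edges w
        K'-E₂ = begin-equality
          K' ≡⟨ (∑-cong λ k → trans (cong ((ind (c k) * ind (Z k)) *_)
                  (∑-prod (λ u → ind (a u ∧ p₂ u k) * ind (X u)) (λ w → ind (b w ∧ p₃ w k) * ind (Y w))))
                  (trans (sym (∑-*ˡ (ind (c k) * ind (Z k)) λ u → ∑ n λ w → (ind (a u ∧ p₂ u k) * ind (X u)) * (ind (b w ∧ p₃ w k) * ind (Y w))))
                  (∑-cong λ u → trans (sym (∑-*ˡ (ind (c k) * ind (Z k)) λ w → (ind (a u ∧ p₂ u k) * ind (X u)) * (ind (b w ∧ p₃ w k) * ind (Y w))))
                  (∑-cong λ w → pointwise u w k)))) ⟩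
          (∑ n λ k → ∑ n λ u → ∑ n λ w → G w u k) ≡⟨ swap₃ (λ u w k → G w u k) ⟩
          (∑ n λ u → ∑ n λ w → ∑ n λ k → G w u k) ≡⟨ ∑-swap (λ u w → ∑ n λ k → G w u k) ⟩
          (∑ n λ w → ∑ n λ u → ∑ n λ k → G w u k) ≡⟨ (∑-cong λ w → trans
              (∑-cong λ u → ∑-*ˡ (ind (b w) * ind (Y w)) λ k → ind (a u) * (ind (c k ∧ p₃ w k) * ind (p₂ u k)))
              (∑-*ˡ (ind (b w) * ind (Y w)) λ u → ∑ n λ k → ind (a u) * (ind (c k ∧ p₃ w k) * ind (p₂ u k)))) ⟩
          _ ∎
          where
          G : Fin n → Fin n → Fin n → ℚ
          G w u k = (ind (b w) * ind (Y w)) * (ind (a u) * (ind (c k ∧ p₃ w k) * ind (p₂ u k)))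
          e : ∀ a b c p q x y z → (c * z) * (((a * p) * x) * ((b * q) * y)) ≡ (b * y) * (a * ((c * q) * (z * (x * p))))
          e = solve-∀ ℚring
          pointwise : ∀ u w k → (ind (c k) * ind (Z k)) * ((ind (a u ∧ p₂ u k) * ind (X u)) * (ind (b w ∧ p₃ w k) * ind (Y w))) ≡ G w u k
          pointwise u w k = trans
            (cong₂ (λ s t → (ind (c k) * ind (Z k)) * ((s * ind (X u)) * (t * ind (Y w)))) (ind-∧ (a u) (p₂ u k)) (ind-∧ (b w) (p₃ w k)))
            (trans (e (ind (a u)) (ind (b w)) (ind (c k)) (ind (p₂ u k)) (ind (p₃ w k)) (ind (X u)) (ind (Y w)) (ind (Z k)))
            (cong₂ (λ s t → (ind (b w) * ind (Y w)) * (ind (a u) * (s * t))) (sym (ind-∧ (c k) (p₃ w k)))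
              (sym (trans (Q₂.supportʳ u k) (cong (ind (Z k) *_) (Q₂.supportˡ u k))))))

        K''-E₃ : (∑ n λ w → (ind (b w) * ind (Y w)) * γ w) ≡ E₃.edges
        K''-E₃ = ∑-cong λ w → trans (sym (∑-*ˡ (ind (b w) * ind (Y w)) λ k → ind (c k ∧ p₃ w k) * ind (Z k)))
          (∑-cong λ k → trans (cong (λ s → (ind (b w) * ind (Y w)) * (s * ind (Z k))) (ind-∧ (c k) (p₃ w k)))
            (trans (e (ind (b w)) (ind (Y w)) (ind (c k)) (ind (p₃ w k)) (ind (Z k)))
              (cong (λ s → ind (b w) * (ind (c k) * s)) (sym (trans (Q₃.supportʳ w k) (cong (ind (Z k) *_) (Q₃.supportˡ w k)))))))
          where
          e : ∀ b y c p z → (b * y) * ((c * p) * z) ≡ b * (c * (z * (y * p)))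
          e = solve-∀ ℚring

        0≤θ = Q₁.0≤θ
        0≤x = Q₁.0≤x
        0≤y = Q₁.0≤y
        0≤z = Q₂.0≤y

        step₁ : D₁ * K' - (θ * (x * y)) * C ≤ triangles p₁ p₂ p₃ a b c
        step₁ = begin
          D₁ * K' - (θ * (x * y)) * C
            ≡⟨ sym (trans (∑-- (λ k → D₁ * ((ind (c k) * ind (Z k)) * (α k * β k))) (λ k → (θ * (x * y)) * (ind (c k) * ind (Z k))))
                 (cong₂ _-_ (∑-*ˡ D₁ λ k → (ind (c k) * ind (Z k)) * (α k * β k)) (∑-*ˡ (θ * (x * y)) λ k → ind (c k) * ind (Z k)))) ⟩
          (∑ n λ k → D₁ * ((ind (c k) * ind (Z k)) * (α k * β k)) - (θ * (x * y)) * (ind (c k) * ind (Z k)))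
            ≤⟨ (∑-mono λ k → ≤-trans (≤-eq (e D₁ (ind (c k) * ind (Z k)) (α k * β k) (θ * (x * y))))
                  (*-monoˡ (ind (c k) * ind (Z k)) (0≤* (0≤ind (c k)) (0≤ind (Z k))) (E₁.edges≥ k))) ⟩
          (∑ n λ k → (ind (c k) * ind (Z k)) * E₁.edges k) ≡⟨ sym triangles-E₁ ⟩
          triangles p₁ p₂ p₃ a b c ∎
          where
          e : ∀ D i s t → D * (i * s) - t * i ≡ i * (D * s - t)
          e = solve-∀ ℚring

        step₂ : (D₂ * A) * E₃.edges - (θ * (x * z)) * B ≤ K'
        step₂ = begin
          (D₂ * A) * E₃.edges - (θ * (x * z)) * B ≡⟨ cong (λ s → (D₂ * A) * s - (θ * (x * z)) * B) (sym K''-E₃) ⟩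
          (D₂ * A) * (∑ n λ w → (ind (b w) * ind (Y w)) * γ w) - (θ * (x * z)) * B
            ≡⟨ sym (trans (∑-- (λ w → (D₂ * A) * ((ind (b w) * ind (Y w)) * γ w)) (λ w → (θ * (x * z)) * (ind (b w) * ind (Y w))))
                 (cong₂ _-_ (∑-*ˡ (D₂ * A) λ w → (ind (b w) * ind (Y w)) * γ w) (∑-*ˡ (θ * (x * z)) λ w → ind (b w) * ind (Y w)))) ⟩
          (∑ n λ w → (D₂ * A) * ((ind (b w) * ind (Y w)) * γ w) - (θ * (x * z)) * (ind (b w) * ind (Y w)))
            ≤⟨ (∑-mono λ w → ≤-trans (≤-eq (e D₂ A (ind (b w) * ind (Y w)) (γ w) (θ * (x * z))))
                  (*-monoˡ (ind (b w) * ind (Y w)) (0≤* (0≤ind (b w)) (0≤ind (Y w))) (E₂.edges≥ w))) ⟩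
          (∑ n λ w → (ind (b w) * ind (Y w)) * E₂.edges w) ≡⟨ sym K'-E₂ ⟩
          K' ∎
          where
          e : ∀ D A i s t → (D * A) * (i * s) - t * i ≡ i * (D * (A * s) - t)
          e = solve-∀ ℚring

      -- The bigraphs are replaced by their densities one at a time: `p₁` between the neighbourhoods
      -- of a vertex of Z, then `p₂` between `a` and the neighbourhood of a vertex of Y, then `p₃`
      -- between `b` and `c`. Each replacement costs at most θ|X||Y||Z|, because densities and
      -- relative sizes are at most 1; `slack` collects what these estimates give away.
      triangles≥ : D₁ * D₂ * D₃ * (A * B * C) - (1ℚ + 1ℚ + 1ℚ) * (θ * (x * y * z)) ≤ triangles p₁ p₂ p₃ a b c
      triangles≥ = ≤-trans (≤-by slack (e D₁ D₂ D₃ θ x y z A B C E₃.edges)) (≤-trans (+-monoˡ-≤ (- ((θ * (x * y)) * C)) (*-monoˡ D₁ Q₁.0≤D step₂)) step₁)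
        where
        e : ∀ D₁ D₂ D₃ θ x y z A B C E →
          D₁ * ((D₂ * A) * E - (θ * (x * z)) * B) - (θ * (x * y)) * C ≡
          (D₁ * D₂ * D₃ * (A * B * C) - (1ℚ + 1ℚ + 1ℚ) * (θ * (x * y * z))) +
          (((D₁ * (D₂ * A)) * (E - (D₃ * (B * C) - θ * (y * z)))
           + (θ * (y * z)) * ((1ℚ - D₁) * x + D₁ * ((1ℚ - D₂) * x + D₂ * (x - A))))
           + ((θ * (x * z)) * ((1ℚ - D₁) * y + D₁ * (y - B)) + (θ * (x * y)) * (z - C)))
        e = solve-∀ ℚring
        slack : 0ℚ ≤ ((D₁ * (D₂ * A)) * (E₃.edges - (D₃ * (B * C) - θ * (y * z)))
           + (θ * (y * z)) * ((1ℚ - D₁) * x + D₁ * ((1ℚ - D₂) * x + D₂ * (x - A))))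
           + ((θ * (x * z)) * ((1ℚ - D₁) * y + D₁ * (y - B)) + (θ * (x * y)) * (z - C))
        slack = 0≤+ (0≤+ (0≤* (0≤* Q₁.0≤D (0≤* Q₂.0≤D (0≤restrict a X))) (≤⇒0≤- E₃.edges≥))
                         (0≤* (0≤* 0≤θ (0≤* 0≤y 0≤z))
                           (0≤+ (0≤* (≤⇒0≤- Q₁.D≤1) 0≤x) (0≤* Q₁.0≤D
                             (0≤+ (0≤* (≤⇒0≤- Q₂.D≤1) 0≤x) (0≤* Q₂.0≤D (≤⇒0≤- (restrict≤ a X))))))))
                    (0≤+ (0≤* (0≤* 0≤θ (0≤* 0≤x 0≤z)) (0≤+ (0≤* (≤⇒0≤- Q₁.D≤1) 0≤y) (0≤* Q₁.0≤D (≤⇒0≤- (restrict≤ b Y)))))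
                         (0≤* (0≤* 0≤θ (0≤* 0≤x 0≤y)) (≤⇒0≤- (restrict≤ c Z))))

  open TriangleCounts

  -- The Gowers-Cauchy-Schwarz inequality relative to a quasirandom triad.

  module OctahedronBound where

    private variable
      n : ℕ

    octahedra : (Fin n → Fin n → Fin n → ℚ) → ℚ
    octahedra {n} h = ∑ n λ u₀ → ∑ n λ u₁ → ∑ n λ w₀ → ∑ n λ w₁ → ∑ n λ z₀ → ∑ n λ z₁ →
      h u₀ w₀ z₀ * h u₀ w₀ z₁ * h u₀ w₁ z₀ * h u₀ w₁ z₁ *
      h u₁ w₀ z₀ * h u₁ w₀ z₁ * h u₁ w₁ z₀ * h u₁ w₁ z₁

    -- `κ` and `η` stand in for the square root of 3ω and the fourth root of 2κ. The function `h` is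
    -- tested against `φ` on pairs and `ψ` on single vertices; `φ` may be any relation, whatever its
    -- complexity.
    module _ {X Y Z : Fin n → Bool} {p₁ p₂ p₃ : Fin n → Fin n → Bool} {D₁ D₂ D₃ θ : ℚ}
             (Q₁ : QuasiRandom X Y p₁ D₁ θ) (Q₂ : QuasiRandom X Z p₂ D₂ θ) (Q₃ : QuasiRandom Y Z p₃ D₃ θ)
             (0<D₁ : 0ℚ < D₁) (0<D₂ : 0ℚ < D₂) (0<D₃ : 0ℚ < D₃)
             (θ≤D₁⁴ : θ ≤ (D₁ * D₁) * (D₁ * D₁)) (θ≤D₂⁴ : θ ≤ (D₂ * D₂) * (D₂ * D₂))
             (h : Fin n → Fin n → Fin n → ℚ)
             (h-p₁ : ∀ u w z → h u w z ≡ ind (p₁ u w) * h u w z)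
             (h-p₂ : ∀ u w z → h u w z ≡ ind (p₂ u z) * h u w z)
             (h-p₃ : ∀ u w z → h u w z ≡ ind (p₃ w z) * h u w z)
             {ω κ η : ℚ} (0≤κ : 0ℚ ≤ κ) (0≤η : 0ℚ ≤ η)
             (ω≤κ² : (1ℚ + 1ℚ + 1ℚ) * ω ≤ κ * κ) (κ≤η⁴ : (1ℚ + 1ℚ) * κ ≤ (η * η) * (η * η))
             (octahedra≤ : octahedra h ≤ ω * (((D₁ * D₁) * (D₁ * D₁)) * ((D₂ * D₂) * (D₂ * D₂)) * ((D₃ * D₃) * (D₃ * D₃)) *
                                       ((size X * size X) * (size Y * size Y) * (size Z * size Z))))
             (φ : Fin n → Fin n → Bool) (ψ : Fin n → Bool) where
      private
        module Q₁ = QuasiRandom Q₁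
        module Q₂ = QuasiRandom Q₂
        module Q₃ = QuasiRandom Q₃
        x y z : ℚ
        x = size X
        y = size Y
        z = size Z
        0≤x = Q₁.0≤x
        0≤y = Q₁.0≤y
        0≤z = Q₂.0≤y
        0<x = Q₁.0<x
        0<y = Q₁.0<y
        0<z = Q₂.0<y
        0≤D₁ = Q₁.0≤D
        0≤D₂ = Q₂.0≤D
        0≤D₃ = Q₃.0≤D

        h² : Fin n → Fin n → Fin n → Fin n → ℚ
        h² u₀ u₁ w k = h u₀ w k * h u₁ w k
        h⁴ : Fin n → Fin n → Fin n → Fin n → Fin n → ℚ
        h⁴ u₀ u₁ w₀ w₁ k = h² u₀ u₁ w₀ k * h² u₀ u₁ w₁ k

        p₂² : Fin n → Fin n → Fin n → Bool
        p₂² u₀ u₁ k = p₂ u₀ k ∧ p₂ u₁ k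
        p₁⁴ : Fin n → Fin n → Fin n → Fin n → Bool
        p₁⁴ u₀ u₁ w₀ w₁ = ((p₁ u₀ w₀ ∧ p₁ u₀ w₁) ∧ p₁ u₁ w₀) ∧ p₁ u₁ w₁
        φ² : Fin n → Fin n → Fin n → Bool
        φ² u₀ u₁ w = φ u₀ w ∧ φ u₁ w

        h²-p₂² : ∀ u₀ u₁ w k → h² u₀ u₁ w k ≡ ind (p₂² u₀ u₁ k) * h² u₀ u₁ w k
        h²-p₂² u₀ u₁ w k = trans (cong₂ _*_ (h-p₂ u₀ w k) (h-p₂ u₁ w k))
          (trans (e (ind (p₂ u₀ k)) (h u₀ w k) (ind (p₂ u₁ k)) (h u₁ w k))
            (cong (_* h² u₀ u₁ w k) (sym (ind-∧ (p₂ u₀ k) (p₂ u₁ k)))))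
          where
          e : ∀ p a q b → (p * a) * (q * b) ≡ (p * q) * (a * b)
          e = solve-∀ ℚring

        ind-p₁⁴ : ∀ u₀ u₁ w₀ w₁ → ind (p₁⁴ u₀ u₁ w₀ w₁) ≡ ind (p₁ u₀ w₀) * ind (p₁ u₀ w₁) * ind (p₁ u₁ w₀) * ind (p₁ u₁ w₁)
        ind-p₁⁴ u₀ u₁ w₀ w₁ = trans (ind-∧ ((p₁ u₀ w₀ ∧ p₁ u₀ w₁) ∧ p₁ u₁ w₀) (p₁ u₁ w₁)) (cong (_* ind (p₁ u₁ w₁))
          (trans (ind-∧ (p₁ u₀ w₀ ∧ p₁ u₀ w₁) (p₁ u₁ w₀)) (cong (_* ind (p₁ u₁ w₀)) (ind-∧ (p₁ u₀ w₀) (p₁ u₀ w₁)))))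

        h⁴-p₁⁴ : ∀ u₀ u₁ w₀ w₁ k → h⁴ u₀ u₁ w₀ w₁ k ≡ ind (p₁⁴ u₀ u₁ w₀ w₁) * h⁴ u₀ u₁ w₀ w₁ k
        h⁴-p₁⁴ u₀ u₁ w₀ w₁ k = trans (cong₂ _*_ (cong₂ _*_ (h-p₁ u₀ w₀ k) (h-p₁ u₁ w₀ k)) (cong₂ _*_ (h-p₁ u₀ w₁ k) (h-p₁ u₁ w₁ k)))
          (trans (e (ind (p₁ u₀ w₀)) (h u₀ w₀ k) (ind (p₁ u₁ w₀)) (h u₁ w₀ k) (ind (p₁ u₀ w₁)) (h u₀ w₁ k) (ind (p₁ u₁ w₁)) (h u₁ w₁ k))
            (cong (_* h⁴ u₀ u₁ w₀ w₁ k) (sym (ind-p₁⁴ u₀ u₁ w₀ w₁))))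
          where
          e : ∀ p a q b r c s d → ((p * a) * (q * b)) * ((r * c) * (s * d)) ≡ (p * r * q * s) * ((a * b) * (c * d))
          e = solve-∀ ℚring

        weight² : ∀ a b → (ind a * ind b) * (ind a * ind b) ≤ ind b
        weight² a b = ≤-trans (≤-eq (trans (cong₂ _*_ (sym (ind-∧ a b)) (sym (ind-∧ a b)))
          (trans (ind-idem (a ∧ b)) (ind-∧ a b)))) (ind*≤ a (0≤ind b))

        -- The variables are doubled one by one. Doubling u discards `ψ` and gives `S₂`, doubling w
        -- gives `S₄`, and doubling z discards `φ` and gives `octahedra h`.
        S S₂ S₄ : ℚ
        S = ∑ n λ u → ∑ n λ w → ∑ n λ k → ind (φ u w) * (ind (ψ k) * h u w k)

        f₁ : Fin n → Fin n → ℚ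
        f₁ w k = ∑ n λ u → ind (φ u w) * h u w k
        S₂ = ∑ n λ w → ∑ n λ k → f₁ w k * f₁ w k

        f₂ : Fin n → Fin n → Fin n → ℚ
        f₂ u₀ u₁ k = ∑ n λ w → ind (φ² u₀ u₁ w) * h² u₀ u₁ w k
        S₄ = ∑ n λ u₀ → ∑ n λ u₁ → ∑ n λ k → f₂ u₀ u₁ k * f₂ u₀ u₁ k

        f₄ : Fin n → Fin n → Fin n → Fin n → ℚ
        f₄ u₀ u₁ w₀ w₁ = ∑ n λ k → h⁴ u₀ u₁ w₀ w₁ k

        S≡ : S ≡ ∑ n λ w → ∑ n λ k → (ind (ψ k) * ind (p₃ w k)) * f₁ w k
        S≡ = trans (swap₃ λ w k u → ind (φ u w) * (ind (ψ k) * h u w k)) (∑-cong λ w → ∑-cong λ k →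
          trans (∑-cong λ u → trans (cong (λ s → ind (φ u w) * (ind (ψ k) * s)) (h-p₃ u w k))
                                    (e (ind (φ u w)) (ind (ψ k)) (ind (p₃ w k)) (h u w k)))
                (∑-*ˡ (ind (ψ k) * ind (p₃ w k)) λ u → ind (φ u w) * h u w k))
          where
          e : ∀ a b p h → a * (b * (p * h)) ≡ (b * p) * (a * h)
          e = solve-∀ ℚring

        -- The support of `h` supplies the weight `p₃`, so the Cauchy-Schwarz factor is the number
        -- of edges of `p₃` and not |Y||Z|. In the next two steps the same device brings in the
        -- cherries of `p₂` and the four-cycles of `p₁`; without it, powers of the densities would
        -- be lost.
        S²≤ : S * S ≤ (D₃ * (y * z)) * S₂
        S²≤ = subst (λ s → s * s ≤ (D₃ * (y * z)) * S₂) (sym S≡)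
          (cauchy-schwarz (fin n ⊗ fin n) (λ { (w , k) → ind (ψ k) * ind (p₃ w k) }) (λ { (w , k) → f₁ w k })
            (0<* 0<D₃ (0<* 0<y 0<z))
            (≤-trans (∑-mono λ w → ∑-mono λ k → weight² (ψ k) (p₃ w k)) (≤-eq Q₃.total)))

        S₂≡ : S₂ ≡ ∑ n λ u₀ → ∑ n λ u₁ → ∑ n λ k → ind (p₂² u₀ u₁ k) * f₂ u₀ u₁ k
        S₂≡ = begin-equality
          S₂ ≡⟨ (∑-cong λ w → ∑-cong λ k → ∑-prod (λ u → ind (φ u w) * h u w k) (λ u → ind (φ u w) * h u w k)) ⟩
          (∑ n λ w → ∑ n λ k → ∑ n λ u₀ → ∑ n λ u₁ → F w k u₀ u₁) ≡⟨ (∑-cong λ w → swap₃ λ u₀ u₁ k → F w k u₀ u₁) ⟩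
          (∑ n λ w → ∑ n λ u₀ → ∑ n λ u₁ → ∑ n λ k → F w k u₀ u₁) ≡⟨ swap₃ (λ u₀ u₁ w → ∑ n λ k → F w k u₀ u₁) ⟩
          (∑ n λ u₀ → ∑ n λ u₁ → ∑ n λ w → ∑ n λ k → F w k u₀ u₁) ≡⟨ (∑-cong λ u₀ → ∑-cong λ u₁ → ∑-swap λ w k → F w k u₀ u₁) ⟩
          (∑ n λ u₀ → ∑ n λ u₁ → ∑ n λ k → ∑ n λ w → F w k u₀ u₁)
            ≡⟨ (∑-cong λ u₀ → ∑-cong λ u₁ → ∑-cong λ k → trans (∑-cong λ w → pointwise u₀ u₁ w k)
                 (∑-*ˡ (ind (p₂² u₀ u₁ k)) λ w → ind (φ² u₀ u₁ w) * h² u₀ u₁ w k)) ⟩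
          _ ∎
          where
          F : Fin n → Fin n → Fin n → Fin n → ℚ
          F w k u₀ u₁ = (ind (φ u₀ w) * h u₀ w k) * (ind (φ u₁ w) * h u₁ w k)
          e : ∀ a h b h' → (a * h) * (b * h') ≡ (a * b) * (h * h')
          e = solve-∀ ℚring
          e' : ∀ a p h → a * (p * h) ≡ p * (a * h)
          e' = solve-∀ ℚring
          pointwise : ∀ u₀ u₁ w k → F w k u₀ u₁ ≡ ind (p₂² u₀ u₁ k) * (ind (φ² u₀ u₁ w) * h² u₀ u₁ w k)
          pointwise u₀ u₁ w k = trans (e (ind (φ u₀ w)) (h u₀ w k) (ind (φ u₁ w)) (h u₁ w k))
            (trans (cong₂ _*_ (sym (ind-∧ (φ u₀ w) (φ u₁ w))) (h²-p₂² u₀ u₁ w k))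
                   (e' (ind (φ² u₀ u₁ w)) (ind (p₂² u₀ u₁ k)) (h² u₀ u₁ w k)))

        S₂²≤ : S₂ * S₂ ≤ ((1ℚ + 1ℚ) * (D₂ * D₂) * ((x * x) * z)) * S₄
        S₂²≤ = subst (λ s → s * s ≤ ((1ℚ + 1ℚ) * (D₂ * D₂) * ((x * x) * z)) * S₄) (sym S₂≡)
          (cauchy-schwarz (fin n ⊗ fin n ⊗ fin n) (λ { (u₀ , u₁ , k) → ind (p₂² u₀ u₁ k) }) (λ { (u₀ , u₁ , k) → f₂ u₀ u₁ k })
            (0<* (0<* (positive⁻¹ (1ℚ + 1ℚ)) (0<* 0<D₂ 0<D₂)) (0<* (0<* 0<x 0<x) 0<z))
            (≤-trans (≤-eq (∑-cong λ u₀ → ∑-cong λ u₁ → ∑-cong λ k → trans (ind-idem (p₂² u₀ u₁ k)) (ind-∧ (p₂ u₀ k) (p₂ u₁ k))))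
              (Counting.cherries≤ Q₂ θ≤D₂⁴)))

        S₄≡ : S₄ ≡ ∑ n λ u₀ → ∑ n λ u₁ → ∑ n λ w₀ → ∑ n λ w₁ →
          (ind (φ² u₀ u₁ w₀ ∧ φ² u₀ u₁ w₁) * ind (p₁⁴ u₀ u₁ w₀ w₁)) * f₄ u₀ u₁ w₀ w₁
        S₄≡ = ∑-cong λ u₀ → ∑-cong λ u₁ → begin-equality
          (∑ n λ k → f₂ u₀ u₁ k * f₂ u₀ u₁ k)
            ≡⟨ (∑-cong λ k → ∑-prod (λ w → ind (φ² u₀ u₁ w) * h² u₀ u₁ w k) (λ w → ind (φ² u₀ u₁ w) * h² u₀ u₁ w k)) ⟩
          _ ≡⟨ swap₃ (λ w₀ w₁ k → (ind (φ² u₀ u₁ w₀) * h² u₀ u₁ w₀ k) * (ind (φ² u₀ u₁ w₁) * h² u₀ u₁ w₁ k)) ⟩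
          _ ≡⟨ (∑-cong λ w₀ → ∑-cong λ w₁ → trans (∑-cong λ k → pointwise u₀ u₁ w₀ w₁ k)
                 (∑-*ˡ (ind (φ² u₀ u₁ w₀ ∧ φ² u₀ u₁ w₁) * ind (p₁⁴ u₀ u₁ w₀ w₁)) λ k → h⁴ u₀ u₁ w₀ w₁ k)) ⟩
          _ ∎
          where
          e : ∀ a h b h' → (a * h) * (b * h') ≡ (a * b) * (h * h')
          e = solve-∀ ℚring
          e' : ∀ a p h → a * (p * h) ≡ (a * p) * h
          e' = solve-∀ ℚring
          pointwise : ∀ u₀ u₁ w₀ w₁ k → (ind (φ² u₀ u₁ w₀) * h² u₀ u₁ w₀ k) * (ind (φ² u₀ u₁ w₁) * h² u₀ u₁ w₁ k) ≡
            (ind (φ² u₀ u₁ w₀ ∧ φ² u₀ u₁ w₁) * ind (p₁⁴ u₀ u₁ w₀ w₁)) * h⁴ u₀ u₁ w₀ w₁ k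
          pointwise u₀ u₁ w₀ w₁ k = trans (e (ind (φ² u₀ u₁ w₀)) (h² u₀ u₁ w₀ k) (ind (φ² u₀ u₁ w₁)) (h² u₀ u₁ w₁ k))
            (trans (cong₂ _*_ (sym (ind-∧ (φ² u₀ u₁ w₀) (φ² u₀ u₁ w₁))) (h⁴-p₁⁴ u₀ u₁ w₀ w₁ k))
                   (e' (ind (φ² u₀ u₁ w₀ ∧ φ² u₀ u₁ w₁)) (ind (p₁⁴ u₀ u₁ w₀ w₁)) (h⁴ u₀ u₁ w₀ w₁ k)))

        octahedra≡ : (∑ n λ u₀ → ∑ n λ u₁ → ∑ n λ w₀ → ∑ n λ w₁ → f₄ u₀ u₁ w₀ w₁ * f₄ u₀ u₁ w₀ w₁) ≡ octahedra h
        octahedra≡ = ∑-cong λ u₀ → ∑-cong λ u₁ → ∑-cong λ w₀ → ∑-cong λ w₁ →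
          trans (∑-prod (λ k → h⁴ u₀ u₁ w₀ w₁ k) (λ k → h⁴ u₀ u₁ w₀ w₁ k)) (∑-cong λ z₀ → ∑-cong λ z₁ →
            e (h u₀ w₀ z₀) (h u₀ w₀ z₁) (h u₀ w₁ z₀) (h u₀ w₁ z₁) (h u₁ w₀ z₀) (h u₁ w₀ z₁) (h u₁ w₁ z₀) (h u₁ w₁ z₁))
          where
          e : ∀ a b c d a' b' c' d' → ((a * a') * (c * c')) * ((b * b') * (d * d')) ≡ a * b * c * d * a' * b' * c' * d'
          e = solve-∀ ℚring

        M₄ : ℚ
        M₄ = (1ℚ + 1ℚ + 1ℚ) * ((D₁ * D₁) * (D₁ * D₁)) * ((x * y) * (x * y))

        0<M₄ : 0ℚ < M₄
        0<M₄ = 0<* (0<* (positive⁻¹ (1ℚ + 1ℚ + 1ℚ)) (0<* (0<* 0<D₁ 0<D₁) (0<* 0<D₁ 0<D₁))) (0<* (0<* 0<x 0<y) (0<* 0<x 0<y))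

        S₄²≤ : S₄ * S₄ ≤ M₄ * octahedra h
        S₄²≤ = ≤-trans (subst (λ s → s * s ≤ M₄ * O) (sym S₄≡)
          (cauchy-schwarz (fin n ⊗ fin n ⊗ fin n ⊗ fin n)
            (λ { (u₀ , u₁ , w₀ , w₁) → ind (φ² u₀ u₁ w₀ ∧ φ² u₀ u₁ w₁) * ind (p₁⁴ u₀ u₁ w₀ w₁) })
            (λ { (u₀ , u₁ , w₀ , w₁) → f₄ u₀ u₁ w₀ w₁ }) 0<M₄
            (≤-trans (∑-mono λ u₀ → ∑-mono λ u₁ → ∑-mono λ w₀ → ∑-mono λ w₁ → ≤-trans
                (weight² (φ² u₀ u₁ w₀ ∧ φ² u₀ u₁ w₁) (p₁⁴ u₀ u₁ w₀ w₁)) (≤-eq (ind-p₁⁴ u₀ u₁ w₀ w₁)))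
              (Counting.cycles≤ Q₁ θ≤D₁⁴))))
          (≤-eq (cong (M₄ *_) octahedra≡))
          where
          O = ∑ n λ u₀ → ∑ n λ u₁ → ∑ n λ w₀ → ∑ n λ w₁ → f₄ u₀ u₁ w₀ w₁ * f₄ u₀ u₁ w₀ w₁

        -- Expected numbers of triangles (`B₁`), of pairs of triangles sharing w and z (`B₂`), and
        -- of systems of four triangles on u₀, u₁, w₀, w₁ and one z (`B₄`). Measured in these units,
        -- the three Cauchy-Schwarz steps involve no densities.
        B₄ B₂ B₁ : ℚ
        B₄ = ((D₁ * D₁) * (D₁ * D₁)) * (D₂ * D₂) * (D₃ * D₃) * ((x * x) * (y * y) * z)
        B₂ = (D₁ * D₁) * (D₂ * D₂) * D₃ * ((x * x) * y * z)
        B₁ = D₁ * D₂ * D₃ * (x * y * z)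

        0≤B₄ : 0ℚ ≤ B₄
        0≤B₄ = 0≤* (0≤* (0≤* (0≤sq (D₁ * D₁)) (0≤sq D₂)) (0≤sq D₃)) (0≤* (0≤* (0≤sq x) (0≤sq y)) 0≤z)
        0≤B₂ : 0ℚ ≤ B₂
        0≤B₂ = 0≤* (0≤* (0≤* (0≤sq D₁) (0≤sq D₂)) 0≤D₃) (0≤* (0≤* (0≤sq x) 0≤y) 0≤z)
        0≤B₁ : 0ℚ ≤ B₁
        0≤B₁ = 0≤* (0≤* (0≤* 0≤D₁ 0≤D₂) 0≤D₃) (0≤* (0≤* 0≤x 0≤y) 0≤z)

        S₄≤ : S₄ ≤ κ * B₄
        S₄≤ = sq-cancel (0≤* 0≤κ 0≤B₄) (begin
          S₄ * S₄  ≤⟨ S₄²≤ ⟩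
          M₄ * octahedra h ≤⟨ *-monoˡ M₄ (<⇒≤ 0<M₄) octahedra≤ ⟩
          _ ≡⟨ e D₁ D₂ D₃ x y z ω ⟩
          ((1ℚ + 1ℚ + 1ℚ) * ω) * (B₄ * B₄) ≤⟨ *-monoʳ (B₄ * B₄) (0≤sq B₄) ω≤κ² ⟩
          (κ * κ) * (B₄ * B₄) ≡⟨ e' κ B₄ ⟩
          (κ * B₄) * (κ * B₄) ∎)
          where
          e : ∀ D₁ D₂ D₃ x y z ω → (1ℚ + 1ℚ + 1ℚ) * ((D₁ * D₁) * (D₁ * D₁)) * ((x * y) * (x * y)) *
             (ω * (((D₁ * D₁) * (D₁ * D₁)) * ((D₂ * D₂) * (D₂ * D₂)) * ((D₃ * D₃) * (D₃ * D₃)) * ((x * x) * (y * y) * (z * z)))) ≡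
             ((1ℚ + 1ℚ + 1ℚ) * ω) * ((((D₁ * D₁) * (D₁ * D₁)) * (D₂ * D₂) * (D₃ * D₃) * ((x * x) * (y * y) * z)) *
                                     (((D₁ * D₁) * (D₁ * D₁)) * (D₂ * D₂) * (D₃ * D₃) * ((x * x) * (y * y) * z)))
          e = solve-∀ ℚring
          e' : ∀ a b → (a * a) * (b * b) ≡ (a * b) * (a * b)
          e' = solve-∀ ℚring

        S₂≤ : S₂ ≤ (η * η) * B₂
        S₂≤ = sq-cancel (0≤* (0≤sq η) 0≤B₂) (begin
          S₂ * S₂  ≤⟨ S₂²≤ ⟩
          _ ≤⟨ *-monoˡ ((1ℚ + 1ℚ) * (D₂ * D₂) * ((x * x) * z))
                 (0≤* (0≤* (nonNegative⁻¹ (1ℚ + 1ℚ)) (0≤sq D₂)) (0≤* (0≤sq x) 0≤z)) S₄≤ ⟩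
          _ ≡⟨ e D₁ D₂ D₃ x y z κ ⟩
          ((1ℚ + 1ℚ) * κ) * (B₂ * B₂) ≤⟨ *-monoʳ (B₂ * B₂) (0≤sq B₂) κ≤η⁴ ⟩
          ((η * η) * (η * η)) * (B₂ * B₂) ≡⟨ e' (η * η) B₂ ⟩
          _ ∎)
          where
          e : ∀ D₁ D₂ D₃ x y z κ → (1ℚ + 1ℚ) * (D₂ * D₂) * ((x * x) * z) *
             (κ * (((D₁ * D₁) * (D₁ * D₁)) * (D₂ * D₂) * (D₃ * D₃) * ((x * x) * (y * y) * z))) ≡
             ((1ℚ + 1ℚ) * κ) * (((D₁ * D₁) * (D₂ * D₂) * D₃ * ((x * x) * y * z)) * ((D₁ * D₁) * (D₂ * D₂) * D₃ * ((x * x) * y * z)))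
          e = solve-∀ ℚring
          e' : ∀ a b → (a * a) * (b * b) ≡ (a * b) * (a * b)
          e' = solve-∀ ℚring

        S²≤' : S * S ≤ (η * B₁) * (η * B₁)
        S²≤' = begin
          S * S  ≤⟨ S²≤ ⟩
          _ ≤⟨ *-monoˡ (D₃ * (y * z)) (0≤* 0≤D₃ (0≤* 0≤y 0≤z)) S₂≤ ⟩
          _ ≡⟨ e D₁ D₂ D₃ x y z η ⟩
          _ ∎
          where
          e : ∀ D₁ D₂ D₃ x y z η → (D₃ * (y * z)) * ((η * η) * ((D₁ * D₁) * (D₂ * D₂) * D₃ * ((x * x) * y * z))) ≡
             (η * (D₁ * D₂ * D₃ * (x * y * z))) * (η * (D₁ * D₂ * D₃ * (x * y * z)))
          e = solve-∀ ℚring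

      correlation : ℚ
      correlation = ∑ n λ u → ∑ n λ w → ∑ n λ k → ind (φ u w) * (ind (ψ k) * h u w k)

      correlation≤ : correlation ≤ η * (D₁ * D₂ * D₃ * (size X * size Y * size Z))
      correlation≤ = sq-cancel (0≤* 0≤η 0≤B₁) S²≤'

      -correlation≤ : - correlation ≤ η * (D₁ * D₂ * D₃ * (size X * size Y * size Z))
      -correlation≤ = sq-cancel (0≤* 0≤η 0≤B₁) (≤-trans (≤-eq (e S)) S²≤')
        where
        e : ∀ s → (- s) * (- s) ≡ s * s
        e = solve-∀ ℚring

  open OctahedronBound

  -- Cardinalities, densities and dev₂ rewritten as sums of indicators.

  module CountsAsSums where

    private variable
      n : ℕ

    toℚ-+ : ∀ a b → toℚ (a ℕ.+ b) ≡ toℚ a + toℚ b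
    toℚ-+ a b = toℚᵘ-injective (ℚᵘ.≃-trans (toℚᵘ-fromℚᵘ (ℚᵘ.mkℚᵘ (ℤ.+ (a ℕ.+ b)) 0)) (ℚᵘ.≃-trans eq
      (ℚᵘ.≃-sym (ℚᵘ.≃-trans (toℚᵘ-homo-+ (toℚ a) (toℚ b))
        (ℚᵘ.+-cong (toℚᵘ-fromℚᵘ (ℚᵘ.mkℚᵘ (ℤ.+ a) 0)) (toℚᵘ-fromℚᵘ (ℚᵘ.mkℚᵘ (ℤ.+ b) 0)))))))
      where
      eq : ℚᵘ.mkℚᵘ (ℤ.+ (a ℕ.+ b)) 0 ℚᵘ.≃ ℚᵘ.mkℚᵘ (ℤ.+ a) 0 ℚᵘ.+ ℚᵘ.mkℚᵘ (ℤ.+ b) 0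
      eq = ℚᵘ.*≡* (cong (ℤ._* ℤ.+ 1) (sym (cong₂ ℤ._+_ (ℤ.*-identityʳ (ℤ.+ a)) (ℤ.*-identityʳ (ℤ.+ b)))))

    toℚ-* : ∀ a b → toℚ (a ℕ.* b) ≡ toℚ a * toℚ b
    toℚ-* zero b = sym (*-zeroˡ (toℚ b))
    toℚ-* (suc a) b = trans (toℚ-+ b (a ℕ.* b)) (trans (cong (toℚ b +_) (toℚ-* a b))
      (trans (e (toℚ a) (toℚ b)) (cong (_* toℚ b) (sym (toℚ-+ 1 a)))))
      where
      e : ∀ a b → b + a * b ≡ (1ℚ + a) * b
      e = solve-∀ ℚring

    0≤toℚ : ∀ a → 0ℚ ≤ toℚ a
    0≤toℚ zero = ≤-refl
    0≤toℚ (suc a) = subst (0ℚ ≤_) (sym (toℚ-+ 1 a)) (0≤+ 0≤1 (0≤toℚ a))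

    toℚ-mono : ∀ {a b} → a ℕ.≤ b → toℚ a ≤ toℚ b
    toℚ-mono {a} {b} p = ≤-by (0≤toℚ (b ℕ.∸ a)) (trans (cong toℚ (sym (ℕ.m+[n∸m]≡n p))) (toℚ-+ a (b ℕ.∸ a)))

    0<toℚ : ∀ a → 0ℚ < toℚ (suc a)
    0<toℚ a = <-≤-trans 0<1 (toℚ-mono (ℕ.s≤s (ℕ.z≤n {a})))

    frac-* : ∀ a b → toℚ (suc b) * frac a (suc b) ≡ toℚ a
    frac-* a b = toℚᵘ-injective (ℚᵘ.≃-trans (toℚᵘ-homo-* (toℚ (suc b)) (frac a (suc b)))
      (ℚᵘ.≃-trans (ℚᵘ.*-cong (toℚᵘ-fromℚᵘ (ℚᵘ.mkℚᵘ (ℤ.+ suc b) 0)) (toℚᵘ-fromℚᵘ (ℚᵘ.mkℚᵘ (ℤ.+ a) b)))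
      (ℚᵘ.≃-trans eq (ℚᵘ.≃-sym (toℚᵘ-fromℚᵘ (ℚᵘ.mkℚᵘ (ℤ.+ a) 0))))))
      where
      eq : ℚᵘ.mkℚᵘ (ℤ.+ suc b) 0 ℚᵘ.* ℚᵘ.mkℚᵘ (ℤ.+ a) b ℚᵘ.≃ ℚᵘ.mkℚᵘ (ℤ.+ a) 0
      eq = ℚᵘ.*≡* (trans (ℤ.*-identityʳ (ℤ.+ suc b ℤ.* ℤ.+ a)) (trans (ℤ.*-comm (ℤ.+ suc b) (ℤ.+ a))
        (cong (ℤ.+ a ℤ.*_) (cong ℤ.+_ (cong suc (sym (ℕ.+-identityʳ b)))))))

    0≤frac : ∀ a b → 0ℚ ≤ frac a b
    0≤frac a zero = ≤-refl
    0≤frac a (suc b) = *-cancel (toℚ (suc b)) (0<toℚ b)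
      (≤-trans (≤-eq (*-zeroʳ (toℚ (suc b)))) (≤-trans (0≤toℚ a) (≤-eq (sym (frac-* a b)))))

    frac≤1 : ∀ {a b} → toℚ a ≤ toℚ b → frac a b ≤ 1ℚ
    frac≤1 {a} {zero} p = 0≤1
    frac≤1 {a} {suc b} p = *-cancel (toℚ (suc b)) (0<toℚ b)
      (≤-trans (≤-eq (frac-* a b)) (≤-trans p (≤-eq (sym (*-identityʳ (toℚ (suc b)))))))

    count-size : (p : Fin n → Bool) → toℚ (count n p) ≡ size p
    count-size {zero} p = refl
    count-size {suc n} p with p zero
    ... | true = trans (toℚ-+ 1 (count n λ i → p (suc i))) (cong (1ℚ +_) (count-size λ i → p (suc i)))
    ... | false = trans (count-size λ i → p (suc i)) (sym (+-identityˡ (size λ i → p (suc i))))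

    sumℕ-∑ : (f : Fin n → ℕ) → toℚ (sumℕ n f) ≡ ∑ n λ i → toℚ (f i)
    sumℕ-∑ {zero} f = refl
    sumℕ-∑ {suc n} f = trans (toℚ-+ (f zero) (sumℕ n λ i → f (suc i))) (cong (toℚ (f zero) +_) (sumℕ-∑ λ i → f (suc i)))

    count2-∑ : (p : Fin n → Fin n → Bool) → toℚ (count2 n p) ≡ ∑ n λ u → ∑ n λ w → ind (p u w)
    count2-∑ {n} p = trans (sumℕ-∑ λ u → count n (p u)) (∑-cong λ u → count-size (p u))

    count3-∑ : (p : Fin n → Fin n → Fin n → Bool) → toℚ (count3 n p) ≡ ∑ n λ u → ∑ n λ w → ∑ n λ z → ind (p u w z)
    count3-∑ {n} p = trans (sumℕ-∑ λ u → count2 n (p u)) (∑-cong λ u → count2-∑ (p u))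

    ∑-const : ∀ n c → ∑ n (λ _ → c) ≡ toℚ n * c
    ∑-const zero c = sym (*-zeroˡ c)
    ∑-const (suc n) c = trans (cong (c +_) (∑-const n c)) (trans (e c (toℚ n)) (cong (_* c) (sym (toℚ-+ 1 n))))
      where
      e : ∀ c k → c + k * c ≡ (1ℚ + k) * c
      e = solve-∀ ℚring

    eqF-suc : ∀ {t} (i j : Fin t) → eqF (suc i) (suc j) ≡ eqF i j
    eqF-suc i j with i F.≟ j
    ... | yes _ = refl
    ... | no _ = refl

    ∑-delta : (i : Fin n) (f : Fin n → ℚ) → (∑ n λ j → ind (eqF i j) * f j) ≡ f i
    ∑-delta {suc n} zero f = trans (cong₂ _+_ (*-identityˡ (f zero))
        (trans (∑-cong λ j → *-zeroˡ (f (suc j))) (∑-0 {n}))) (+-identityʳ (f zero))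
    ∑-delta {suc n} (suc i) f = trans (cong₂ _+_ (*-zeroˡ (f zero))
        (trans (∑-cong λ j → cong (λ b → ind b * f (suc j)) (eqF-suc i j)) (∑-delta i λ j → f (suc j)))) (+-identityˡ (f (suc i)))

    eqF⇒≡ : ∀ {t} (i j : Fin t) → eqF i j ≡ true → i ≡ j
    eqF⇒≡ i j p with i F.≟ j
    ... | yes q = q

    eqF-refl : ∀ {t} (i : Fin t) → eqF i i ≡ true
    eqF-refl i with i F.≟ i
    ... | yes _ = refl
    ... | no q = ⊥-elim (q refl)

    module _ (B : Bigraph n) where
      open Bigraph B

      private
        D : ℚ
        D = densB B

      Eʳ-supportˡ : ∀ u w → ind (Eʳ B u w) ≡ ind (U u) * ind (Eʳ B u w)
      Eʳ-supportˡ u w with U u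
      ... | true = sym (*-identityˡ (ind (W w ∧ E u w)))
      ... | false = refl

      Eʳ-supportʳ : ∀ u w → ind (Eʳ B u w) ≡ ind (W w) * ind (Eʳ B u w)
      Eʳ-supportʳ u w with U u | W w
      ... | true | true = sym (*-identityˡ (ind (E u w)))
      ... | true | false = refl
      ... | false | b = sym (*-zeroʳ (ind b))

      densB-total : 0ℚ < size U → 0ℚ < size W → (∑ n λ u → ∑ n λ w → ind (Eʳ B u w)) ≡ D * (size U * size W)
      densB-total p q = trans (sym (count2-∑ (Eʳ B))) (trans (lemma (count2 n (Eʳ B)) (count n U ℕ.* count n W)
          (subst (0ℚ <_) (sym size-*) (0<* p q))) (cong (D *_) size-*))
        where
        size-* : toℚ (count n U ℕ.* count n W) ≡ size U * size W
        size-* = trans (toℚ-* (count n U) (count n W)) (cong₂ _*_ (count-size U) (count-size W))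
        lemma : ∀ a b → 0ℚ < toℚ b → toℚ a ≡ frac a b * toℚ b
        lemma a zero r = ⊥-elim (<-irrefl refl r)
        lemma a (suc b) r = trans (sym (frac-* a b)) (*-comm (toℚ (suc b)) (frac a (suc b)))

      densB≤1 : 0ℚ < size U → 0ℚ < size W → D ≤ 1ℚ
      densB≤1 p q = *-cancel (size U * size W) (0<* p q) (begin
        (size U * size W) * D   ≡⟨ trans (*-comm (size U * size W) D) (sym (densB-total p q)) ⟩
        (∑ n λ u → ∑ n λ w → ind (Eʳ B u w))
          ≤⟨ (∑-mono λ u → ∑-mono λ w → ≤-trans (≤-eq (Eʳ-supportˡ u w)) (*-monoˡ (ind (U u)) (0≤ind (U u))
                (≤-trans (≤-eq (Eʳ-supportʳ u w)) (≤-trans (*-monoˡ (ind (W w)) (0≤ind (W w)) (ind≤1 (Eʳ B u w))) (≤-eq (*-identityʳ (ind (W w)))))))) ⟩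
        (∑ n λ u → ∑ n λ w → ind (U u) * ind (W w)) ≡⟨ sym (∑-prod (λ u → ind (U u)) (λ w → ind (W w))) ⟩
        size U * size W ≡⟨ sym (*-identityʳ (size U * size W)) ⟩
        (size U * size W) * 1ℚ ∎)

      gB-ind : ∀ u w → gB B u w ≡ ind (Eʳ B u w) - D
      gB-ind u w with Eʳ B u w
      ... | true = refl
      ... | false = sym (+-identityˡ (- D))

      deviation-gB : ∀ u w → deviation U W (Eʳ B) D u w ≡ (ind (U u) * ind (W w)) * gB B u w
      deviation-gB u w = trans (cong (_- D * (ind (U u) * ind (W w))) (trans (Eʳ-supportˡ u w) (cong (ind (U u) *_) (Eʳ-supportʳ u w))))
        (trans (e (ind (U u)) (ind (W w)) (ind (Eʳ B u w)) D) (cong ((ind (U u) * ind (W w)) *_) (sym (gB-ind u w))))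
        where
        e : ∀ a b p D → a * (b * p) - D * (a * b) ≡ (a * b) * (p - D)
        e = solve-∀ ℚring

      octB-deviation : octB B ≡ ∑ n λ u₀ → ∑ n λ u₁ → ∑ n λ w₀ → ∑ n λ w₁ → let g = deviation U W (Eʳ B) D in
        g u₀ w₀ * g u₀ w₁ * g u₁ w₀ * g u₁ w₁
      octB-deviation = ∑-cong λ u₀ → ∑-cong λ u₁ → ∑-cong λ w₀ → ∑-cong λ w₁ → sym (pointwise u₀ u₁ w₀ w₁)
        where
        g = deviation U W (Eʳ B) D
        e : ∀ a b c d g₁ g₂ g₃ g₄ → ((a * c) * g₁) * ((a * d) * g₂) * ((b * c) * g₃) * ((b * d) * g₄) ≡
          ((a * a) * ((b * b) * ((c * c) * (d * d)))) * (g₁ * g₂ * g₃ * g₄)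
        e = solve-∀ ℚring
        pointwise : ∀ u₀ u₁ w₀ w₁ → g u₀ w₀ * g u₀ w₁ * g u₁ w₀ * g u₁ w₁ ≡
          ind (U u₀ ∧ U u₁ ∧ W w₀ ∧ W w₁) * (gB B u₀ w₀ * gB B u₀ w₁ * gB B u₁ w₀ * gB B u₁ w₁)
        pointwise u₀ u₁ w₀ w₁ = trans
          (cong₂ _*_ (cong₂ _*_ (cong₂ _*_ (deviation-gB u₀ w₀) (deviation-gB u₀ w₁)) (deviation-gB u₁ w₀)) (deviation-gB u₁ w₁))
          (trans (e (ind (U u₀)) (ind (U u₁)) (ind (W w₀)) (ind (W w₁)) (gB B u₀ w₀) (gB B u₀ w₁) (gB B u₁ w₀) (gB B u₁ w₁))
          (cong (_* (gB B u₀ w₀ * gB B u₀ w₁ * gB B u₁ w₀ * gB B u₁ w₁))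
            (trans (cong₂ _*_ (ind-idem (U u₀)) (cong₂ _*_ (ind-idem (U u₁)) (cong₂ _*_ (ind-idem (W w₀)) (ind-idem (W w₁)))))
            (sym (trans (ind-∧ (U u₀) _) (cong (ind (U u₀) *_) (trans (ind-∧ (U u₁) _) (cong (ind (U u₁) *_) (ind-∧ (W w₀) (W w₁))))))))))

      dev2⇒quasiRandom : ∀ {θ d} → 0ℚ ≤ θ → 0ℚ < size U → 0ℚ < size W →
        Dev2 B ((θ * θ) * (θ * θ)) d → QuasiRandom U W (Eʳ B) D θ
      dev2⇒quasiRandom {θ} 0≤θ 0<U 0<W (_ , oct≤) = record
        { 0≤D = 0≤frac (count2 n (Eʳ B)) (count n U ℕ.* count n W)
        ; D≤1 = densB≤1 0<U 0<W
        ; 0≤θ = 0≤θ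
        ; 0<x = 0<U
        ; 0<y = 0<W
        ; supportˡ = Eʳ-supportˡ
        ; supportʳ = Eʳ-supportʳ
        ; total = densB-total 0<U 0<W
        ; oct = subst₂ _≤_ octB-deviation
            (cong₂ (λ s t → (θ * θ) * (θ * θ) * (s * s) * (t * t)) (count-size U) (count-size W)) oct≤ }

      dev2⇒d≤2D : ∀ {ε d} → ε ≤ D → Dev2 B ε d → d ≤ (1ℚ + 1ℚ) * D
      dev2⇒d≤2D {ε} {d} ε≤D (D-d≤ε , _) = ≤-by (0≤+ (≤⇒0≤- ε≤D) (≤⇒0≤- d-D≤ε)) (e D d ε)
        where
        d-D≤ε : d - D ≤ ε
        d-D≤ε = ≤-trans (≤-eq (e' d D)) (≤-trans (p≤∣p∣ (- (D - d))) (≤-trans (≤-eq (∣-p∣≡∣p∣ (D - d))) D-d≤ε))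
          where
          e' : ∀ d D → d - D ≡ - (D - d)
          e' = solve-∀ ℚring
          p≤∣p∣ : ∀ p → p ≤ ∣ p ∣
          p≤∣p∣ p = ≤-cases p (λ 0≤p → ≤-eq (sym (0≤p⇒∣p∣≡p 0≤p))) (λ p≤0 → ≤-trans p≤0 (0≤∣p∣ p))
        e : ∀ D d ε → (1ℚ + 1ℚ) * D ≡ d + ((D - ε) + (ε - (d - D)))
        e = solve-∀ ℚring

  open CountsAsSums

  -- Homogeneity of the pattern on a regular triad without sparse bigraphs.

  module RegularTriads where

    private variable
      n : ℕ

    -- Here `gr` names the group of a vertex and `lab w` is the set of groups attached to w. No
    -- bigraph of a triad enters, so the value depends on the two parts but not on the colours.
    patternEdges : ∀ {N} (gr : Fin n → Fin N) (lab : Fin n → Fin N → Bool) (a b X Y : Fin n → Bool) → ℚ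
    patternEdges {n} gr lab a b X Y = ∑ n λ u → ∑ n λ w →
      (ind (a u) * ind (X u)) * ((ind (b w) * ind (Y w)) * ind (lab w (gr u)))

    module _ {N : ℕ} (gr : Fin n → Fin N) (lab : Fin n → Fin N → Bool) (a b c : Fin n → Bool) where
      private
        aₚ bₚ : Fin N → Fin n → Bool
        aₚ p u = eqF (gr u) p ∧ a u
        bₚ p w = lab w p ∧ b w

      -- The pattern depends on u only through gr u, hence is a sum of N products of one-variable indicators;
      -- this keeps the total counting error proportional to N.
      patternEdges-classes : (X Y : Fin n → Bool) →
        patternEdges gr lab a b X Y ≡ ∑ N λ p → restrict (aₚ p) X * restrict (bₚ p) Y
      patternEdges-classes X Y = sym (begin-equality
        (∑ N λ p → restrict (aₚ p) X * restrict (bₚ p) Y)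
          ≡⟨ (∑-cong λ p → ∑-prod (λ u → ind (aₚ p u) * ind (X u)) (λ w → ind (bₚ p w) * ind (Y w))) ⟩
        (∑ N λ p → ∑ n λ u → ∑ n λ w → (ind (aₚ p u) * ind (X u)) * (ind (bₚ p w) * ind (Y w)))
          ≡⟨ trans (∑-swap λ p u → ∑ n λ w → (ind (aₚ p u) * ind (X u)) * (ind (bₚ p w) * ind (Y w)))
                   (∑-cong λ u → ∑-swap λ p w → (ind (aₚ p u) * ind (X u)) * (ind (bₚ p w) * ind (Y w))) ⟩
        (∑ n λ u → ∑ n λ w → ∑ N λ p → (ind (aₚ p u) * ind (X u)) * (ind (bₚ p w) * ind (Y w)))
          ≡⟨ (∑-cong λ u → ∑-cong λ w → trans (∑-cong λ p → pointwise u w p)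
                (∑-delta (gr u) λ p → (ind (a u) * ind (X u)) * ((ind (b w) * ind (Y w)) * ind (lab w p)))) ⟩
        patternEdges gr lab a b X Y ∎)
        where
        e : ∀ d a x l b y → ((d * a) * x) * ((l * b) * y) ≡ d * ((a * x) * ((b * y) * l))
        e = solve-∀ ℚring
        pointwise : ∀ u w p → (ind (aₚ p u) * ind (X u)) * (ind (bₚ p w) * ind (Y w)) ≡
          ind (eqF (gr u) p) * ((ind (a u) * ind (X u)) * ((ind (b w) * ind (Y w)) * ind (lab w p)))
        pointwise u w p = trans (cong₂ (λ s t → (s * ind (X u)) * (t * ind (Y w))) (ind-∧ (eqF (gr u) p) (a u)) (ind-∧ (lab w p) (b w)))
          (e (ind (eqF (gr u) p)) (ind (a u)) (ind (X u)) (ind (lab w p)) (ind (b w)) (ind (Y w)))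

      patternTriangles : (p₁ p₂ p₃ : Fin n → Fin n → Bool) → ℚ
      patternTriangles p₁ p₂ p₃ = ∑ n λ u → ∑ n λ w → ∑ n λ z →
        ind (a u ∧ (b w ∧ lab w (gr u))) * (ind (c z) * (ind (p₁ u w) * (ind (p₂ u z) * ind (p₃ w z))))

      patternTriangles-classes : (p₁ p₂ p₃ : Fin n → Fin n → Bool) →
        patternTriangles p₁ p₂ p₃ ≡ ∑ N λ p → triangles p₁ p₂ p₃ (aₚ p) (bₚ p) c
      patternTriangles-classes p₁ p₂ p₃ = sym (begin-equality
        (∑ N λ p → triangles p₁ p₂ p₃ (aₚ p) (bₚ p) c)
          ≡⟨ trans (∑-swap λ p u → ∑ n λ w → ∑ n λ z → F p u w z) (∑-cong λ u →
               trans (∑-swap λ p w → ∑ n λ z → F p u w z) (∑-cong λ w → ∑-swap λ p z → F p u w z)) ⟩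
        (∑ n λ u → ∑ n λ w → ∑ n λ z → ∑ N λ p → F p u w z)
          ≡⟨ (∑-cong λ u → ∑-cong λ w → ∑-cong λ z → trans (∑-cong λ p → pointwise u w z p)
                (∑-delta (gr u) λ p → ind (a u ∧ (b w ∧ lab w p)) * (ind (c z) * T u w z))) ⟩
        patternTriangles p₁ p₂ p₃ ∎)
        where
        T : Fin n → Fin n → Fin n → ℚ
        T u w z = ind (p₁ u w) * (ind (p₂ u z) * ind (p₃ w z))
        F : Fin N → Fin n → Fin n → Fin n → ℚ
        F p u w z = (ind (aₚ p u) * (ind (bₚ p w) * ind (c z))) * T u w z
        e : ∀ d a l b c t → ((d * a) * ((l * b) * c)) * t ≡ d * ((a * (b * l)) * (c * t))
        e = solve-∀ ℚring
        pointwise : ∀ u w z p → F p u w z ≡ ind (eqF (gr u) p) * (ind (a u ∧ (b w ∧ lab w p)) * (ind (c z) * T u w z))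
        pointwise u w z p = trans
          (cong₂ (λ s t → (s * (t * ind (c z))) * T u w z) (ind-∧ (eqF (gr u) p) (a u)) (ind-∧ (lab w p) (b w)))
          (trans (e (ind (eqF (gr u) p)) (ind (a u)) (ind (lab w p)) (ind (b w)) (ind (c z)) (T u w z))
            (cong (λ s → ind (eqF (gr u) p) * (s * (ind (c z) * T u w z)))
              (sym (trans (ind-∧ (a u) (b w ∧ lab w p)) (cong (ind (a u) *_) (ind-∧ (b w) (lab w p)))))))

      patternTriangles≥ : ∀ {X Y Z : Fin n → Bool} {p₁ p₂ p₃ : Fin n → Fin n → Bool} {D₁ D₂ D₃ θ : ℚ} →
        QuasiRandom X Y p₁ D₁ θ → QuasiRandom X Z p₂ D₂ θ → QuasiRandom Y Z p₃ D₃ θ →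
        D₁ * D₂ * D₃ * (patternEdges gr lab a b X Y * restrict c Z)
          - toℚ N * ((1ℚ + 1ℚ + 1ℚ) * (θ * (size X * size Y * size Z))) ≤ patternTriangles p₁ p₂ p₃
      patternTriangles≥ {X} {Y} {Z} {p₁} {p₂} {p₃} {D₁} {D₂} {D₃} {θ} Q₁ Q₂ Q₃ = begin
        D * (patternEdges gr lab a b X Y * C) - toℚ N * t
          ≡⟨ cong₂ _-_ (trans (cong (λ s → D * (s * C)) (patternEdges-classes X Y)) (e D C (∑ N λ p → A p * B p))) (sym (∑-const N t)) ⟩
        (D * C) * (∑ N λ p → A p * B p) - (∑ N λ _ → t)
          ≡⟨ cong (_- (∑ N λ _ → t)) (sym (∑-*ˡ (D * C) λ p → A p * B p)) ⟩
        (∑ N λ p → (D * C) * (A p * B p)) - (∑ N λ _ → t) ≡⟨ sym (∑-- (λ p → (D * C) * (A p * B p)) (λ _ → t)) ⟩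
        (∑ N λ p → (D * C) * (A p * B p) - t)
          ≤⟨ (∑-mono λ p → ≤-trans (≤-eq (cong (_- t) (e' D C (A p) (B p)))) (triangles≥ Q₁ Q₂ Q₃ (aₚ p) (bₚ p) c)) ⟩
        (∑ N λ p → triangles p₁ p₂ p₃ (aₚ p) (bₚ p) c) ≡⟨ sym (patternTriangles-classes p₁ p₂ p₃) ⟩
        patternTriangles p₁ p₂ p₃ ∎
        where
        D C t : ℚ
        D = D₁ * D₂ * D₃
        C = restrict c Z
        t = (1ℚ + 1ℚ + 1ℚ) * (θ * (size X * size Y * size Z))
        A B : Fin N → ℚ
        A p = restrict (aₚ p) X
        B p = restrict (bₚ p) Y
        e : ∀ D C s → D * (s * C) ≡ (D * C) * s
        e = solve-∀ ℚring
        e' : ∀ D C a b → (D * C) * (a * b) ≡ D * (a * b * C)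
        e' = solve-∀ ℚring

    opaque
      16ℚ : ℚ
      16ℚ = ((1ℚ + 1ℚ) * (1ℚ + 1ℚ)) * ((1ℚ + 1ℚ) * (1ℚ + 1ℚ))

      16ℚ-def : ((1ℚ + 1ℚ) * (1ℚ + 1ℚ)) * ((1ℚ + 1ℚ) * (1ℚ + 1ℚ)) ≡ 16ℚ
      16ℚ-def = refl

      0≤16ℚ : 0ℚ ≤ 16ℚ
      0≤16ℚ = nonNegative⁻¹ 16ℚ

    -- The three factors 16ℚ in ε₁≤κ² come from d⁴ ≤ 16 D⁴, where d ≤ 2 D compares the density d named by
    -- dev₂,₃ with the true density D of each bigraph.
    record Constants (N : ℕ) (ε₁ σ θ η κ : ℚ) : Set where
      field
        0<σ   : 0ℚ < σ
        0≤θ   : 0ℚ ≤ θ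
        θ≤σ⁴  : θ ≤ (σ * σ) * (σ * σ)
        θ⁴≤σ  : (θ * θ) * (θ * θ) ≤ σ
        Nθ≤   : toℚ N * ((1ℚ + 1ℚ + 1ℚ) * θ) ≤ η * (σ * σ * σ)
        0≤κ   : 0ℚ ≤ κ
        0≤η   : 0ℚ ≤ η
        ε₁≤κ² : (1ℚ + 1ℚ + 1ℚ) * (ε₁ * (16ℚ * 16ℚ * 16ℚ)) ≤ κ * κ
        κ≤η⁴  : (1ℚ + 1ℚ) * κ ≤ (η * η) * (η * η)
        0≤ε₁  : 0ℚ ≤ ε₁

    -- Each `Eʳ` contains its own vertex-set conditions, hence the duplicated conjuncts.
    K3-∧ : ∀ a b c d e f → a ∧ b ∧ c ∧ d ∧ e ∧ f ≡ (a ∧ b ∧ d) ∧ ((a ∧ c ∧ e) ∧ (b ∧ c ∧ f))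
    K3-∧ false b c d e f = refl
    K3-∧ true false c d e f = refl
    K3-∧ true true false d e f = sym (Bool.∧-zeroʳ d)
    K3-∧ true true true d e f = refl

    support-∧ˡ : ∀ {K} P R → K ≡ P ∧ R → (v : ℚ) → (if K then v else 0ℚ) ≡ ind P * (if K then v else 0ℚ)
    support-∧ˡ true R refl v = sym (*-identityˡ _)
    support-∧ˡ false R refl v = refl

    module _ (T : Triad n) (HE : Fin n → Fin n → Fin n → Bool) where
      open Triad T

      private
        p₁ = Eʳ (bXY T)
        p₂ = Eʳ (bXZ T)
        p₃ = Eʳ (bYZ T)
        h = hT T HE
        d = densT T HE

      K3≡ : ∀ u w z → K3 T u w z ≡ p₁ u w ∧ (p₂ u z ∧ p₃ w z)
      K3≡ u w z = K3-∧ (X u) (Y w) (Z z) (Exy u w) (Exz u z) (Eyz w z)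

      ind-K3 : ∀ u w z → ind (K3 T u w z) ≡ ind (p₁ u w) * (ind (p₂ u z) * ind (p₃ w z))
      ind-K3 u w z = trans (cong ind (K3≡ u w z)) (trans (ind-∧ (p₁ u w) _) (cong (ind (p₁ u w) *_) (ind-∧ (p₂ u z) (p₃ w z))))

      private
        ∧-rot : ∀ a b c → a ∧ (b ∧ c) ≡ b ∧ (a ∧ c)
        ∧-rot false false c = refl
        ∧-rot false true c = refl
        ∧-rot true b c = refl

        ∧-rot₂ : ∀ a b c → a ∧ (b ∧ c) ≡ c ∧ (a ∧ b)
        ∧-rot₂ false b c = sym (Bool.∧-zeroʳ c)
        ∧-rot₂ true false c = sym (Bool.∧-zeroʳ c)
        ∧-rot₂ true true false = refl
        ∧-rot₂ true true true = refl

      hT-support₁ : ∀ u w z → h u w z ≡ ind (p₁ u w) * h u w z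
      hT-support₁ u w z = support-∧ˡ (p₁ u w) (p₂ u z ∧ p₃ w z) (K3≡ u w z) _

      hT-support₂ : ∀ u w z → h u w z ≡ ind (p₂ u z) * h u w z
      hT-support₂ u w z = support-∧ˡ (p₂ u z) (p₁ u w ∧ p₃ w z) (trans (K3≡ u w z) (∧-rot (p₁ u w) (p₂ u z) (p₃ w z))) _

      hT-support₃ : ∀ u w z → h u w z ≡ ind (p₃ w z) * h u w z
      hT-support₃ u w z = support-∧ˡ (p₃ w z) (p₁ u w ∧ p₂ u z) (trans (K3≡ u w z) (∧-rot₂ (p₁ u w) (p₂ u z) (p₃ w z))) _

      -- `hT` vanishes off X × Y × Z, and the first and last of the eight factors sit at opposite
      -- corners, so these two alone reproduce the indicator for all six vertices.
      octT-octahedra : octT T HE ≡ octahedra h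
      octT-octahedra = ∑-cong λ u₀ → ∑-cong λ u₁ → ∑-cong λ w₀ → ∑-cong λ w₁ → ∑-cong λ z₀ → ∑-cong λ z₁ →
        sym (pointwise u₀ u₁ w₀ w₁ z₀ z₁)
        where
        hXYZ : ∀ u w z → h u w z ≡ (ind (X u) * (ind (Y w) * ind (Z z))) * h u w z
        hXYZ u w z = trans (support-∧ˡ (X u ∧ Y w ∧ Z z) (Exy u w ∧ Exz u z ∧ Eyz w z) (e (X u) (Y w) (Z z) _) _)
          (cong (_* h u w z) (trans (ind-∧ (X u) _) (cong (ind (X u) *_) (ind-∧ (Y w) (Z z)))))
          where
          e : ∀ a b c r → a ∧ b ∧ c ∧ r ≡ (a ∧ b ∧ c) ∧ r
          e false b c r = refl
          e true false c r = refl
          e true true c r = refl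
        e : ∀ i j h₁ h₂ h₃ h₄ h₅ h₆ h₇ h₈ → (i * h₁) * h₂ * h₃ * h₄ * h₅ * h₆ * h₇ * (j * h₈) ≡ (i * j) * (h₁ * h₂ * h₃ * h₄ * h₅ * h₆ * h₇ * h₈)
        e = solve-∀ ℚring
        e' : ∀ x₀ x₁ y₀ y₁ z₀ z₁ → (x₀ * (y₀ * z₀)) * (x₁ * (y₁ * z₁)) ≡ x₀ * (x₁ * (y₀ * (y₁ * (z₀ * z₁))))
        e' = solve-∀ ℚring
        pointwise : ∀ u₀ u₁ w₀ w₁ z₀ z₁ →
          h u₀ w₀ z₀ * h u₀ w₀ z₁ * h u₀ w₁ z₀ * h u₀ w₁ z₁ * h u₁ w₀ z₀ * h u₁ w₀ z₁ * h u₁ w₁ z₀ * h u₁ w₁ z₁ ≡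
          ind (X u₀ ∧ X u₁ ∧ Y w₀ ∧ Y w₁ ∧ Z z₀ ∧ Z z₁) *
          (h u₀ w₀ z₀ * h u₀ w₀ z₁ * h u₀ w₁ z₀ * h u₀ w₁ z₁ * h u₁ w₀ z₀ * h u₁ w₀ z₁ * h u₁ w₁ z₀ * h u₁ w₁ z₁)
        pointwise u₀ u₁ w₀ w₁ z₀ z₁ = trans
          (cong₂ (λ s t → s * h u₀ w₀ z₁ * h u₀ w₁ z₀ * h u₀ w₁ z₁ * h u₁ w₀ z₀ * h u₁ w₀ z₁ * h u₁ w₁ z₀ * t) (hXYZ u₀ w₀ z₀) (hXYZ u₁ w₁ z₁))
          (trans (e (ind (X u₀) * (ind (Y w₀) * ind (Z z₀))) (ind (X u₁) * (ind (Y w₁) * ind (Z z₁)))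
              (h u₀ w₀ z₀) (h u₀ w₀ z₁) (h u₀ w₁ z₀) (h u₀ w₁ z₁) (h u₁ w₀ z₀) (h u₁ w₀ z₁) (h u₁ w₁ z₀) (h u₁ w₁ z₁))
          (cong (_* (h u₀ w₀ z₀ * h u₀ w₀ z₁ * h u₀ w₁ z₀ * h u₀ w₁ z₁ * h u₁ w₀ z₀ * h u₁ w₀ z₁ * h u₁ w₁ z₀ * h u₁ w₁ z₁))
          (trans (e' (ind (X u₀)) (ind (X u₁)) (ind (Y w₀)) (ind (Y w₁)) (ind (Z z₀)) (ind (Z z₁)))
          (sym (trans (ind-∧ (X u₀) _) (cong (ind (X u₀) *_) (trans (ind-∧ (X u₁) _) (cong (ind (X u₁) *_)
            (trans (ind-∧ (Y w₀) _) (cong (ind (Y w₀) *_) (trans (ind-∧ (Y w₁) _) (cong (ind (Y w₁) *_) (ind-∧ (Z z₀) (Z z₁))))))))))))))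

      0≤densT : 0ℚ ≤ d
      0≤densT = 0≤frac (count3 n (λ x y z → HE x y z ∧ K3 T x y z)) (count3 n (K3 T))

      densT≤1 : d ≤ 1ℚ
      densT≤1 = frac≤1 {count3 n (λ x y z → HE x y z ∧ K3 T x y z)} {count3 n (K3 T)} (subst₂ _≤_ (sym (count3-∑ (λ x y z → HE x y z ∧ K3 T x y z))) (sym (count3-∑ (K3 T)))
        (∑-mono λ x → ∑-mono λ y → ∑-mono λ z → ≤-trans (≤-eq (ind-∧ (HE x y z) (K3 T x y z))) (ind*≤ (HE x y z) (0≤ind (K3 T x y z)))))

      module _ {N : ℕ} {gr : Fin n → Fin N} {lab : Fin n → Fin N → Bool} {a b c : Fin n → Bool}
               (HE≡ : ∀ u w z → a u ≡ true → b w ≡ true → c z ≡ true → HE u w z ≡ lab w (gr u))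
               {ε₁ σ θ η κ : ℚ} (𝓒 : Constants N ε₁ σ θ η κ)
               (0<X : 0ℚ < size X) (0<Y : 0ℚ < size Y) (0<Z : 0ℚ < size Z)
               (σ≤D₁ : σ ≤ densB (bXY T)) (σ≤D₂ : σ ≤ densB (bXZ T)) (σ≤D₃ : σ ≤ densB (bYZ T))
               (reg : Dev23 T HE ε₁ ((θ * θ) * (θ * θ))) where
        open Constants 𝓒
        private
          D₁ D₂ D₃ x y z xyz D C : ℚ
          D₁ = densB (bXY T)
          D₂ = densB (bXZ T)
          D₃ = densB (bYZ T)
          x = size X
          y = size Y
          z = size Z
          xyz = x * y * z
          D = D₁ * D₂ * D₃
          C = restrict c Z
          dxy = proj₁ reg
          dxz = proj₁ (proj₂ reg)
          dyz = proj₁ (proj₂ (proj₂ reg))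
          rest = proj₂ (proj₂ (proj₂ reg))
          0<dxy = proj₁ rest
          0<dxz = proj₁ (proj₂ rest)
          0<dyz = proj₁ (proj₂ (proj₂ rest))
          dev₁ = proj₁ (proj₂ (proj₂ (proj₂ rest)))
          dev₂ = proj₁ (proj₂ (proj₂ (proj₂ (proj₂ rest))))
          dev₃ = proj₁ (proj₂ (proj₂ (proj₂ (proj₂ (proj₂ rest)))))
          oct≤ = proj₂ (proj₂ (proj₂ (proj₂ (proj₂ (proj₂ rest)))))
          Q₁ = dev2⇒quasiRandom (bXY T) 0≤θ 0<X 0<Y dev₁
          Q₂ = dev2⇒quasiRandom (bXZ T) 0≤θ 0<X 0<Z dev₂
          Q₃ = dev2⇒quasiRandom (bYZ T) 0≤θ 0<Y 0<Z dev₃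
          0≤σ = <⇒≤ 0<σ

          θ≤⁴ : ∀ {D} → σ ≤ D → θ ≤ (D * D) * (D * D)
          θ≤⁴ {D} p = ≤-trans θ≤σ⁴ (*-mono (0≤sq D) (0≤sq σ) q q)
            where
            q : σ * σ ≤ D * D
            q = *-mono (≤-trans 0≤σ p) 0≤σ p p

          fourth : ∀ d D → 0ℚ < d → d ≤ (1ℚ + 1ℚ) * D → sq (sq d) ≤ 16ℚ * ((D * D) * (D * D))
          fourth d D 0<d p = ≤-trans (*-mono (0≤sq ((1ℚ + 1ℚ) * D)) (0≤sq d) q q) (≤-eq (trans (e D) (cong (_* ((D * D) * (D * D))) 16ℚ-def)))
            where
            q : d * d ≤ ((1ℚ + 1ℚ) * D) * ((1ℚ + 1ℚ) * D)
            q = *-mono (≤-trans (<⇒≤ 0<d) p) (<⇒≤ 0<d) p p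
            e : ∀ D → (((1ℚ + 1ℚ) * D) * ((1ℚ + 1ℚ) * D)) * (((1ℚ + 1ℚ) * D) * ((1ℚ + 1ℚ) * D)) ≡
                      (((1ℚ + 1ℚ) * (1ℚ + 1ℚ)) * ((1ℚ + 1ℚ) * (1ℚ + 1ℚ))) * ((D * D) * (D * D))
            e = solve-∀ ℚring

          octahedra≤ : octahedra h ≤ (ε₁ * (16ℚ * 16ℚ * 16ℚ)) *
            (((D₁ * D₁) * (D₁ * D₁)) * ((D₂ * D₂) * (D₂ * D₂)) * ((D₃ * D₃) * (D₃ * D₃)) * ((x * x) * (y * y) * (z * z)))
          octahedra≤ = begin
            octahedra h ≡⟨ sym octT-octahedra ⟩
            octT T HE   ≤⟨ oct≤ ⟩
            ε₁ * sq (sq dxy) * sq (sq dxz) * sq (sq dyz) * sq (toℚ (count n X)) * sq (toℚ (count n Y)) * sq (toℚ (count n Z))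
              ≡⟨ cong₂ _*_ (cong₂ _*_ (cong (λ s → ε₁ * sq (sq dxy) * sq (sq dxz) * sq (sq dyz) * sq s) (count-size X))
                   (cong sq (count-size Y))) (cong sq (count-size Z)) ⟩
            ε₁ * sq (sq dxy) * sq (sq dxz) * sq (sq dyz) * (x * x) * (y * y) * (z * z)
              ≡⟨ e ε₁ (sq (sq dxy)) (sq (sq dxz)) (sq (sq dyz)) ((x * x) * (y * y) * (z * z)) (x * x) (y * y) (z * z) ⟩
            ε₁ * ((sq (sq dxy) * sq (sq dxz) * sq (sq dyz)) * ((x * x) * (y * y) * (z * z)))
              ≤⟨ *-monoˡ ε₁ 0≤ε₁ (*-monoʳ ((x * x) * (y * y) * (z * z)) (0≤* (0≤* (0≤sq x) (0≤sq y)) (0≤sq z))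
                   (*-mono (0≤* (0≤16* D₁) (0≤16* D₂)) (0≤sq (sq dyz))
                     (*-mono (0≤16* D₁) (0≤sq (sq dxz))
                       (fourth dxy D₁ 0<dxy (dev2⇒d≤2D (bXY T) (≤-trans θ⁴≤σ σ≤D₁) dev₁))
                       (fourth dxz D₂ 0<dxz (dev2⇒d≤2D (bXZ T) (≤-trans θ⁴≤σ σ≤D₂) dev₂)))
                     (fourth dyz D₃ 0<dyz (dev2⇒d≤2D (bYZ T) (≤-trans θ⁴≤σ σ≤D₃) dev₃)))) ⟩
            _ ≡⟨ e' ε₁ 16ℚ ((D₁ * D₁) * (D₁ * D₁)) ((D₂ * D₂) * (D₂ * D₂)) ((D₃ * D₃) * (D₃ * D₃)) ((x * x) * (y * y) * (z * z)) ⟩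
            _ ∎
            where
            0≤16* : ∀ D → 0ℚ ≤ 16ℚ * ((D * D) * (D * D))
            0≤16* D = 0≤* 0≤16ℚ (0≤sq (D * D))
            e : ∀ ε a b c v x y z → ε * a * b * c * x * y * z ≡ ε * ((a * b * c) * (x * y * z))
            e = solve-∀ ℚring
            e' : ∀ ε k a b c v → ε * (((k * a) * (k * b) * (k * c)) * v) ≡ (ε * (k * k * k)) * (a * b * c * v)
            e' = solve-∀ ℚring

          -- `f` will be the identity or `not`, which selects the edges or the non-edges of the
          -- pattern.
          φ : (Bool → Bool) → Fin n → Fin n → Bool
          φ f u w = a u ∧ (b w ∧ f (lab w (gr u)))

          corr : (Bool → Bool) → ℚ
          corr f = correlation Q₁ Q₂ Q₃ (<-≤-trans 0<σ σ≤D₁) (<-≤-trans 0<σ σ≤D₂) (<-≤-trans 0<σ σ≤D₃)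
            (θ≤⁴ σ≤D₁) (θ≤⁴ σ≤D₂) h hT-support₁ hT-support₂ hT-support₃ {ε₁ * (16ℚ * 16ℚ * 16ℚ)} {κ} {η} 0≤κ 0≤η ε₁≤κ² κ≤η⁴ octahedra≤ (φ f) c

          corr≤ : ∀ f → corr f ≤ η * (D * xyz)
          corr≤ f = correlation≤ Q₁ Q₂ Q₃ (<-≤-trans 0<σ σ≤D₁) (<-≤-trans 0<σ σ≤D₂) (<-≤-trans 0<σ σ≤D₃)
            (θ≤⁴ σ≤D₁) (θ≤⁴ σ≤D₂) h hT-support₁ hT-support₂ hT-support₃ {ε₁ * (16ℚ * 16ℚ * 16ℚ)} {κ} {η} 0≤κ 0≤η ε₁≤κ² κ≤η⁴ octahedra≤ (φ f) c

          -corr≤ : ∀ f → - corr f ≤ η * (D * xyz)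
          -corr≤ f = -correlation≤ Q₁ Q₂ Q₃ (<-≤-trans 0<σ σ≤D₁) (<-≤-trans 0<σ σ≤D₂) (<-≤-trans 0<σ σ≤D₃)
            (θ≤⁴ σ≤D₁) (θ≤⁴ σ≤D₂) h hT-support₁ hT-support₂ hT-support₃ {ε₁ * (16ℚ * 16ℚ * 16ℚ)} {κ} {η} 0≤κ 0≤η ε₁≤κ² κ≤η⁴ octahedra≤ (φ f) c

          K : (Bool → Bool) → ℚ
          K f = patternTriangles gr (λ w p → f (lab w p)) a b c p₁ p₂ p₃

          -- On the triples selected by `φ f` and `c` the 3-graph agrees with the pattern, so `hT`
          -- is constant on the triangles among them: 1 - d for edges, -d for non-edges. The
          -- correlation is this constant times a triangle count.
          corr-K : ∀ f v → (∀ l → f l ≡ true → (if l then 1ℚ - d else - d) ≡ v) → corr f ≡ v * K f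
          corr-K f v f-v = trans (∑-cong λ u → trans (∑-cong λ w → trans (∑-cong λ k → pointwise u w k)
              (∑-*ˡ v λ k → G u w k)) (∑-*ˡ v λ w → ∑ n λ k → G u w k)) (∑-*ˡ v λ u → ∑ n λ w → ∑ n λ k → G u w k)
            where
            G : Fin n → Fin n → Fin n → ℚ
            G u w k = ind (φ f u w) * (ind (c k) * (ind (p₁ u w) * (ind (p₂ u k) * ind (p₃ w k))))
            e : ∀ v g → 1ℚ * (1ℚ * (v * g)) ≡ v * (1ℚ * (1ℚ * g))
            e = solve-∀ ℚring
            z₁ : ∀ v s t → 0ℚ * s ≡ v * (0ℚ * t)
            z₁ = solve-∀ ℚring
            z₂ : ∀ v i s t → i * (0ℚ * s) ≡ v * (i * (0ℚ * t))
            z₂ = solve-∀ ℚring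
            h≡ : ∀ u w k → (if HE u w k then 1ℚ - d else - d) ≡ v → h u w k ≡ v * (ind (p₁ u w) * (ind (p₂ u k) * ind (p₃ w k)))
            h≡ u w k q = trans (e'' (K3 T u w k)) (cong (v *_) (ind-K3 u w k))
              where
              e'' : ∀ b → (if b then (if HE u w k then 1ℚ - d else - d) else 0ℚ) ≡ v * ind b
              e'' true = trans q (sym (*-identityʳ v))
              e'' false = sym (*-zeroʳ v)
            pointwise : ∀ u w k → ind (φ f u w) * (ind (c k) * h u w k) ≡ v * G u w k
            pointwise u w k with a u in au | b w in bw | c k in ck | f (lab w (gr u)) in fl
            ... | false | _ | ck' | _ = z₁ v (ind ck' * h u w k) (ind ck' * (ind (p₁ u w) * (ind (p₂ u k) * ind (p₃ w k))))
            ... | true | false | ck' | _ = z₁ v (ind ck' * h u w k) (ind ck' * (ind (p₁ u w) * (ind (p₂ u k) * ind (p₃ w k))))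
            ... | true | true | false | q = z₂ v (ind q) (h u w k) (ind (p₁ u w) * (ind (p₂ u k) * ind (p₃ w k)))
            ... | true | true | true | false = z₁ v (1ℚ * h u w k) (1ℚ * (ind (p₁ u w) * (ind (p₂ u k) * ind (p₃ w k))))
            ... | true | true | true | true = trans (cong (λ s → 1ℚ * (1ℚ * s)) (h≡ u w k
                  (trans (cong (λ l → if l then 1ℚ - d else - d) (HE≡ u w k au bw ck)) (f-v (lab w (gr u)) fl))))
                (e v (ind (p₁ u w) * (ind (p₂ u k) * ind (p₃ w k))))

          K≥ : ∀ f m → m ≤ patternEdges gr (λ w p → f (lab w p)) a b X Y →
               D * (m * C) - η * (D * xyz) ≤ K f
          K≥ f m m≤ = ≤-trans (≤-by (0≤+ (0≤* 0≤D (0≤* (≤⇒0≤- m≤) (0≤restrict c Z))) (0≤* (≤⇒0≤- N≤) 0≤xyz))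
              (e D m C η xyz E (toℚ N) θ))
            (patternTriangles≥ gr (λ w p → f (lab w p)) a b c Q₁ Q₂ Q₃)
            where
            E = patternEdges gr (λ w p → f (lab w p)) a b X Y
            0≤D : 0ℚ ≤ D
            0≤D = 0≤* (0≤* (≤-trans 0≤σ σ≤D₁) (≤-trans 0≤σ σ≤D₂)) (≤-trans 0≤σ σ≤D₃)
            0≤xyz : 0ℚ ≤ xyz
            0≤xyz = 0≤* (0≤* (0≤size X) (0≤size Y)) (0≤size Z)
            -- All three densities are at least σ, so the counting errors of all N groups together
            -- stay below η times the expected number of triangles.
            N≤ : toℚ N * ((1ℚ + 1ℚ + 1ℚ) * θ) ≤ η * D
            N≤ = ≤-trans Nθ≤ (*-monoˡ η 0≤η (*-mono (0≤* (≤-trans 0≤σ σ≤D₁) (≤-trans 0≤σ σ≤D₂)) 0≤σ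
              (*-mono (≤-trans 0≤σ σ≤D₁) 0≤σ σ≤D₁ σ≤D₂) σ≤D₃))
            e : ∀ D m C η s E N θ → D * (E * C) - N * ((1ℚ + 1ℚ + 1ℚ) * (θ * s)) ≡
              (D * (m * C) - η * (D * s)) + (D * ((E - m) * C) + (η * D - N * ((1ℚ + 1ℚ + 1ℚ) * θ)) * s)
            e = solve-∀ ℚring

        -- Octahedral regularity makes both (1 - d) K₁ and d K₀ at most η times the expected number
        -- of triangles, K₁ and K₀ being the triangles on edges and on non-edges. Both K₁ and K₀ are
        -- at least D m |c ∩ Z| minus the same error, and averaging with weights 1 - d and d avoids
        -- any case distinction on d. The two correlation errors and the averaged counting error
        -- make up the factor 3.
        regular⇒homogeneous : ∀ m → m ≤ patternEdges gr lab a b X Y → m ≤ patternEdges gr (λ w p → not (lab w p)) a b X Y →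
          m * restrict c Z ≤ (1ℚ + 1ℚ + 1ℚ) * η * (size X * size Y * size Z)
        regular⇒homogeneous m m≤₁ m≤₀ = *-cancel D 0<D (≤-by
            (0≤+ (0≤+ (≤⇒0≤- r₁) (≤⇒0≤- r₀))
                 (0≤+ (0≤* (≤⇒0≤- densT≤1) (≤⇒0≤- (K≥ (λ l → l) m m≤₁))) (0≤* 0≤densT (≤⇒0≤- (K≥ not m m≤₀)))))
            (e D (m * C) η xyz d (K λ l → l) (K not)))
          where
          0<D : 0ℚ < D
          0<D = 0<* (0<* (<-≤-trans 0<σ σ≤D₁) (<-≤-trans 0<σ σ≤D₂)) (<-≤-trans 0<σ σ≤D₃)
          r₁ : (1ℚ - d) * K (λ l → l) ≤ η * (D * xyz)
          r₁ = subst (_≤ η * (D * xyz)) (corr-K (λ l → l) (1ℚ - d) λ { true _ → refl }) (corr≤ λ l → l)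
          r₀ : d * K not ≤ η * (D * xyz)
          r₀ = subst (_≤ η * (D * xyz)) (trans (cong -_ (corr-K not (- d) λ { false _ → refl })) (e' d (K not))) (-corr≤ not)
            where
            e' : ∀ d k → - ((- d) * k) ≡ d * k
            e' = solve-∀ ℚring
          e : ∀ D M η s d K₁ K₀ → D * ((1ℚ + 1ℚ + 1ℚ) * η * s) ≡
            D * M + ((η * (D * s) - (1ℚ - d) * K₁ + (η * (D * s) - d * K₀)) +
                     ((1ℚ - d) * (K₁ - (D * M - η * (D * s))) + d * (K₀ - (D * M - η * (D * s)))))
          e = solve-∀ ℚring

  open RegularTriads

  -- Summation over the triads of a decomposition, with sparse bigraphs as exceptions.

  module Decompositions where

    private variable
      n : ℕ

    0<size : (X : Fin n → Bool) → ∀ x → X x ≡ true → 0ℚ < size X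
    0<size X x p = <-≤-trans 0<1 (≤-trans (≤-eq (cong ind (sym p))) (∑-single (λ u → ind (X u)) (λ u → 0≤ind (X u)) x))

    -- Unlike `densB-total` this also covers an empty side, where the density is 0 by convention and
    -- there are no edges.
    edges≤density : (B : Bigraph n) → let open Bigraph B in
      (∑ n λ u → ∑ n λ w → ind (Eʳ B u w)) ≤ densB B * (size U * size W)
    edges≤density {n} B = go (0ℚ <? size U) (0ℚ <? size W)
      where
      open Bigraph B
      crude : (∑ n λ u → ∑ n λ w → ind (Eʳ B u w)) ≤ size U * size W
      crude = ≤-trans (∑-mono λ u → ∑-mono λ w → pointwise (U u) (W w) (E u w)) (≤-eq (sym (∑-prod (λ u → ind (U u)) (λ w → ind (W w)))))
        where
        pointwise : ∀ a b c → ind (a ∧ b ∧ c) ≤ ind a * ind b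
        pointwise a b c = ≤-trans (≤-eq (trans (ind-∧ a (b ∧ c)) (cong (ind a *_) (ind-∧ b c))))
          (*-monoˡ (ind a) (0≤ind a) (≤-trans (≤-eq (*-comm (ind b) (ind c))) (ind*≤ c (0≤ind b))))
      degenerate : size U * size W ≤ 0ℚ → (∑ n λ u → ∑ n λ w → ind (Eʳ B u w)) ≤ densB B * (size U * size W)
      degenerate p = ≤-trans crude (≤-trans p (0≤* (0≤frac (count2 n (Eʳ B)) (count n U ℕ.* count n W)) (0≤* (0≤size U) (0≤size W))))
      go : Dec (0ℚ < size U) → Dec (0ℚ < size W) → _
      go (yes p) (yes q) = ≤-eq (densB-total B p q)
      go (no p) _ = degenerate (≤-trans (*-monoʳ (size W) (0≤size W) (≮⇒≥ p)) (≤-eq (*-zeroˡ (size W))))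
      go (yes _) (no q) = degenerate (≤-trans (*-monoˡ (size U) (0≤size U) (≮⇒≥ q)) (≤-eq (*-zeroʳ (size U))))

    patternEdges≤ : ∀ {N} (gr : Fin n → Fin N) (lab : Fin n → Fin N → Bool) (a b X Y : Fin n → Bool) →
      patternEdges gr lab a b X Y ≤ size X * size Y
    patternEdges≤ gr lab a b X Y = ≤-trans
      (∑-mono λ u → ∑-mono λ w → *-mono (0≤ind (X u)) (0≤* (0≤* (0≤ind (b w)) (0≤ind (Y w))) (0≤ind (lab w (gr u))))
        (ind*≤ (a u) (0≤ind (X u)))
        (≤-trans (≤-eq (*-comm (ind (b w) * ind (Y w)) (ind (lab w (gr u)))))
          (≤-trans (ind*≤ (lab w (gr u)) (0≤* (0≤ind (b w)) (0≤ind (Y w)))) (ind*≤ (b w) (0≤ind (Y w))))))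
      (≤-eq (sym (∑-prod (λ u → ind (X u)) (λ w → ind (Y w)))))

    module _ {t ℓ : ℕ} (P : Decomp n t ℓ) where
      open Decomp P

      private
        V : Fin t → Fin n → Bool
        V = inV P

      bigraphOf : Fin t → Fin t → Fin ℓ → Bigraph n
      bigraphOf i j α = record { U = V i ; W = V j ; E = λ u w → eqF (colour u w) α }

      ∑-parts : (f : Fin n → ℚ) → (∑ t λ i → ∑ n λ x → ind (V i x) * f x) ≡ ∑ n f
      ∑-parts f = trans (∑-swap λ i x → ind (V i x) * f x) (∑-cong λ x → ∑-delta (part x) λ _ → f x)

      ∑-sizes : (∑ t λ i → size (V i)) ≡ toℚ n
      ∑-sizes = trans (∑-cong λ i → ∑-cong λ x → sym (*-identityʳ (ind (V i x))))
        (trans (∑-parts λ _ → 1ℚ) (trans (∑-const n 1ℚ) (*-identityʳ (toℚ n))))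

      ∑-bigraphs : (f : Fin t → Fin t → Fin ℓ → ℚ) →
        (∑ n λ x → ∑ n λ y → f (part x) (part y) (colour x y)) ≡
        (∑ t λ i → ∑ t λ j → ∑ ℓ λ α → f i j α * (∑ n λ x → ∑ n λ y → ind (Eʳ (bigraphOf i j α) x y)))
      ∑-bigraphs f = sym (begin-equality
        (∑ t λ i → ∑ t λ j → ∑ ℓ λ α → f i j α * (∑ n λ x → ∑ n λ y → ind (Eʳ (bigraphOf i j α) x y)))
          ≡⟨ (∑-cong λ i → ∑-cong λ j → trans (∑-cong λ α →
                trans (sym (∑-*ˡ (f i j α) λ x → ∑ n λ y → ind (Eʳ (bigraphOf i j α) x y)))
                  (∑-cong λ x → trans (sym (∑-*ˡ (f i j α) λ y → ind (Eʳ (bigraphOf i j α) x y)))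
                    (∑-cong λ y → pointwise i j α x y)))
              (swap₃ℓ λ x y α → ind (V i x) * (ind (V j y) * (ind (eqF (colour x y) α) * f i j α)))) ⟩
        (∑ t λ i → ∑ t λ j → ∑ n λ x → ∑ n λ y → ∑ ℓ λ α → ind (V i x) * (ind (V j y) * (ind (eqF (colour x y) α) * f i j α)))
          ≡⟨ (∑-cong λ i → ∑-cong λ j → ∑-cong λ x → ∑-cong λ y → trans
                (∑-*ˡ (ind (V i x)) λ α → ind (V j y) * (ind (eqF (colour x y) α) * f i j α))
                (cong (ind (V i x) *_) (trans (∑-*ˡ (ind (V j y)) λ α → ind (eqF (colour x y) α) * f i j α)
                  (cong (ind (V j y) *_) (∑-delta (colour x y) (f i j)))))) ⟩
        (∑ t λ i → ∑ t λ j → ∑ n λ x → ∑ n λ y → ind (V i x) * (ind (V j y) * f i j (colour x y)))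
          ≡⟨ (∑-cong λ i → trans (∑-swap λ j x → ∑ n λ y → ind (V i x) * (ind (V j y) * f i j (colour x y)))
                (∑-cong λ x → trans (∑-swap λ j y → ind (V i x) * (ind (V j y) * f i j (colour x y)))
                  (trans (∑-cong λ y → trans (∑-*ˡ (ind (V i x)) λ j → ind (V j y) * f i j (colour x y))
                      (cong (ind (V i x) *_) (∑-delta (part y) λ j → f i j (colour x y))))
                    (∑-*ˡ (ind (V i x)) λ y → f i (part y) (colour x y))))) ⟩
        (∑ t λ i → ∑ n λ x → ind (V i x) * (∑ n λ y → f i (part y) (colour x y)))
          ≡⟨ trans (∑-swap λ i x → ind (V i x) * (∑ n λ y → f i (part y) (colour x y)))
                (∑-cong λ x → ∑-delta (part x) λ i → ∑ n λ y → f i (part y) (colour x y)) ⟩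
        (∑ n λ x → ∑ n λ y → f (part x) (part y) (colour x y)) ∎)
        where
        swap₃ℓ : (g : Fin n → Fin n → Fin ℓ → ℚ) →
          (∑ ℓ λ α → ∑ n λ x → ∑ n λ y → g x y α) ≡ (∑ n λ x → ∑ n λ y → ∑ ℓ λ α → g x y α)
        swap₃ℓ g = trans (∑-swap λ α x → ∑ n λ y → g x y α) (∑-cong λ x → ∑-swap λ α y → g x y α)
        e : ∀ f a b c → f * (a * (b * c)) ≡ a * (b * (c * f))
        e = solve-∀ ℚring
        pointwise : ∀ i j α x y → f i j α * ind (Eʳ (bigraphOf i j α) x y) ≡
          ind (V i x) * (ind (V j y) * (ind (eqF (colour x y) α) * f i j α))
        pointwise i j α x y = trans (cong (f i j α *_) (trans (ind-∧ (V i x) _) (cong (ind (V i x) *_) (ind-∧ (V j y) (eqF (colour x y) α)))))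
          (e (f i j α) (ind (V i x)) (ind (V j y)) (ind (eqF (colour x y) α)))

      module _ (σ : ℚ) where
        sparseClass : Fin t → Fin t → Fin ℓ → Bool
        sparseClass i j α = ⌊ densB (bigraphOf i j α) <? σ ⌋

        sparse : Fin n → Fin n → Bool
        sparse x y = sparseClass (part x) (part y) (colour x y)

        dense⇒σ≤ : ∀ x y → sparse x y ≡ false → σ ≤ densB (bigraphAt P x y)
        dense⇒σ≤ x y p with densB (bigraphAt P x y) <? σ
        ... | no q = ≮⇒≥ q

        -- Between two parts each of the ℓ colours contributes at most σ|V_i||V_j| sparse pairs.
        -- Hence σ has to shrink with ℓ.
        sparse≤ : 0ℚ ≤ σ → (∑ n λ x → ∑ n λ y → ind (sparse x y)) ≤ (toℚ ℓ * σ) * (toℚ n * toℚ n)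
        sparse≤ 0≤σ = begin
          (∑ n λ x → ∑ n λ y → ind (sparse x y)) ≡⟨ ∑-bigraphs (λ i j α → ind (sparseClass i j α)) ⟩
          (∑ t λ i → ∑ t λ j → ∑ ℓ λ α → ind (sparseClass i j α) * (∑ n λ x → ∑ n λ y → ind (Eʳ (bigraphOf i j α) x y)))
            ≤⟨ (∑-mono λ i → ∑-mono λ j → ≤-trans (∑-mono λ α → few i j α) (≤-eq (trans (∑-const ℓ (σ * (size (V i) * size (V j))))
                  (e (toℚ ℓ) σ (size (V i)) (size (V j)))))) ⟩
          (∑ t λ i → ∑ t λ j → size (V i) * ((toℚ ℓ * σ) * size (V j)))
            ≡⟨ sym (∑-prod (λ i → size (V i)) (λ j → (toℚ ℓ * σ) * size (V j))) ⟩
          (∑ t λ i → size (V i)) * (∑ t λ j → (toℚ ℓ * σ) * size (V j))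
            ≡⟨ cong₂ _*_ ∑-sizes (trans (∑-*ˡ (toℚ ℓ * σ) λ j → size (V j)) (cong ((toℚ ℓ * σ) *_) ∑-sizes)) ⟩
          toℚ n * ((toℚ ℓ * σ) * toℚ n) ≡⟨ e' (toℚ n) (toℚ ℓ * σ) ⟩
          (toℚ ℓ * σ) * (toℚ n * toℚ n) ∎
          where
          e : ∀ l s a b → l * (s * (a * b)) ≡ a * ((l * s) * b)
          e = solve-∀ ℚring
          e' : ∀ n s → n * (s * n) ≡ s * (n * n)
          e' = solve-∀ ℚring
          few : ∀ i j α → ind (sparseClass i j α) * (∑ n λ x → ∑ n λ y → ind (Eʳ (bigraphOf i j α) x y)) ≤ σ * (size (V i) * size (V j))
          few i j α with densB (bigraphOf i j α) <? σ
          ... | yes p = ≤-trans (≤-eq (*-identityˡ _)) (≤-trans (edges≤density (bigraphOf i j α))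
                  (*-monoʳ (size (V i) * size (V j)) (0≤* (0≤size (V i)) (0≤size (V j))) (<⇒≤ p)))
          ... | no _ = ≤-trans (≤-eq (*-zeroˡ (∑ n λ x → ∑ n λ y → ind (Eʳ (bigraphOf i j α) x y)))) (0≤* 0≤σ (0≤* (0≤size (V i)) (0≤size (V j))))

      module _ {HE : Fin n → Fin n → Fin n → Bool} {N : ℕ} {gr : Fin n → Fin N} {lab : Fin n → Fin N → Bool} {a b c : Fin n → Bool}
               (HE≡ : ∀ u w z → a u ≡ true → b w ≡ true → c z ≡ true → HE u w z ≡ lab w (gr u))
               {ε₁ σ θ η κ : ℚ} (𝓒 : Constants N ε₁ σ θ η κ) (ℓσ≤η : toℚ ℓ * σ ≤ η)
               (reg : IsRegular P HE ε₁ ((θ * θ) * (θ * θ))) where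
        open Constants 𝓒
        private
          good : Fin n → Fin n → Fin n → Bool
          good = proj₁ reg
          lab̅ : Fin n → Fin N → Bool
          lab̅ w p = not (lab w p)
          s = sparse σ

          -- A union bound in the form of a function: it is at least 1 on every unusable triple, and
          -- its four terms can be summed separately.
          exceptional : Fin n → Fin n → Fin n → ℚ
          exceptional x y z = ind (not (good x y z)) + (ind (s x y) + (ind (s x z) + ind (s y z)))

          0≤exceptional : ∀ x y z → 0ℚ ≤ exceptional x y z
          0≤exceptional x y z = 0≤+ (0≤ind (not (good x y z))) (0≤+ (0≤ind (s x y)) (0≤+ (0≤ind (s x z)) (0≤ind (s y z))))

          usable : Fin n → Fin n → Fin n → Bool
          usable x y z = good x y z ∧ (not (s x y) ∧ (not (s x z) ∧ not (s y z)))

          unusable⇒exceptional : ∀ x y z → usable x y z ≡ false → 1ℚ ≤ exceptional x y z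
          unusable⇒exceptional x y z p = lemma (good x y z) (s x y) (s x z) (s y z) p
            where
            1+ : ∀ {r} → 0ℚ ≤ r → 1ℚ ≤ 1ℚ + r
            1+ q = ≤-by q refl
            +1 : ∀ {r} → 1ℚ ≤ r → 1ℚ ≤ 0ℚ + r
            +1 {r} q = ≤-trans q (≤-eq (sym (+-identityˡ r)))
            lemma : ∀ g p q r → g ∧ (not p ∧ (not q ∧ not r)) ≡ false →
              1ℚ ≤ ind (not g) + (ind p + (ind q + ind r))
            lemma false p q r _ = 1+ (0≤+ (0≤ind p) (0≤+ (0≤ind q) (0≤ind r)))
            lemma true true q r _ = +1 (1+ (0≤+ (0≤ind q) (0≤ind r)))
            lemma true false true r _ = +1 (+1 (1+ (0≤ind r)))
            lemma true false false true _ = +1 (+1 (+1 ≤-refl))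

          usable⇒ : ∀ x y z → usable x y z ≡ true →
            good x y z ≡ true × s x y ≡ false × s x z ≡ false × s y z ≡ false
          usable⇒ x y z p = lemma (good x y z) (s x y) (s x z) (s y z) p
            where
            lemma : ∀ g p q r → g ∧ (not p ∧ (not q ∧ not r)) ≡ true → g ≡ true × p ≡ false × q ≡ false × r ≡ false
            lemma true false false false _ = refl , refl , refl , refl

          vol : Fin t → Fin t → Fin t → ℚ
          vol i j k = size (V i) * size (V j) * size (V k)

          weighted : Fin t → Fin t → Fin t → ℚ
          weighted i j k = ∑ n λ x → ind (V i x) * (∑ n λ y → ind (V j y) * (∑ n λ z → ind (V k z) * exceptional x y z))

          0≤weighted : ∀ i j k → 0ℚ ≤ weighted i j k
          0≤weighted i j k = 0≤∑ λ x → 0≤* (0≤ind (V i x)) (0≤∑ λ y → 0≤* (0≤ind (V j y)) (0≤∑ λ z → 0≤* (0≤ind (V k z)) (0≤exceptional x y z)))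

          0≤vol : ∀ i j k → 0ℚ ≤ vol i j k
          0≤vol i j k = 0≤* (0≤* (0≤size (V i)) (0≤size (V j))) (0≤size (V k))

          0≤3η : 0ℚ ≤ (1ℚ + 1ℚ + 1ℚ) * η
          0≤3η = 0≤* (nonNegative⁻¹ (1ℚ + 1ℚ + 1ℚ)) 0≤η

        -- A single usable triple in V_i × V_j × V_k exhibits one dense regular triad, and its
        -- homogeneity settles the claim for the parts i, j, k because the pattern counts ignore
        -- colours. If there is none, every triple of the box has exceptional weight at least 1, and
        -- `weighted` exceeds the volume of the box.
        homogeneous-or-exceptional : ∀ i j k m →
          m ≤ patternEdges gr lab a b (V i) (V j) → m ≤ patternEdges gr lab̅ a b (V i) (V j) →
          m * restrict c (V k) ≤ (1ℚ + 1ℚ + 1ℚ) * η * vol i j k + weighted i j k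
        homogeneous-or-exceptional i j k m m≤₁ m≤₀ =
          go (any? λ x → any? λ y → any? λ z → (V i x ∧ (V j y ∧ (V k z ∧ usable x y z))) Bool.≟ true)
          where
          split : ∀ p q r u → p ∧ (q ∧ (r ∧ u)) ≡ true → p ≡ true × q ≡ true × r ≡ true × u ≡ true
          split true true true true _ = refl , refl , refl , refl
          go : Dec (Σ _ λ x → Σ _ λ y → Σ _ λ z → (V i x ∧ (V j y ∧ (V k z ∧ usable x y z))) ≡ true) → _
          go (yes (x , y , z , p)) with split (V i x) (V j y) (V k z) (usable x y z) p
          ... | px , py , pz , u with eqF⇒≡ (part x) i px | eqF⇒≡ (part y) j py | eqF⇒≡ (part z) k pz | usable⇒ x y z u
          ... | refl | refl | refl | g , dxy , dxz , dyz = ≤-trans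
            (regular⇒homogeneous (triadAt P x y z) HE {gr = gr} {lab = lab} HE≡ 𝓒 (0<size (V i) x px) (0<size (V j) y py) (0<size (V k) z pz)
              (dense⇒σ≤ σ x y dxy) (dense⇒σ≤ σ x z dxz) (dense⇒σ≤ σ y z dyz) (proj₂ (proj₂ reg) x y z g) m m≤₁ m≤₀)
            (≤-by (0≤weighted i j k) refl)
          go (no q) = begin
            m * restrict c (V k)   ≤⟨ *-monoʳ (restrict c (V k)) (0≤restrict c (V k)) (≤-trans m≤₁ (patternEdges≤ gr lab a b (V i) (V j))) ⟩
            size (V i) * size (V j) * restrict c (V k)
              ≤⟨ *-monoˡ (size (V i) * size (V j)) (0≤* (0≤size (V i)) (0≤size (V j))) (restrict≤ c (V k)) ⟩
            vol i j k ≡⟨ vol≡ ⟩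
            (∑ n λ x → ∑ n λ y → ∑ n λ z → ind (V i x) * (ind (V j y) * (ind (V k z) * 1ℚ)))
              ≤⟨ (∑-mono λ x → ∑-mono λ y → ∑-mono λ z → pointwise x y z) ⟩
            (∑ n λ x → ∑ n λ y → ∑ n λ z → ind (V i x) * (ind (V j y) * (ind (V k z) * exceptional x y z)))
              ≡⟨ (∑-cong λ x → trans (∑-cong λ y → trans (∑-*ˡ (ind (V i x)) λ z → ind (V j y) * (ind (V k z) * exceptional x y z))
                    (cong (ind (V i x) *_) (∑-*ˡ (ind (V j y)) λ z → ind (V k z) * exceptional x y z)))
                    (∑-*ˡ (ind (V i x)) λ y → ind (V j y) * (∑ n λ z → ind (V k z) * exceptional x y z))) ⟩
            weighted i j k ≤⟨ ≤-by (0≤* 0≤3η (0≤vol i j k)) (+-comm ((1ℚ + 1ℚ + 1ℚ) * η * vol i j k) (weighted i j k)) ⟩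
            (1ℚ + 1ℚ + 1ℚ) * η * vol i j k + weighted i j k ∎
            where
            vol≡ : vol i j k ≡ ∑ n λ x → ∑ n λ y → ∑ n λ z → ind (V i x) * (ind (V j y) * (ind (V k z) * 1ℚ))
            vol≡ = trans (cong (_* size (V k)) (∑-prod (λ x → ind (V i x)) (λ y → ind (V j y))))
              (trans (sym (∑-*ʳ (size (V k)) λ x → ∑ n λ y → ind (V i x) * ind (V j y)))
              (∑-cong λ x → trans (sym (∑-*ʳ (size (V k)) λ y → ind (V i x) * ind (V j y)))
              (∑-cong λ y → trans (sym (∑-*ˡ (ind (V i x) * ind (V j y)) λ z → ind (V k z)))
              (∑-cong λ z → e (ind (V i x)) (ind (V j y)) (ind (V k z))))))
              where
              e : ∀ a b c → (a * b) * c ≡ a * (b * (c * 1ℚ))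
              e = solve-∀ ℚring
            pointwise : ∀ x y z → ind (V i x) * (ind (V j y) * (ind (V k z) * 1ℚ)) ≤ ind (V i x) * (ind (V j y) * (ind (V k z) * exceptional x y z))
            pointwise x y z = lemma (V i x) (V j y) (V k z) (usable x y z) (λ p → q (x , y , z , p)) (unusable⇒exceptional x y z)
              where
              lemma : ∀ p q r u {v} → ¬ (p ∧ (q ∧ (r ∧ u)) ≡ true) → (u ≡ false → 1ℚ ≤ v) →
                ind p * (ind q * (ind r * 1ℚ)) ≤ ind p * (ind q * (ind r * v))
              lemma true true true true ¬p _ = ⊥-elim (¬p refl)
              lemma true true true false {v} _ 1≤v = *-monoˡ 1ℚ 0≤1 (*-monoˡ 1ℚ 0≤1 (*-monoˡ 1ℚ 0≤1 (1≤v refl)))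
              lemma true true false u {v} _ _ = *-monoˡ 1ℚ 0≤1 (*-monoˡ 1ℚ 0≤1 (≤-eq (trans (*-zeroˡ 1ℚ) (sym (*-zeroˡ v)))))
              lemma true false r u {v} _ _ = *-monoˡ 1ℚ 0≤1 (≤-eq (trans (*-zeroˡ (ind r * 1ℚ)) (sym (*-zeroˡ (ind r * v)))))
              lemma false q r u {v} _ _ = ≤-eq (trans (*-zeroˡ (ind q * (ind r * 1ℚ))) (sym (*-zeroˡ (ind q * (ind r * v)))))

        private
          ∑-exceptional : (∑ n λ x → ∑ n λ y → ∑ n λ z → exceptional x y z) ≤
            (ε₁ + (1ℚ + 1ℚ + 1ℚ) * η) * (toℚ n * (toℚ n * toℚ n))
          ∑-exceptional = begin
            (∑ n λ x → ∑ n λ y → ∑ n λ z → exceptional x y z)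
              ≡⟨ ∑₃-+ (λ x y z → ind (not (good x y z))) (λ x y z → ind (s x y) + (ind (s x z) + ind (s y z))) ⟩
            bad + (∑ n λ x → ∑ n λ y → ∑ n λ z → ind (s x y) + (ind (s x z) + ind (s y z)))
              ≡⟨ cong (bad +_) (trans (∑₃-+ (λ x y z → ind (s x y)) (λ x y z → ind (s x z) + ind (s y z)))
                   (cong₂ _+_ s₁ (trans (∑₃-+ (λ x y z → ind (s x z)) (λ x y z → ind (s y z))) (cong₂ _+_ s₂ s₃)))) ⟩
            bad + (toℚ n * S + (toℚ n * S + toℚ n * S))
              ≤⟨ ≤-by (0≤+ (≤⇒0≤- bad≤) (0≤* (0≤* (nonNegative⁻¹ (1ℚ + 1ℚ + 1ℚ)) (0≤toℚ n)) (≤⇒0≤- S≤))) (e bad (toℚ n) S ε₁ η) ⟩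
            (ε₁ + (1ℚ + 1ℚ + 1ℚ) * η) * (toℚ n * (toℚ n * toℚ n)) ∎
            where
            bad S : ℚ
            bad = ∑ n λ x → ∑ n λ y → ∑ n λ z → ind (not (good x y z))
            S = ∑ n λ x → ∑ n λ y → ind (s x y)
            bad≤ : bad ≤ ε₁ * toℚ n * (toℚ n * toℚ n)
            bad≤ = ≤-trans (≤-eq (sym (count3-∑ (λ x y z → not (good x y z))))) (proj₁ (proj₂ reg))
            S≤ : S ≤ η * (toℚ n * toℚ n)
            S≤ = ≤-trans (sparse≤ σ (<⇒≤ 0<σ)) (*-monoʳ (toℚ n * toℚ n) (0≤sq (toℚ n)) ℓσ≤η)
            ∑₃-+ : (f g : Fin n → Fin n → Fin n → ℚ) → (∑ n λ x → ∑ n λ y → ∑ n λ z → f x y z + g x y z) ≡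
              (∑ n λ x → ∑ n λ y → ∑ n λ z → f x y z) + (∑ n λ x → ∑ n λ y → ∑ n λ z → g x y z)
            ∑₃-+ f g = trans (∑-cong λ x → trans (∑-cong λ y → ∑-+ (f x y) (g x y))
                (∑-+ (λ y → ∑ n λ z → f x y z) (λ y → ∑ n λ z → g x y z)))
              (∑-+ (λ x → ∑ n λ y → ∑ n λ z → f x y z) (λ x → ∑ n λ y → ∑ n λ z → g x y z))
            s₁ : (∑ n λ x → ∑ n λ y → ∑ n λ z → ind (s x y)) ≡ toℚ n * S
            s₁ = trans (∑-cong λ x → trans (∑-cong λ y → ∑-const n (ind (s x y))) (∑-*ˡ (toℚ n) λ y → ind (s x y)))
              (∑-*ˡ (toℚ n) λ x → ∑ n λ y → ind (s x y))
            s₂ : (∑ n λ x → ∑ n λ y → ∑ n λ z → ind (s x z)) ≡ toℚ n * S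
            s₂ = trans (∑-cong λ x → ∑-const n (∑ n λ z → ind (s x z))) (∑-*ˡ (toℚ n) λ x → ∑ n λ z → ind (s x z))
            s₃ : (∑ n λ x → ∑ n λ y → ∑ n λ z → ind (s y z)) ≡ toℚ n * S
            s₃ = ∑-const n S
            e : ∀ b n S ε η → (ε + (1ℚ + 1ℚ + 1ℚ) * η) * (n * (n * n)) ≡
              (b + (n * S + (n * S + n * S))) + ((ε * n * (n * n) - b) + ((1ℚ + 1ℚ + 1ℚ) * n) * (η * (n * n) - S))
            e = solve-∀ ℚring

          ∑-weighted : (∑ t λ i → ∑ t λ j → ∑ t λ k → weighted i j k) ≡ (∑ n λ x → ∑ n λ y → ∑ n λ z → exceptional x y z)
          ∑-weighted = trans (∑-cong λ i → trans (∑-cong λ j → pull₁ i j) (pull₂ i)) (∑-parts λ x → ∑ n λ y → ∑ n λ z → exceptional x y z)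
            where
            pull₁ : ∀ i j → (∑ t λ k → weighted i j k) ≡ ∑ n λ x → ind (V i x) * (∑ n λ y → ind (V j y) * (∑ n λ z → exceptional x y z))
            pull₁ i j = trans (∑-swap λ k x → ind (V i x) * (∑ n λ y → ind (V j y) * (∑ n λ z → ind (V k z) * exceptional x y z)))
              (∑-cong λ x → trans (∑-*ˡ (ind (V i x)) λ k → ∑ n λ y → ind (V j y) * (∑ n λ z → ind (V k z) * exceptional x y z))
                (cong (ind (V i x) *_) (trans (∑-swap λ k y → ind (V j y) * (∑ n λ z → ind (V k z) * exceptional x y z))
                  (∑-cong λ y → trans (∑-*ˡ (ind (V j y)) λ k → ∑ n λ z → ind (V k z) * exceptional x y z)
                    (cong (ind (V j y) *_) (∑-parts λ z → exceptional x y z))))))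
            pull₂ : ∀ i → (∑ t λ j → ∑ n λ x → ind (V i x) * (∑ n λ y → ind (V j y) * (∑ n λ z → exceptional x y z))) ≡
              ∑ n λ x → ind (V i x) * (∑ n λ y → ∑ n λ z → exceptional x y z)
            pull₂ i = trans (∑-swap λ j x → ind (V i x) * (∑ n λ y → ind (V j y) * (∑ n λ z → exceptional x y z)))
              (∑-cong λ x → trans (∑-*ˡ (ind (V i x)) λ j → ∑ n λ y → ind (V j y) * (∑ n λ z → exceptional x y z))
                (cong (ind (V i x) *_) (∑-parts λ y → ∑ n λ z → exceptional x y z)))

          ∑-vol : (∑ t λ i → ∑ t λ j → ∑ t λ k → vol i j k) ≡ toℚ n * (toℚ n * toℚ n)
          ∑-vol = trans (∑-cong λ i → trans (∑-cong λ j → trans (∑-*ˡ (size (V i) * size (V j)) λ k → size (V k))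
                (trans (cong ((size (V i) * size (V j)) *_) ∑-sizes) (e (size (V i)) (size (V j)) (toℚ n))))
              (trans (∑-*ˡ (size (V i) * toℚ n) λ j → size (V j)) (trans (cong ((size (V i) * toℚ n) *_) ∑-sizes) (*-assoc (size (V i)) (toℚ n) (toℚ n)))))
            (trans (∑-*ʳ (toℚ n * toℚ n) λ i → size (V i)) (cong (_* (toℚ n * toℚ n)) ∑-sizes))
            where
            e : ∀ a b n → (a * b) * n ≡ (a * n) * b
            e = solve-∀ ℚring

        -- Of the 6η, half comes from the homogeneity bound and half from the three pairs of a
        -- triple, any of which may lie in a sparse bigraph.
        ∑-homogeneous : (m : Fin t → Fin t → ℚ) →
          (∀ i j → m i j ≤ patternEdges gr lab a b (V i) (V j)) → (∀ i j → m i j ≤ patternEdges gr lab̅ a b (V i) (V j)) →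
          (∑ t λ i → ∑ t λ j → m i j) * size c ≤
          (ε₁ + (1ℚ + 1ℚ + 1ℚ + (1ℚ + 1ℚ + 1ℚ)) * η) * (toℚ n * (toℚ n * toℚ n))
        ∑-homogeneous m m≤₁ m≤₀ = begin
          (∑ t λ i → ∑ t λ j → m i j) * size c ≡⟨ expand ⟩
          (∑ t λ i → ∑ t λ j → ∑ t λ k → m i j * restrict c (V k))
            ≤⟨ (∑-mono λ i → ∑-mono λ j → ∑-mono λ k → homogeneous-or-exceptional i j k (m i j) (m≤₁ i j) (m≤₀ i j)) ⟩
          (∑ t λ i → ∑ t λ j → ∑ t λ k → (1ℚ + 1ℚ + 1ℚ) * η * vol i j k + weighted i j k) ≡⟨ collect ⟩
          (1ℚ + 1ℚ + 1ℚ) * η * (∑ t λ i → ∑ t λ j → ∑ t λ k → vol i j k) + (∑ t λ i → ∑ t λ j → ∑ t λ k → weighted i j k)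
            ≤⟨ +-mono-≤ (≤-eq (cong ((1ℚ + 1ℚ + 1ℚ) * η *_) ∑-vol)) (≤-trans (≤-eq ∑-weighted) ∑-exceptional) ⟩
          _ ≡⟨ e ε₁ η (toℚ n * (toℚ n * toℚ n)) ⟩
          _ ∎
          where
          e : ∀ ε η n → (1ℚ + 1ℚ + 1ℚ) * η * n + (ε + (1ℚ + 1ℚ + 1ℚ) * η) * n ≡ (ε + (1ℚ + 1ℚ + 1ℚ + (1ℚ + 1ℚ + 1ℚ)) * η) * n
          e = solve-∀ ℚring
          size-c : size c ≡ ∑ t λ k → restrict c (V k)
          size-c = trans (sym (∑-parts λ x → ind (c x))) (∑-cong λ k → ∑-cong λ x → *-comm (ind (V k x)) (ind (c x)))
          expand : (∑ t λ i → ∑ t λ j → m i j) * size c ≡ ∑ t λ i → ∑ t λ j → ∑ t λ k → m i j * restrict c (V k)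
          expand = trans (cong ((∑ t λ i → ∑ t λ j → m i j) *_) size-c)
            (trans (sym (∑-*ʳ (∑ t λ k → restrict c (V k)) λ i → ∑ t λ j → m i j))
            (∑-cong λ i → trans (sym (∑-*ʳ (∑ t λ k → restrict c (V k)) (m i)))
            (∑-cong λ j → sym (∑-*ˡ (m i j) λ k → restrict c (V k)))))
          3η : ℚ
          3η = (1ℚ + 1ℚ + 1ℚ) * η
          collect : (∑ t λ i → ∑ t λ j → ∑ t λ k → 3η * vol i j k + weighted i j k) ≡
            3η * (∑ t λ i → ∑ t λ j → ∑ t λ k → vol i j k) + (∑ t λ i → ∑ t λ j → ∑ t λ k → weighted i j k)
          collect = trans (∑-cong λ i → trans (∑-cong λ j → trans (∑-+ (λ k → 3η * vol i j k) (weighted i j))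
                (cong (_+ ∑ t (weighted i j)) (∑-*ˡ 3η (vol i j))))
              (trans (∑-+ (λ j → 3η * ∑ t (vol i j)) (λ j → ∑ t (weighted i j)))
                (cong (_+ (∑ t λ j → ∑ t (weighted i j))) (∑-*ˡ 3η λ j → ∑ t (vol i j)))))
            (trans (∑-+ (λ i → 3η * (∑ t λ j → ∑ t (vol i j))) (λ i → ∑ t λ j → ∑ t (weighted i j)))
              (cong (_+ (∑ t λ i → ∑ t λ j → ∑ t (weighted i j))) (∑-*ˡ 3η λ i → ∑ t λ j → ∑ t (vol i j))))

  open Decompositions

  -- Few parts force many mixed rows.

  module Mixing where

    private variable
      n : ℕ

    recip : ℕ → ℚ
    recip = frac 1

    0≤recip : ∀ k → 0ℚ ≤ recip k
    0≤recip k = 0≤frac 1 k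

    recip-*≤1 : ∀ k → recip k * toℚ k ≤ 1ℚ
    recip-*≤1 zero = ≤-trans (≤-eq (*-zeroˡ 0ℚ)) 0≤1
    recip-*≤1 (suc k) = ≤-eq (trans (*-comm (recip (suc k)) (toℚ (suc k))) (frac-* 1 k))

    -- The form with `k` squared holds at 0 as well, since `recip 0` is 0, so parts that miss A need
    -- no separate case.
    recip-*-* : ∀ k → recip k * (toℚ k * toℚ k) ≡ toℚ k
    recip-*-* zero = refl
    recip-*-* (suc k) = trans (e (recip (suc k)) (toℚ (suc k))) (trans (cong (_* toℚ (suc k)) (frac-* 1 k)) (*-identityˡ (toℚ (suc k))))
      where
      e : ∀ r k → r * (k * k) ≡ (k * r) * k
      e = solve-∀ ℚring

    -- In the application f = |A|/N is the size of a group, and q = |B|/4 is the number of rows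
    -- whose set contains one given group but not another.
    module _ {t ℓ : ℕ} (P : Decomp n t ℓ) {N : ℕ} (gr : Fin n → Fin N) (lab : Fin n → Fin N → Bool) (a b : Fin n → Bool)
             {f q : ℚ} (0≤f : 0ℚ ≤ f) (0≤q : 0ℚ ≤ q)
             (fibres : ∀ p → (∑ n λ x → ind (a x) * ind (eqF p (gr x))) ≤ f)
             (pairs : ∀ p p' → q * (1ℚ - ind (eqF p p')) ≤ (∑ n λ y → ind (b y) * (ind (lab y p) * ind (not (lab y p')))))
      where
      open Decomp P
      private
        V : Fin t → Fin n → Bool
        V = inV P

        A : Fin t → Fin n → ℚ
        A i x = ind (a x) * ind (V i x)
        0≤A : ∀ i x → 0ℚ ≤ A i x
        0≤A i x = 0≤* (0≤ind (a x)) (0≤ind (V i x))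

        k : Fin t → ℕ
        k i = count n (λ x → a x ∧ V i x)
        α : Fin t → ℚ
        α i = restrict a (V i)
        k-α : ∀ i → toℚ (k i) ≡ α i
        k-α i = trans (count-size (λ x → a x ∧ V i x)) (∑-cong λ x → ind-∧ (a x) (V i x))
        r : Fin t → ℚ
        r i = recip (k i)

        deg : (Fin n → Fin N → Bool) → Fin t → Fin n → ℚ
        deg l i y = ∑ n λ x → A i x * ind (l y (gr x))
        lab̅ : Fin n → Fin N → Bool
        lab̅ y p = not (lab y p)

        0≤deg : ∀ l i y → 0ℚ ≤ deg l i y
        0≤deg l i y = 0≤∑ λ x → 0≤* (0≤A i x) (0≤ind (l y (gr x)))

        deg≤ : ∀ l i y → r i * deg l i y ≤ 1ℚ
        deg≤ l i y = ≤-trans (*-monoˡ (r i) (0≤recip (k i)) (∑-mono λ x →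
            ≤-trans (≤-eq (*-comm (A i x) (ind (l y (gr x))))) (ind*≤ (l y (gr x)) (0≤A i x))))
          (≤-trans (≤-eq (cong (r i *_) (sym (k-α i)))) (recip-*≤1 (k i)))

      -- A row y with n₁ ones and n₀ zeros on V i ∩ A contributes n₁ n₀ / (n₁ + n₀), a lower bound for both n₁ and n₀
      -- that is bilinear up to a factor depending on i only.
      mixing : Fin t → Fin t → ℚ
      mixing i j = ∑ n λ y → (ind (b y) * ind (V j y)) * (r i * (deg lab i y * deg lab̅ i y))

      private
        patternEdges-deg : ∀ l i j → patternEdges gr l a b (V i) (V j) ≡ ∑ n λ y → (ind (b y) * ind (V j y)) * deg l i y
        patternEdges-deg l i j = trans (∑-swap λ u w → A i u * ((ind (b w) * ind (V j w)) * ind (l w (gr u))))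
          (∑-cong λ w → trans (∑-cong λ u → e (A i u) (ind (b w) * ind (V j w)) (ind (l w (gr u))))
            (∑-*ˡ (ind (b w) * ind (V j w)) λ u → A i u * ind (l w (gr u))))
          where
          e : ∀ a b c → a * (b * c) ≡ b * (a * c)
          e = solve-∀ ℚring

        shrink : ∀ {r x y} → 0ℚ ≤ x → r * y ≤ 1ℚ → r * (x * y) ≤ x
        shrink {r} {x} {y} p ry≤1 = ≤-trans (≤-eq (e r x y)) (≤-trans (*-monoˡ x p ry≤1) (≤-eq (*-identityʳ x)))
          where
          e : ∀ r x y → r * (x * y) ≡ x * (r * y)
          e = solve-∀ ℚring

      mixing≤ : ∀ i j → mixing i j ≤ patternEdges gr lab a b (V i) (V j)
      mixing≤ i j = ≤-trans (∑-mono λ y → *-monoˡ (ind (b y) * ind (V j y)) (0≤* (0≤ind (b y)) (0≤ind (V j y)))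
        (shrink {r i} {deg lab i y} {deg lab̅ i y} (0≤deg lab i y) (deg≤ lab̅ i y))) (≤-eq (sym (patternEdges-deg lab i j)))

      mixing≤' : ∀ i j → mixing i j ≤ patternEdges gr lab̅ a b (V i) (V j)
      mixing≤' i j = ≤-trans (∑-mono λ y → *-monoˡ (ind (b y) * ind (V j y)) (0≤* (0≤ind (b y)) (0≤ind (V j y)))
        (≤-trans (≤-eq (cong (r i *_) (*-comm (deg lab i y) (deg lab̅ i y))))
          (shrink {r i} {deg lab̅ i y} {deg lab i y} (0≤deg lab̅ i y) (deg≤ lab i y)))) (≤-eq (sym (patternEdges-deg lab̅ i j)))

      private
        ∑ⱼ-mixing : ∀ i → (∑ t λ j → mixing i j) ≡ r i * (∑ n λ y → ind (b y) * (deg lab i y * deg lab̅ i y))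
        ∑ⱼ-mixing i = trans (∑-cong λ j → ∑-cong λ y → e (ind (b y)) (ind (V j y)) (r i) (deg lab i y * deg lab̅ i y))
          (trans (∑-parts P λ y → r i * (ind (b y) * (deg lab i y * deg lab̅ i y))) (∑-*ˡ (r i) λ y → ind (b y) * (deg lab i y * deg lab̅ i y)))
          where
          e : ∀ b v r d → (b * v) * (r * d) ≡ v * (r * (b * d))
          e = solve-∀ ℚring

        -- Double counting of triples (x, x', y) with x, x' in V_i ∩ A such that the set of y
        -- contains the group of x but not that of x'. Fixing y gives the product of the two
        -- degrees. Fixing x and x' gives at least q whenever their groups differ, and at most f
        -- choices of x' share the group of x.
        separated≥ : ∀ i → q * (α i * α i - α i * f) ≤ (∑ n λ y → ind (b y) * (deg lab i y * deg lab̅ i y))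
        separated≥ i = begin
          q * (α i * α i - α i * f)
            ≤⟨ *-monoˡ q 0≤q (≤-trans (≤-by (≤⇒0≤- same≤) (e' (α i * α i) (α i * f) same)) (≤-eq (sym distinct))) ⟩
          q * (∑ n λ x → ∑ n λ x' → (A i x * A i x') * (1ℚ - ind (eqF (gr x) (gr x'))))
            ≡⟨ sym (trans (∑-cong λ x → ∑-*ˡ q λ x' → (A i x * A i x') * (1ℚ - ind (eqF (gr x) (gr x'))))
                  (∑-*ˡ q λ x → ∑ n λ x' → (A i x * A i x') * (1ℚ - ind (eqF (gr x) (gr x'))))) ⟩
          (∑ n λ x → ∑ n λ x' → q * ((A i x * A i x') * (1ℚ - ind (eqF (gr x) (gr x')))))
            ≤⟨ (∑-mono λ x → ∑-mono λ x' → ≤-trans (≤-eq (e₁ q (A i x * A i x') (1ℚ - ind (eqF (gr x) (gr x')))))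
                  (*-monoˡ (A i x * A i x') (0≤* (0≤A i x) (0≤A i x')) (pairs (gr x) (gr x')))) ⟩
          (∑ n λ x → ∑ n λ x' → (A i x * A i x') * (∑ n λ y → ind (b y) * (ind (lab y (gr x)) * ind (lab̅ y (gr x')))))
            ≡⟨ (∑-cong λ x → ∑-cong λ x' → trans (sym (∑-*ˡ (A i x * A i x') λ y → ind (b y) * (ind (lab y (gr x)) * ind (lab̅ y (gr x')))))
                  (∑-cong λ y → e₂ (A i x) (A i x') (ind (b y)) (ind (lab y (gr x))) (ind (lab̅ y (gr x'))))) ⟩
          (∑ n λ x → ∑ n λ x' → ∑ n λ y → ind (b y) * ((A i x * ind (lab y (gr x))) * (A i x' * ind (lab̅ y (gr x')))))
            ≡⟨ sym (swap₃ λ x x' y → ind (b y) * ((A i x * ind (lab y (gr x))) * (A i x' * ind (lab̅ y (gr x'))))) ⟩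
          (∑ n λ y → ∑ n λ x → ∑ n λ x' → ind (b y) * ((A i x * ind (lab y (gr x))) * (A i x' * ind (lab̅ y (gr x')))))
            ≡⟨ (∑-cong λ y → trans (∑-cong λ x → ∑-*ˡ (ind (b y)) λ x' → (A i x * ind (lab y (gr x))) * (A i x' * ind (lab̅ y (gr x'))))
                  (trans (∑-*ˡ (ind (b y)) λ x → ∑ n λ x' → (A i x * ind (lab y (gr x))) * (A i x' * ind (lab̅ y (gr x'))))
                    (cong (ind (b y) *_) (sym (∑-prod (λ x → A i x * ind (lab y (gr x))) (λ x' → A i x' * ind (lab̅ y (gr x')))))))) ⟩
          (∑ n λ y → ind (b y) * (deg lab i y * deg lab̅ i y)) ∎
          where
          same : ℚ
          same = ∑ n λ x → A i x * (∑ n λ x' → A i x' * ind (eqF (gr x) (gr x')))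
          same≤ : same ≤ α i * f
          same≤ = ≤-trans (∑-mono λ x → *-monoˡ (A i x) (0≤A i x) (≤-trans (∑-mono λ x' →
              *-monoʳ (ind (eqF (gr x) (gr x'))) (0≤ind (eqF (gr x) (gr x')))
                (≤-trans (≤-eq (*-comm (ind (a x')) (ind (V i x')))) (ind*≤ (V i x') (0≤ind (a x'))))) (fibres (gr x))))
            (≤-eq (∑-*ʳ f (A i)))
          distinct : (∑ n λ x → ∑ n λ x' → (A i x * A i x') * (1ℚ - ind (eqF (gr x) (gr x')))) ≡ α i * α i - same
          distinct = trans (∑-cong λ x → trans (∑-cong λ x' → e (A i x) (A i x') (ind (eqF (gr x) (gr x'))))
                (∑-- (λ x' → A i x * A i x') λ x' → A i x * (A i x' * ind (eqF (gr x) (gr x')))))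
              (trans (∑-- (λ x → ∑ n λ x' → A i x * A i x') λ x → ∑ n λ x' → A i x * (A i x' * ind (eqF (gr x) (gr x'))))
              (cong₂ _-_ (sym (∑-prod (A i) (A i))) (∑-cong λ x → ∑-*ˡ (A i x) λ x' → A i x' * ind (eqF (gr x) (gr x')))))
            where
            e : ∀ a b d → (a * b) * (1ℚ - d) ≡ a * b - a * (b * d)
            e = solve-∀ ℚring
          e' : ∀ s u v → s - v ≡ (s - u) + (u - v)
          e' = solve-∀ ℚring
          e₁ : ∀ q a d → q * (a * d) ≡ a * (q * d)
          e₁ = solve-∀ ℚring
          e₂ : ∀ a a' b l l' → (a * a') * (b * (l * l')) ≡ b * ((a * l) * (a' * l'))
          e₂ = solve-∀ ℚring

        ∑ⱼ-mixing≥ : ∀ i → q * (α i - f) ≤ (∑ t λ j → mixing i j)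
        ∑ⱼ-mixing≥ i = begin
          -- The slack (1 - r α) f vanishes unless the part misses A; in that case r = 0 and the
          -- bound to be proved is not positive.
          q * (α i - f)  ≤⟨ *-monoˡ q 0≤q (≤-by (0≤* (≤⇒0≤- rα≤1) 0≤f) (trans (e (r i) (α i) f) (cong (λ s → s - f + (1ℚ - r i * α i) * f) rαα))) ⟩
          q * (r i * (α i * α i) - r i * (α i * f)) ≡⟨ e' q (r i) (α i) f ⟩
          r i * (q * (α i * α i - α i * f)) ≤⟨ *-monoˡ (r i) (0≤recip (k i)) (separated≥ i) ⟩
          r i * (∑ n λ y → ind (b y) * (deg lab i y * deg lab̅ i y)) ≡⟨ sym (∑ⱼ-mixing i) ⟩
          (∑ t λ j → mixing i j) ∎
          where
          rα≤1 : r i * α i ≤ 1ℚ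
          rα≤1 = subst (λ s → r i * s ≤ 1ℚ) (k-α i) (recip-*≤1 (k i))
          rαα : r i * (α i * α i) ≡ α i
          rαα = subst (λ s → r i * (s * s) ≡ s) (k-α i) (recip-*-* (k i))
          e : ∀ r a f → r * (a * a) - r * (a * f) ≡ (r * (a * a) - f) + (1ℚ - r * a) * f
          e = solve-∀ ℚring
          e' : ∀ q r a f → q * (r * (a * a) - r * (a * f)) ≡ r * (q * (a * a - a * f))
          e' = solve-∀ ℚring

      -- Every part forfeits at most one group's worth of A, hence t parts forfeit t f in total.
      -- This is where a small number of parts enters.
      ∑-mixing≥ : q * (size a - toℚ t * f) ≤ (∑ t λ i → ∑ t λ j → mixing i j)
      ∑-mixing≥ = begin
        q * (size a - toℚ t * f) ≡⟨ cong₂ (λ s u → q * (s - u)) size-a (sym (∑-const t f)) ⟩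
        q * ((∑ t λ i → α i) - (∑ t λ _ → f)) ≡⟨ cong (q *_) (sym (∑-- α (λ _ → f))) ⟩
        q * (∑ t λ i → α i - f) ≡⟨ sym (∑-*ˡ q λ i → α i - f) ⟩
        (∑ t λ i → q * (α i - f)) ≤⟨ ∑-mono ∑ⱼ-mixing≥ ⟩
        (∑ t λ i → ∑ t λ j → mixing i j) ∎
        where
        size-a : size a ≡ ∑ t α
        size-a = trans (sym (∑-parts P λ x → ind (a x))) (∑-cong λ i → ∑-cong λ x → *-comm (ind (V i x)) (ind (a x)))

  open Mixing

  -- Extracting a prescribed tripartite pattern from a copy of k ⊗ U(k) in Trip(H).

  module CopiesOfU where

    distinct3-mid : ∀ p q q' r → distinct3 p q r ≡ true → distinct3 p q' r ≡ true → q ≡ q'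
    distinct3-mid = toWitness {a? = all? λ p → all? λ q → all? λ q' → all? λ r →
      (distinct3 p q r Bool.≟ true) →-dec ((distinct3 p q' r Bool.≟ true) →-dec (q F.≟ q'))} tt

    distinct3-left : ∀ p p' q r → distinct3 p q r ≡ true → distinct3 p' q r ≡ true → p ≡ p'
    distinct3-left = toWitness {a? = all? λ p → all? λ p' → all? λ q → all? λ r →
      (distinct3 p q r Bool.≟ true) →-dec ((distinct3 p' q r Bool.≟ true) →-dec (p F.≟ p'))} tt

    distinct3-right : ∀ p q r r' → distinct3 p q r ≡ true → distinct3 p q r' ≡ true → r ≡ r'
    distinct3-right = toWitness {a? = all? λ p → all? λ q → all? λ r → all? λ r' →
      (distinct3 p q r Bool.≟ true) →-dec ((distinct3 p q r' Bool.≟ true) →-dec (r F.≟ r'))} tt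

    ∧-true : ∀ {a b} → a ∧ b ≡ true → a ≡ true × b ≡ true
    ∧-true {true} {true} _ = refl , refl

    -- A copy of k ⊗ U(k) on the vertices of H itself; only its edges between the three classes are controlled.
    record Copy (H : Graph3) (k : ℕ) : Set where
      open Graph3 H
      field
        α : Fin k → Fin n
        β : Subset k → Fin n
        γ : Fin k → Fin n
        edge : ∀ i S z {j} → lookup S j ≡ true → E (α i) (β S) (γ z) ≡ lookup S i
        α-inj : ∀ i i' → α i ≡ α i' → i ≡ i'
        β-inj : ∀ S S' {j j'} → lookup S j ≡ true → lookup S' j' ≡ true → β S ≡ β S' → S ≡ S'
        γ-inj : ∀ z z' → γ z ≡ γ z' → z ≡ z'
        α≢γ : ∀ i z → α i ≢ γ z
        β≢γ : ∀ S z {j} → lookup S j ≡ true → β S ≢ γ z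

    -- An edge of Trip(H) has one vertex of each of the three kinds. The full set forms an edge with
    -- every α i and γ z, which pins each class to one kind, so dropping the kind is injective on
    -- each class. The vertex of the empty set lies in no edge and may have any kind; this explains
    -- the hypotheses `lookup S j ≡ true`. Index `zero` of `Fin (suc k)` serves as reference vertex.
    copy : ∀ {H k} → Embeds (kU (suc k)) (Trip H) → Copy H (suc k)
    copy {H} {k} (f , f-inj , f-edge) = record
      { α = λ i → proj₂ (a i) ; β = λ S → proj₂ (b S) ; γ = λ z → proj₂ (c z)
      ; edge = edge
      ; α-inj = λ i i' p → inj₁-injective (inj₁-injective (f-inj _ _ (cong₂ _,_ (α-part i i') p)))
      ; β-inj = λ S S' {j} {j'} Sj S'j' p → inj₂-injective (inj₁-injective (f-inj _ _ (cong₂ _,_ (trans (β-part S j Sj) (sym (β-part S' j' S'j'))) p)))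
      ; γ-inj = λ z z' p → inj₂-injective (f-inj _ _ (cong₂ _,_ (γ-part z z') p))
      ; α≢γ = λ i z p → ends-distinct _ _ _ (full-edge i z) p
      ; β≢γ = λ S z {j} Sj p → last-distinct _ _ _ (proj₂ (∧-true (trans (sym (cross j S z)) Sj))) p
      }
      where
      open Graph3 H
      a : Fin (suc k) → Fin 3 × Fin n
      a i = f (inj₁ (inj₁ i))
      b : Subset (suc k) → Fin 3 × Fin n
      b S = f (inj₁ (inj₂ S))
      c : Fin (suc k) → Fin 3 × Fin n
      c z = f (inj₂ z)
      cross : ∀ i S z → lookup S i ≡ distinct3 (proj₁ (a i)) (proj₁ (b S)) (proj₁ (c z)) ∧ E (proj₂ (a i)) (proj₂ (b S)) (proj₂ (c z))
      cross i S z = trans (sym (simp (lookup S i))) (f-edge (inj₁ (inj₁ i)) (inj₁ (inj₂ S)) (inj₂ z))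
        where
        simp : ∀ x → (x ∧ true) ∨ (false ∨ false) ≡ x
        simp true = refl
        simp false = refl
      full : Subset (suc k)
      full = tabulate λ _ → true
      full-cross : ∀ i z → distinct3 (proj₁ (a i)) (proj₁ (b full)) (proj₁ (c z)) ∧ E (proj₂ (a i)) (proj₂ (b full)) (proj₂ (c z)) ≡ true
      full-cross i z = trans (sym (cross i full z)) (lookup∘tabulate (λ _ → true) i)
      full-edge : ∀ i z → E (proj₂ (a i)) (proj₂ (b full)) (proj₂ (c z)) ≡ true
      full-edge i z = proj₂ (∧-true (full-cross i z))
      full-distinct : ∀ i z → distinct3 (proj₁ (a i)) (proj₁ (b full)) (proj₁ (c z)) ≡ true
      full-distinct i z = proj₁ (∧-true (full-cross i z))
      α-part : ∀ i i' → proj₁ (a i) ≡ proj₁ (a i')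
      α-part i i' = distinct3-left _ _ (proj₁ (b full)) (proj₁ (c zero)) (full-distinct i zero) (full-distinct i' zero)
      γ-part : ∀ z z' → proj₁ (c z) ≡ proj₁ (c z')
      γ-part z z' = distinct3-right (proj₁ (a zero)) (proj₁ (b full)) _ _ (full-distinct zero z) (full-distinct zero z')
      β-part : ∀ S j → lookup S j ≡ true → proj₁ (b S) ≡ proj₁ (b full)
      β-part S j Sj = distinct3-mid (proj₁ (a j)) _ _ (proj₁ (c zero)) (proj₁ (∧-true (trans (sym (cross j S zero)) Sj))) (full-distinct j zero)
      edge : ∀ i S z {j} → lookup S j ≡ true → E (proj₂ (a i)) (proj₂ (b S)) (proj₂ (c z)) ≡ lookup S i
      edge i S z {j} Sj = sym (trans (cross i S z) (cong (_∧ E (proj₂ (a i)) (proj₂ (b S)) (proj₂ (c z)))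
        (trans (cong (λ p → distinct3 (proj₁ (a i)) p (proj₁ (c z))) (β-part S j Sj)) (full-distinct i z))))
      true≢false : true ≢ false
      true≢false ()
      ends-distinct : ∀ u v w → E u v w ≡ true → u ≢ w
      ends-distinct u v w p refl = true≢false (trans (sym p) (trans (sym₂₃ u v u) (irr u v)))
      last-distinct : ∀ u v w → E u v w ≡ true → v ≢ w
      last-distinct u v w p refl = true≢false (trans (sym p) (trans (sym₁₂ u v v) (trans (sym₂₃ v u v) (irr v u))))

    avoid : ∀ {m v} (g : Fin m → Fin v) (h : Fin (suc m) → Fin v) → (∀ e e' → h e ≡ h e' → e ≡ e') →
      Σ (Fin (suc m)) λ e → ∀ i → g i ≢ h e
    avoid {m} g h h-inj = go (any? λ e → all? λ i → ¬? (g i F.≟ h e))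
      where
      go : Dec (Σ (Fin (suc m)) λ e → ∀ i → g i ≢ h e) → _
      go (yes p) = p
      go (no q) = ⊥-elim (clash (pigeonhole (ℕ.n<1+n m) φ))
        where
        hit : ∀ e → Σ (Fin m) λ i → g i ≡ h e
        hit e with ¬∀⟶∃¬ m (λ i → g i ≢ h e) (λ i → ¬? (g i F.≟ h e)) (λ r → q (e , r))
        ... | i , ¬¬p = i , decidable-stable (g i F.≟ h e) ¬¬p
        φ : Fin (suc m) → Fin m
        φ e = proj₁ (hit e)
        clash : ¬ (Σ _ λ e → Σ _ λ e' → e F.< e' × φ e ≡ φ e')
        clash (e , e' , e<e' , p) = F.<⇒≢ e<e' (h-inj e e' (trans (sym (proj₂ (hit e))) (trans (cong g p) (proj₂ (hit e')))))

    -- The index set consists of m elements that carry the pattern and m (m + 1) marks, which give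
    -- each row y a choice of m + 1 candidate sets.
    module Realise {H : Graph3} {m : ℕ} (pattern' : Fin m → Fin m → Bool)
                   (Q : Copy H (m ℕ.+ m ℕ.* suc m)) where
      open Graph3 H
      open Copy Q
      private
        k = m ℕ.+ m ℕ.* suc m

      -- Marking S_{y,e} with its own element (y,e) makes these sets nonempty and pairwise distinct; by pigeonhole
      -- some e then keeps β S_{y,e} away from the images of α, which edges alone only guarantee for elements of S.
      subset : Fin m → Fin (suc m) → Subset k
      subset y e = tabulate λ i → [ (λ x → pattern' x y) , (λ j → eqF (combine y e) j) ]′ (splitAt m i)

      subset-pattern : ∀ y e x → lookup (subset y e) (x ↑ˡ (m ℕ.* suc m)) ≡ pattern' x y
      subset-pattern y e x = trans (lookup∘tabulate _ (x ↑ˡ (m ℕ.* suc m)))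
        (cong [ (λ x → pattern' x y) , (λ j → eqF (combine y e) j) ]′ (F.splitAt-↑ˡ m x (m ℕ.* suc m)))

      subset-mark : ∀ y e j → lookup (subset y e) (m ↑ʳ j) ≡ eqF (combine y e) j
      subset-mark y e j = trans (lookup∘tabulate _ (m ↑ʳ j))
        (cong [ (λ x → pattern' x y) , (λ j → eqF (combine y e) j) ]′ (F.splitAt-↑ʳ m (m ℕ.* suc m) j))

      subset-nonempty : ∀ y e → lookup (subset y e) (m ↑ʳ combine y e) ≡ true
      subset-nonempty y e = trans (subset-mark y e (combine y e)) (eqF-refl (combine y e))

      subset-inj : ∀ y e y' e' → β (subset y e) ≡ β (subset y' e') → y ≡ y' × e ≡ e'
      subset-inj y e y' e' p = F.combine-injective y e y' e' (sym (eqF⇒≡ (combine y' e') (combine y e)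
        (trans (sym (subset-mark y' e' (combine y e)))
          (trans (cong (λ S → lookup S (m ↑ʳ combine y e)) (sym (β-inj _ _ (subset-nonempty y e) (subset-nonempty y' e') p)))
            (subset-nonempty y e)))))

      private
        ια : Fin m → Fin n
        ια x = α (x ↑ˡ (m ℕ.* suc m))
        ιγ : Fin m → Fin n
        ιγ z = γ (z ↑ˡ (m ℕ.* suc m))
        fresh : ∀ y → Σ (Fin (suc m)) λ e → ∀ i → ια i ≢ β (subset y e)
        fresh y = avoid ια (λ e → β (subset y e)) λ e e' p → proj₂ (subset-inj y e y e' p)
        S : Fin m → Subset k
        S y = subset y (proj₁ (fresh y))
        ιβ : Fin m → Fin n
        ιβ y = β (S y)

      ι : Fin 3 × Fin m → Fin n
      ι (zero , i) = ια i
      ι (suc zero , i) = ιβ i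
      ι (suc (suc zero) , i) = ιγ i

      ι-inj : ∀ u v → ι u ≡ ι v → u ≡ v
      ι-inj (zero , x) (zero , x') p = cong (zero ,_) (F.↑ˡ-injective (m ℕ.* suc m) x x' (α-inj _ _ p))
      ι-inj (zero , x) (suc zero , y) p = ⊥-elim (proj₂ (fresh y) x p)
      ι-inj (zero , x) (suc (suc zero) , z) p = ⊥-elim (α≢γ _ _ p)
      ι-inj (suc zero , y) (zero , x) p = ⊥-elim (proj₂ (fresh y) x (sym p))
      ι-inj (suc zero , y) (suc zero , y') p = cong (suc zero ,_) (proj₁ (subset-inj y _ y' _ p))
      ι-inj (suc zero , y) (suc (suc zero) , z) p = ⊥-elim (β≢γ (S y) _ (subset-nonempty y _) p)
      ι-inj (suc (suc zero) , z) (zero , x) p = ⊥-elim (α≢γ _ _ (sym p))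
      ι-inj (suc (suc zero) , z) (suc zero , y) p = ⊥-elim (β≢γ (S y) _ (subset-nonempty y _) (sym p))
      ι-inj (suc (suc zero) , z) (suc (suc zero) , z') p = cong (suc (suc zero) ,_) (F.↑ˡ-injective (m ℕ.* suc m) z z' (γ-inj _ _ p))

      ι-edge : ∀ x y z → E (ια x) (ιβ y) (ιγ z) ≡ pattern' x y
      ι-edge x y z = trans (edge _ (S y) _ (subset-nonempty y _)) (subset-pattern y _ x)

      split : Fin (3 ℕ.* m) → Fin 3 × Fin m
      split = remQuot {3} m

      -- Restriction to the 3m chosen vertices makes every class exactly a third of the vertex set.
      -- Triples that do not meet all three classes remain arbitrary.
      induced : Graph3
      induced = record
        { n = 3 ℕ.* m
        ; E = λ x y z → E (ι (split x)) (ι (split y)) (ι (split z))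
        ; sym₁₂ = λ x y z → sym₁₂ _ _ _
        ; sym₂₃ = λ x y z → sym₂₃ _ _ _
        ; irr = λ x z → irr _ _ }

      induced-embeds : Embeds (toStr induced) (toStr H)
      induced-embeds = (λ x → ι (split x)) , (λ x y p → split-inj x y (ι-inj _ _ p)) , λ _ _ _ → refl
        where
        split-inj : ∀ x y → split x ≡ split y → x ≡ y
        split-inj x y p = trans (sym (F.combine-remQuot {3} m x)) (trans (cong (λ { (i , j) → combine i j }) p) (F.combine-remQuot {3} m y))

      class-edge : ∀ u v w → eqF (proj₁ u) zero ≡ true → eqF (proj₁ v) (suc zero) ≡ true → eqF (proj₁ w) (suc (suc zero)) ≡ true →
        E (ι u) (ι v) (ι w) ≡ pattern' (proj₂ u) (proj₂ v)
      class-edge (i , x) (j , y) (l , z) p q r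
        with refl ← eqF⇒≡ i zero p | refl ← eqF⇒≡ j (suc zero) q | refl ← eqF⇒≡ l (suc (suc zero)) r = ι-edge x y z

  open CopiesOfU

  -- Equal groups and equidistributed rows.

  module BalancedPattern where

    ∑-++ : ∀ m n (f : Fin (m ℕ.+ n) → ℚ) → ∑ (m ℕ.+ n) f ≡ ∑ m (λ i → f (i ↑ˡ n)) + ∑ n (λ j → f (m ↑ʳ j))
    ∑-++ zero n f = sym (+-identityˡ (∑ n f))
    ∑-++ (suc m) n f = trans (cong (f zero +_) (∑-++ m n λ i → f (suc i)))
      (sym (+-assoc (f zero) (∑ m λ i → f (suc i ↑ˡ n)) (∑ n λ j → f (suc m ↑ʳ j))))

    ∑-combine : ∀ m n (f : Fin (m ℕ.* n) → ℚ) → ∑ (m ℕ.* n) f ≡ ∑ m λ i → ∑ n λ j → f (combine i j)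
    ∑-combine zero n f = refl
    ∑-combine (suc m) n f = trans (∑-++ n (m ℕ.* n) f)
      (cong (∑ n (λ j → f (j ↑ˡ (m ℕ.* n))) +_) (∑-combine m n λ i → f (n ↑ʳ i)))

    ∑-remQuot : ∀ m n (f : Fin m × Fin n → ℚ) → ∑ (m ℕ.* n) (λ i → f (remQuot n i)) ≡ ∑ m λ i → ∑ n λ j → f (i , j)
    ∑-remQuot m n f = trans (∑-combine m n λ i → f (remQuot n i)) (∑-cong λ i → ∑-cong λ j → cong f (F.remQuot-combine i j))

    eqF-sym : ∀ {t} (i j : Fin t) → eqF i j ≡ eqF j i
    eqF-sym i j with i F.≟ j | j F.≟ i
    ... | yes _ | yes _ = refl
    ... | no _ | no _ = refl
    ... | yes p | no q = ⊥-elim (q (sym p))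
    ... | no p | yes q = ⊥-elim (p (sym q))

    ∑-class : ∀ k m (i : Fin k) (f : Fin m → ℚ) →
      ∑ (k ℕ.* m) (λ x → ind (eqF (proj₁ (remQuot {k} m x)) i) * f (proj₂ (remQuot {k} m x))) ≡ ∑ m f
    ∑-class k m i f = trans (∑-remQuot k m λ { (j , x) → ind (eqF j i) * f x })
      (trans (∑-cong λ j → trans (∑-*ˡ (ind (eqF j i)) f) (cong (λ b → ind b * ∑ m f) (eqF-sym j i))) (∑-delta i λ _ → ∑ m f))

    -- This is 2^r times `base`; the recursion matches the splitting of binary labels by their first
    -- coordinate.
    doubled : ℕ → ℕ → ℕ
    doubled zero base = base
    doubled (suc r) base = doubled r base ℕ.+ doubled r base

    base≤doubled : ∀ r base → base ℕ.≤ doubled r base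
    base≤doubled zero base = ℕ.≤-refl
    base≤doubled (suc r) base = ℕ.≤-trans (base≤doubled r base) (ℕ.m≤m+n _ _)

    -- Periodic extension: each of the 2^r blocks carries a copy of `g`, so proportions are
    -- preserved.
    toDoubled : ∀ {A : Set} r base → (Fin base → A) → Fin (doubled r base) → A
    toDoubled zero base g = g
    toDoubled (suc r) base g x = [ toDoubled r base g , toDoubled r base g ]′ (splitAt (doubled r base) x)

    -- The rows x ↦ label r base x run through all of {0,1}^r, each occurring base times.
    label : ∀ r base → Fin (doubled r base) → Fin r → Bool
    label (suc r) base x zero = [ (λ _ → false) , (λ _ → true) ]′ (splitAt (doubled r base) x)
    label (suc r) base x (suc p) = [ (λ y → label r base y p) , (λ y → label r base y p) ]′ (splitAt (doubled r base) x)

    ∑-splitAt : ∀ {A : Set} m n (f : Fin m → A) (g : Fin n → A) (h : A → ℚ) →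
      ∑ (m ℕ.+ n) (λ x → h ([ f , g ]′ (splitAt m x))) ≡ ∑ m (λ i → h (f i)) + ∑ n (λ j → h (g j))
    ∑-splitAt m n f g h = trans (∑-++ m n λ x → h ([ f , g ]′ (splitAt m x)))
      (cong₂ _+_ (∑-cong λ i → cong (λ s → h ([ f , g ]′ s)) (F.splitAt-↑ˡ m i n))
                 (∑-cong λ j → cong (λ s → h ([ f , g ]′ s)) (F.splitAt-↑ʳ m n j)))

    ∑-toDoubled : ∀ {A : Set} r base (g : Fin base → A) (h : A → ℚ) {c} → c * ∑ base (λ i → h (g i)) ≡ toℚ base →
      c * ∑ (doubled r base) (λ x → h (toDoubled r base g x)) ≡ toℚ (doubled r base)
    ∑-toDoubled zero base g h p = p
    ∑-toDoubled (suc r) base g h {c} p = trans (cong (c *_) (∑-splitAt m m (toDoubled r base g) (toDoubled r base g) h))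
      (trans (*-distribˡ-+ c S S) (trans (cong₂ _+_ ih ih) (sym (toℚ-+ m m))))
      where
      m = doubled r base
      S : ℚ
      S = ∑ m λ x → h (toDoubled r base g x)
      ih = ∑-toDoubled r base g h {c} p

    group : ∀ r N s → Fin (doubled r (N ℕ.* s)) → Fin N
    group r N s = toDoubled r (N ℕ.* s) (quotient {N} s)

    group-fibre : ∀ r N s p → toℚ N * ∑ (doubled r (N ℕ.* s)) (λ x → ind (eqF p (group r N s x))) ≡ toℚ (doubled r (N ℕ.* s))
    group-fibre r N s p = ∑-toDoubled r (N ℕ.* s) (quotient {N} s) (λ i → ind (eqF p i)) {toℚ N}
      (trans (cong (toℚ N *_) (trans (∑-remQuot N s λ { (i , _) → ind (eqF p i) })
        (trans (∑-cong λ i → trans (∑-const s (ind (eqF p i))) (*-comm (toℚ s) (ind (eqF p i)))) (∑-delta p λ _ → toℚ s))))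
        (sym (toℚ-* N s)))

    -- Satisfied by `ind` and by its complement, so one induction treats ones and zeros of the
    -- labels alike.
    Balanced : (Bool → ℚ) → Set
    Balanced h = h false + h true ≡ 1ℚ

    label-half : ∀ r base p h → Balanced h → (1ℚ + 1ℚ) * ∑ (doubled r base) (λ x → h (label r base x p)) ≡ toℚ (doubled r base)
    label-half (suc r) base zero h bal = trans (cong ((1ℚ + 1ℚ) *_)
        (trans (∑-splitAt m m (λ _ → false) (λ _ → true) h) (cong₂ _+_ (∑-const m (h false)) (∑-const m (h true)))))
      (trans (e (toℚ m) (h false) (h true)) (trans (cong (λ s → s * toℚ m + s * toℚ m) bal)
        (trans (cong₂ _+_ (*-identityˡ (toℚ m)) (*-identityˡ (toℚ m))) (sym (toℚ-+ m m)))))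
      where
      m = doubled r base
      e : ∀ m a b → (1ℚ + 1ℚ) * (m * a + m * b) ≡ (a + b) * m + (a + b) * m
      e = solve-∀ ℚring
    label-half (suc r) base (suc p) h bal = trans (cong ((1ℚ + 1ℚ) *_) (∑-splitAt m m (λ y → label r base y p) (λ y → label r base y p) h))
      (trans (*-distribˡ-+ (1ℚ + 1ℚ) S S) (trans (cong₂ _+_ ih ih) (sym (toℚ-+ m m))))
      where
      m = doubled r base
      S : ℚ
      S = ∑ m λ y → h (label r base y p)
      ih = label-half r base p h bal

    -- Distinct coordinates are independent. If one of them is the top coordinate, it is constant on
    -- each half, while the other is equidistributed there by `label-half`; if both are lower, the
    -- two halves are identical copies.
    label-quarter : ∀ r base p p' h h' → Balanced h → Balanced h' → eqF p p' ≡ false →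
      ((1ℚ + 1ℚ) * (1ℚ + 1ℚ)) * ∑ (doubled r base) (λ x → h (label r base x p) * h' (label r base x p')) ≡ toℚ (doubled r base)
    label-quarter (suc r) base zero (suc p') h h' bal bal' _ = trans (cong (((1ℚ + 1ℚ) * (1ℚ + 1ℚ)) *_)
        (trans (∑-++ m m (λ x → h (label (suc r) base x zero) * h' (label (suc r) base x (suc p'))))
        (cong₂ _+_
          (trans (∑-cong λ i → cong (λ s → h ([ (λ _ → false) , (λ _ → true) ]′ s) * h' ([ L , L ]′ s)) (F.splitAt-↑ˡ m i m)) (∑-*ˡ (h false) λ y → h' (L y)))
          (trans (∑-cong λ i → cong (λ s → h ([ (λ _ → false) , (λ _ → true) ]′ s) * h' ([ L , L ]′ s)) (F.splitAt-↑ʳ m m i)) (∑-*ˡ (h true) λ y → h' (L y))))))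
      (trans (e (h false) (h true) S) (trans (cong₂ (λ s t → s * t + s * t) bal (label-half r base p' h' bal'))
        (trans (cong₂ _+_ (*-identityˡ (toℚ m)) (*-identityˡ (toℚ m))) (sym (toℚ-+ m m)))))
      where
      m = doubled r base
      L : Fin m → Bool
      L y = label r base y p'
      S : ℚ
      S = ∑ m λ y → h' (L y)
      e : ∀ a b s → ((1ℚ + 1ℚ) * (1ℚ + 1ℚ)) * (a * s + b * s) ≡ (a + b) * ((1ℚ + 1ℚ) * s) + (a + b) * ((1ℚ + 1ℚ) * s)
      e = solve-∀ ℚring
    label-quarter (suc r) base (suc p) zero h h' bal bal' q = trans (cong (((1ℚ + 1ℚ) * (1ℚ + 1ℚ)) *_)
        (∑-cong λ x → *-comm (h (label (suc r) base x (suc p))) (h' (label (suc r) base x zero))))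
      (label-quarter (suc r) base zero (suc p) h' h bal' bal refl)
    label-quarter (suc r) base (suc p) (suc p') h h' bal bal' q = trans (cong (((1ℚ + 1ℚ) * (1ℚ + 1ℚ)) *_)
        (trans (∑-++ m m (λ x → h (label (suc r) base x (suc p)) * h' (label (suc r) base x (suc p'))))
        (cong₂ _+_
          (∑-cong λ i → cong (λ s → h ([ L p , L p ]′ s) * h' ([ L p' , L p' ]′ s)) (F.splitAt-↑ˡ m i m))
          (∑-cong λ i → cong (λ s → h ([ L p , L p ]′ s) * h' ([ L p' , L p' ]′ s)) (F.splitAt-↑ʳ m m i)))))
      (trans (*-distribˡ-+ ((1ℚ + 1ℚ) * (1ℚ + 1ℚ)) S S) (trans (cong₂ _+_ ih ih) (sym (toℚ-+ m m))))
      where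
      m = doubled r base
      L : Fin r → Fin m → Bool
      L p y = label r base y p
      S : ℚ
      S = ∑ m λ y → h (L p y) * h' (L p' y)
      ih = label-quarter r base p p' h h' bal bal' (trans (sym (eqF-suc p p')) q)

  open BalancedPattern

  -- Choice of the constants and a crude bound for the ceiling.

  module Parameters where

    recip-inverse : ∀ k → 1 ℕ.≤ k → toℚ k * recip k ≡ 1ℚ
    recip-inverse (suc k) _ = frac-* 1 k

    0<recip : ∀ k → 1 ℕ.≤ k → 0ℚ < recip k
    0<recip k p = go (0ℚ <? recip k)
      where
      go : _ → 0ℚ < recip k
      go (yes q) = q
      go (no q) = ⊥-elim (<-irrefl refl (<-≤-trans 0<1 (≤-trans (≤-eq (sym (recip-inverse k p)))
        (≤-trans (*-monoˡ (toℚ k) (0≤toℚ k) (≮⇒≥ q)) (≤-eq (*-zeroʳ (toℚ k)))))))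

    ≤recip : ∀ k → 1 ℕ.≤ k → ∀ {x} → toℚ k * x ≤ 1ℚ → x ≤ recip k
    ≤recip (suc k) p q = *-cancel (toℚ (suc k)) (0<toℚ k) (≤-trans q (≤-eq (sym (recip-inverse (suc k) p))))

    opaque
      -- The binding requirement is 8 · 7 · 27 η < 1 in the final comparison, that is η < 1/1512,
      -- and 1/2048 is the next power of two. The other requirements, 2η ≤ 1 and 3 · 16³ η² ≤ 1,
      -- follow with room to spare.
      η : ℚ
      η = recip 2048

      0<η : 0ℚ < η
      0<η = 0<recip 2048 (ℕ.s≤s ℕ.z≤n)

      2048η≡1 : toℚ 2048 * η ≡ 1ℚ
      2048η≡1 = recip-inverse 2048 (ℕ.s≤s ℕ.z≤n)

      ≤η : ∀ {x} → toℚ 2048 * x ≤ 1ℚ → x ≤ η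
      ≤η = ≤recip 2048 (ℕ.s≤s ℕ.z≤n)

    0≤η : 0ℚ ≤ η
    0≤η = <⇒≤ 0<η

    kη≤1 : ∀ k → k ℕ.≤ 2048 → toℚ k * η ≤ 1ℚ
    kη≤1 k p = ≤-trans (*-monoʳ η 0≤η (toℚ-mono p)) (≤-eq 2048η≡1)

    kη<1 : ∀ k → k ℕ.≤ 2047 → toℚ k * η < 1ℚ
    kη<1 k p = ≤-<-trans (*-monoʳ η 0≤η (toℚ-mono p)) (subst₂ _<_ (+-identityˡ (toℚ 2047 * η))
      (trans (e (toℚ 2047) η) (trans (cong (_* η) (sym (toℚ-+ 1 2047))) 2048η≡1)) (+-monoˡ-< (toℚ 2047 * η) 0<η))
      where
      e : ∀ k h → h + k * h ≡ (1ℚ + k) * h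
      e = solve-∀ ℚring

    η≤1 : η ≤ 1ℚ
    η≤1 = ≤-trans (≤-eq (sym (*-identityˡ η))) (kη≤1 1 (ℕ.s≤s ℕ.z≤n))

    -- κ = η⁵ reduces 2κ ≤ η⁴ to 2η ≤ 1, and ε* = κ²η² reduces 3 · 16³ ε₁ ≤ κ² to 3 · 16³ η² ≤ 1.
    κ ε* : ℚ
    κ = ((η * η) * (η * η)) * η
    ε* = (κ * κ) * (η * η)

    0<κ : 0ℚ < κ
    0<κ = 0<* (0<* (0<* 0<η 0<η) (0<* 0<η 0<η)) 0<η

    0<ε* : 0ℚ < ε*
    0<ε* = 0<* (0<* 0<κ 0<κ) (0<* 0<η 0<η)

    private
      *≤1 : ∀ {a b} → 0ℚ ≤ a → 0ℚ ≤ b → a ≤ 1ℚ → b ≤ 1ℚ → a * b ≤ 1ℚ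
      *≤1 p q r s = ≤-trans (*-mono 0≤1 q r s) (≤-eq refl)

    κ≤1 : κ ≤ 1ℚ
    κ≤1 = *≤1 (0≤sq (η * η)) 0≤η (*≤1 (0≤sq η) (0≤sq η) (*≤1 0≤η 0≤η η≤1 η≤1) (*≤1 0≤η 0≤η η≤1 η≤1)) η≤1

    ε*≤η : ε* ≤ η
    ε*≤η = ≤-trans (≤-eq (e (κ * κ) η)) (≤-trans (*-monoʳ η 0≤η
        (*≤1 (0≤sq κ) 0≤η (*≤1 (<⇒≤ 0<κ) (<⇒≤ 0<κ) κ≤1 κ≤1) η≤1)) (≤-eq (*-identityˡ η)))
      where
      e : ∀ k h → k * (h * h) ≡ (k * h) * h
      e = solve-∀ ℚring

    opaque
      unfolding 16ℚ
      16ℚ≡ : 16ℚ ≡ toℚ 16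
      16ℚ≡ = refl

    3·16³η²≤1 : ((1ℚ + 1ℚ + 1ℚ) * (16ℚ * 16ℚ * 16ℚ)) * (η * η) ≤ 1ℚ
    3·16³η²≤1 = ≤-trans (*-monoʳ (η * η) (0≤sq η) (≤-trans (≤-eq (cong₂ _*_ {x = 1ℚ + 1ℚ + 1ℚ} {y = toℚ 3} refl 16³))
        (≤-trans (≤-eq (sym (toℚ-* 3 (16 ℕ.* 16 ℕ.* 16)))) (≤-trans (toℚ-mono {3 ℕ.* (16 ℕ.* 16 ℕ.* 16)} {2048 ℕ.* 2048} (ℕ.≤ᵇ⇒≤ _ _ tt)) (≤-eq (toℚ-* 2048 2048))))))
      (≤-eq (trans (e (toℚ 2048) η) (cong₂ _*_ 2048η≡1 2048η≡1)))
      where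
      16³ : 16ℚ * 16ℚ * 16ℚ ≡ toℚ (16 ℕ.* 16 ℕ.* 16)
      16³ = trans (cong (λ s → s * s * s) 16ℚ≡) (sym (trans (toℚ-* (16 ℕ.* 16) 16) (cong (_* toℚ 16) (toℚ-* 16 16))))
      e : ∀ k h → (k * k) * (h * h) ≡ (k * h) * (k * h)
      e = solve-∀ ℚring

    module _ (N : ℕ) (1≤N : 1 ℕ.≤ N) where
      private
        -- Its reciprocal σ equals η / (3N(ℓ + 1)). The factor 3N pays for counting triangles group
        -- by group and ℓ + 1 for the sparse bigraphs; ℓ + 1 in place of ℓ keeps the value positive
        -- at ℓ = 0.
        K : ℕ → ℕ
        K ℓ = 2048 ℕ.* (3 ℕ.* N ℕ.* suc ℓ)
        K-suc : ∀ ℓ → 1 ℕ.≤ K ℓ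
        K-suc ℓ = ℕ.*-mono-≤ {1} {2048} (ℕ.s≤s ℕ.z≤n) (ℕ.*-mono-≤ {1} {3 ℕ.* N} (ℕ.*-mono-≤ {1} {3} (ℕ.s≤s ℕ.z≤n) 1≤N) (ℕ.s≤s ℕ.z≤n))

      opaque
        σ : ℕ → ℚ
        σ ℓ = recip (K ℓ)

        0<σ : ∀ ℓ → 0ℚ < σ ℓ
        0<σ ℓ = 0<recip (K ℓ) (K-suc ℓ)

        jσ≤η : ∀ ℓ j → j ℕ.≤ 3 ℕ.* N ℕ.* suc ℓ → toℚ j * σ ℓ ≤ η
        jσ≤η ℓ j p = ≤η (≤-trans (≤-eq (trans (sym (*-assoc (toℚ 2048) (toℚ j) (σ ℓ))) (cong (_* σ ℓ) (sym (toℚ-* 2048 j)))))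
          (≤-trans (*-monoʳ (σ ℓ) (<⇒≤ (0<σ ℓ)) (toℚ-mono (ℕ.*-mono-≤ {2048} ℕ.≤-refl p))) (≤-eq (recip-inverse (K ℓ) (K-suc ℓ)))))

      ℓσ≤η : ∀ ℓ → toℚ ℓ * σ ℓ ≤ η
      ℓσ≤η ℓ = jσ≤η ℓ ℓ (ℕ.≤-trans (ℕ.n≤1+n ℓ) (ℕ.≤-trans (ℕ.≤-reflexive (sym (ℕ.*-identityˡ (suc ℓ))))
        (ℕ.*-mono-≤ {1} {3 ℕ.* N} (ℕ.*-mono-≤ {1} {3} (ℕ.s≤s ℕ.z≤n) 1≤N) ℕ.≤-refl)))

      3Nσ≤η : ∀ ℓ → toℚ (3 ℕ.* N) * σ ℓ ≤ η
      3Nσ≤η ℓ = jσ≤η ℓ (3 ℕ.* N) (ℕ.≤-trans (ℕ.≤-reflexive (sym (ℕ.*-identityʳ (3 ℕ.* N)))) (ℕ.*-mono-≤ {3 ℕ.* N} ℕ.≤-refl (ℕ.s≤s ℕ.z≤n)))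

      σ≤1 : ∀ ℓ → σ ℓ ≤ 1ℚ
      σ≤1 ℓ = ≤-trans (≤-eq (sym (*-identityˡ (σ ℓ)))) (≤-trans (jσ≤η ℓ 1 (ℕ.*-mono-≤ {1} {3 ℕ.* N} (ℕ.*-mono-≤ {1} {3} (ℕ.s≤s ℕ.z≤n) 1≤N) (ℕ.s≤s ℕ.z≤n))) η≤1)

      θ : ℕ → ℚ
      θ ℓ = (σ ℓ * σ ℓ) * (σ ℓ * σ ℓ)

      0<θ : ∀ ℓ → 0ℚ < θ ℓ
      0<θ ℓ = 0<* (0<* (0<σ ℓ) (0<σ ℓ)) (0<* (0<σ ℓ) (0<σ ℓ))

      θ≤1 : ∀ ℓ → θ ℓ ≤ 1ℚ
      θ≤1 ℓ = *≤1 (0≤sq (σ ℓ)) (0≤sq (σ ℓ)) s s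
        where
        s : σ ℓ * σ ℓ ≤ 1ℚ
        s = *≤1 (<⇒≤ (0<σ ℓ)) (<⇒≤ (0<σ ℓ)) (σ≤1 ℓ) (σ≤1 ℓ)

      ε₂ : ℕ → ℚ
      ε₂ ℓ = (θ ℓ * θ ℓ) * (θ ℓ * θ ℓ)

      0<ε₂ : ∀ ℓ → 0ℚ < ε₂ ℓ
      0<ε₂ ℓ = 0<* (0<* (0<θ ℓ) (0<θ ℓ)) (0<* (0<θ ℓ) (0<θ ℓ))

      ε₂≤1 : ∀ ℓ → ε₂ ℓ ≤ 1ℚ
      ε₂≤1 ℓ = *≤1 (0≤sq (θ ℓ)) (0≤sq (θ ℓ)) s s
        where
        s : θ ℓ * θ ℓ ≤ 1ℚ
        s = *≤1 (<⇒≤ (0<θ ℓ)) (<⇒≤ (0<θ ℓ)) (θ≤1 ℓ) (θ≤1 ℓ)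

      constants : ∀ {ε₁} → 0ℚ < ε₁ → ε₁ < ε* → ∀ ℓ → Constants N ε₁ (σ ℓ) (θ ℓ) η κ
      constants {ε₁} 0<ε₁ ε₁<ε* ℓ = record
        { 0<σ = 0<σ ℓ
        ; 0≤θ = <⇒≤ (0<θ ℓ)
        ; θ≤σ⁴ = ≤-refl
        ; θ⁴≤σ = ε₂≤σ
        -- Since θ = σ⁴, the left side is 3Nσ · σ³.
        ; Nθ≤ = ≤-trans (≤-eq (trans (e₁ (toℚ N) (σ ℓ)) (cong (λ s → (s * σ ℓ) * (σ ℓ * σ ℓ * σ ℓ)) (sym (toℚ-* 3 N)))))
                  (*-monoʳ (σ ℓ * σ ℓ * σ ℓ) (0≤* (0≤sq (σ ℓ)) (<⇒≤ (0<σ ℓ))) (3Nσ≤η ℓ))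
        ; 0≤κ = <⇒≤ 0<κ
        ; 0≤η = 0≤η
        ; ε₁≤κ² = ≤-trans (≤-eq (e₂ (1ℚ + 1ℚ + 1ℚ) ε₁ (16ℚ * 16ℚ * 16ℚ)))
            (≤-trans (*-monoˡ c (0≤* (nonNegative⁻¹ (1ℚ + 1ℚ + 1ℚ)) (0≤* (0≤* 0≤16ℚ 0≤16ℚ) 0≤16ℚ)) (<⇒≤ ε₁<ε*))
            (≤-trans (≤-eq (e₃ c (κ * κ) (η * η)))
            (≤-trans (*-monoˡ (κ * κ) (0≤sq κ) 3·16³η²≤1) (≤-eq (*-identityʳ (κ * κ))))))
        ; κ≤η⁴ = ≤-trans (≤-eq (e₄ (1ℚ + 1ℚ) ((η * η) * (η * η)) η))
            (≤-trans (*-monoˡ ((η * η) * (η * η)) (0≤sq (η * η)) (kη≤1 2 (ℕ.s≤s (ℕ.s≤s ℕ.z≤n)))) (≤-eq (*-identityʳ ((η * η) * (η * η)))))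
        ; 0≤ε₁ = <⇒≤ 0<ε₁ }
        where
        c : ℚ
        c = (1ℚ + 1ℚ + 1ℚ) * (16ℚ * 16ℚ * 16ℚ)
        e₁ : ∀ N s → N * ((1ℚ + 1ℚ + 1ℚ) * ((s * s) * (s * s))) ≡ (((1ℚ + 1ℚ + 1ℚ) * N) * s) * (s * s * s)
        e₁ = solve-∀ ℚring
        e₂ : ∀ a b c → a * (b * c) ≡ (a * c) * b
        e₂ = solve-∀ ℚring
        e₃ : ∀ c k h → c * (k * h) ≡ k * (c * h)
        e₃ = solve-∀ ℚring
        e₄ : ∀ t h k → t * (h * k) ≡ h * (t * k)
        e₄ = solve-∀ ℚring
        ε₂≤σ : ε₂ ℓ ≤ σ ℓ
        ε₂≤σ = ≤-trans (≤-eq (e (σ ℓ) (θ ℓ))) (≤-trans (*-monoˡ (σ ℓ) (<⇒≤ (0<σ ℓ)) rest≤1) (≤-eq (*-identityʳ (σ ℓ))))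
          where
          e : ∀ s t → ((((s * s) * (s * s)) * t) * (t * t)) ≡ s * (((s * s) * s) * t * (t * t))
          e = solve-∀ ℚring
          0≤s = <⇒≤ (0<σ ℓ)
          0≤t = <⇒≤ (0<θ ℓ)
          rest≤1 : ((σ ℓ * σ ℓ) * σ ℓ) * θ ℓ * (θ ℓ * θ ℓ) ≤ 1ℚ
          rest≤1 = *≤1 (0≤* (0≤* (0≤sq (σ ℓ)) 0≤s) 0≤t) (0≤sq (θ ℓ))
            (*≤1 (0≤* (0≤sq (σ ℓ)) 0≤s) 0≤t (*≤1 (0≤sq (σ ℓ)) 0≤s (*≤1 0≤s 0≤s (σ≤1 ℓ) (σ≤1 ℓ)) (σ≤1 ℓ)) (θ≤1 ℓ))
            (*≤1 0≤t 0≤t (θ≤1 ℓ) (θ≤1 ℓ))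

    -- Partial sums dominate all earlier values without an appeal to monotonicity of `Wow`.
    wowBound : ℕ → ℕ
    wowBound zero = Wow zero
    wowBound (suc k) = wowBound k ℕ.+ Wow (suc k)

    Wow≤wowBound : ∀ {m k} → m ℕ.≤ k → Wow m ℕ.≤ wowBound k
    Wow≤wowBound {zero} {zero} _ = ℕ.≤-refl
    Wow≤wowBound {m} {suc k} p with ℕ.m≤n⇒m<n∨m≡n p
    ... | inj₁ q = ℕ.≤-trans (Wow≤wowBound (ℕ.s≤s⁻¹ q)) (ℕ.m≤m+n _ _)
    ... | inj₂ refl = ℕ.m≤n+m _ _

    -- A positive fraction is at least the reciprocal of its denominator, here `suc d`.
    denominator-bound : ∀ ε → 0ℚ < ε → Σ ℕ λ d → 1ℚ ≤ toℚ (suc d) * ε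
    denominator-bound ε 0<ε = go ε (positive 0<ε)
      where
      go : ∀ ε → Positive ε → Σ ℕ λ d → 1ℚ ≤ toℚ (suc d) * ε
      go ε@(mkℚ (ℤ.+ suc a) d _) _ = d , ≤-trans (toℚ-mono {1} {suc a} (ℕ.s≤s ℕ.z≤n))
        (≤-eq (trans (sym (frac-* (suc a) d)) (cong (toℚ (suc d) *_) (↥p/↧p≡p ε))))

    ≤pow7 : ∀ x → 1ℚ ≤ x → x ≤ pow7 x
    ≤pow7 x 1≤x = step (step (step (step (step (step ≤-refl)))))
      where
      0≤x : 0ℚ ≤ x
      0≤x = ≤-trans 0≤1 1≤x
      step : ∀ {y} → x ≤ y → x ≤ y * x
      step {y} x≤y = ≤-trans x≤y (≤-trans (≤-eq (sym (*-identityʳ y))) (*-monoˡ y (≤-trans 0≤x x≤y) 1≤x))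

    -- If the predecessor m' of the ceiling were at least `suc d`, then m'⁷ ε ≥ m' ε ≥ 1, against
    -- minimality.
    ceil≤ : ∀ {ε m d} → 0ℚ < ε → 1ℚ ≤ toℚ (suc d) * ε → IsCeilRoot7 1ℚ ε m → m ℕ.≤ suc d
    ceil≤ {m = zero} _ _ _ = ℕ.z≤n
    ceil≤ {ε} {suc m} {d} 0<ε 1≤ (_ , minimal) with suc m ℕ.≤? suc d
    ... | yes p = p
    ... | no p = ⊥-elim (<-irrefl refl (<-≤-trans (minimal m ℕ.≤-refl) (≤-trans 1≤ (*-monoʳ ε (<⇒≤ 0<ε)
        (≤-trans (toℚ-mono d<m) (≤pow7 (toℚ m) (≤-trans (toℚ-mono {1} {suc d} (ℕ.s≤s ℕ.z≤n)) (toℚ-mono d<m))))))))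
      where
      d<m : suc d ℕ.≤ m
      d<m = ℕ.s≤s⁻¹ (ℕ.≰⇒> p)

  open Parameters public

  -- The contradiction for few parts, and the lower bound.

  module LowerBound where

    copyOf : ∀ {𝓗} → (∀ k → 1 ℕ.≤ k → InTrip 𝓗 (kU k)) → ∀ k → 1 ℕ.≤ k → Σ Graph3 λ H → 𝓗 H × Copy H k
    copyOf trip (suc k) 1≤k with trip (suc k) 1≤k
    ... | H , 𝓗H , emb = H , 𝓗H , copy emb

    -- With q = X/4 and T f ≤ X/2 the left side of the last inequality is at least X³/8. With ε₁ ≤ η
    -- its right side is at most 7η · 27X³, the vertex set being three times as large as a class.
    -- These clash because 8 · 7 · 27 η < 1.
    density-contradiction : ∀ X T f q ε₁ →
      0ℚ < X → 0ℚ ≤ f → toℚ 4 * q ≡ X → (1ℚ + 1ℚ) * (T * f) ≤ X → ε₁ ≤ η →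
      q * (X - T * f) * X ≤ (ε₁ + (1ℚ + 1ℚ + 1ℚ + (1ℚ + 1ℚ + 1ℚ)) * η) * ((toℚ 3 * X) * ((toℚ 3 * X) * (toℚ 3 * X))) → ⊥
    density-contradiction X T f q ε₁ 0<X 0≤f 4q≡X 2Tf≤X ε₁≤η upper =
      <-irrefl refl (≤-<-trans X³≤ (subst ((c * η) * (X * (X * X)) <_) (*-identityˡ (X * (X * X)))
        (*-monoˡ-<-pos (X * (X * X)) ⦃ positive (0<* 0<X (0<* 0<X 0<X)) ⦄ cη<1)))
      where
      8ℚ 27ℚ c : ℚ
      8ℚ = (1ℚ + 1ℚ) * toℚ 4
      27ℚ = (toℚ 3 * toℚ 3) * toℚ 3
      c = 8ℚ * toℚ 7 * 27ℚ
      0≤X = <⇒≤ 0<X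
      0≤8ℚ : 0ℚ ≤ 8ℚ
      0≤8ℚ = 0≤* (nonNegative⁻¹ (1ℚ + 1ℚ)) (0≤toℚ 4)
      c≡ : toℚ (2 ℕ.* 4 ℕ.* 7 ℕ.* (3 ℕ.* 3 ℕ.* 3)) ≡ c
      c≡ = trans (toℚ-* (2 ℕ.* 4 ℕ.* 7) (3 ℕ.* 3 ℕ.* 3)) (cong₂ _*_
        (trans (toℚ-* (2 ℕ.* 4) 7) (cong (_* toℚ 7) (toℚ-* 2 4)))
        (trans (toℚ-* (3 ℕ.* 3) 3) (cong (_* toℚ 3) (toℚ-* 3 3))))
      cη<1 : c * η < 1ℚ
      cη<1 = subst (λ s → s * η < 1ℚ) c≡ (kη<1 (2 ℕ.* 4 ℕ.* 7 ℕ.* (3 ℕ.* 3 ℕ.* 3)) (ℕ.≤ᵇ⇒≤ _ _ tt))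
      e₁ : ∀ k q X u → ((1ℚ + 1ℚ) * k) * (q * (X - u) * X) ≡ (1ℚ + 1ℚ) * ((k * q) * ((X - u) * X))
      e₁ = solve-∀ ℚring
      e₂ : ∀ X u → (1ℚ + 1ℚ) * (X * ((X - u) * X)) ≡ X * (X * X) + (X * X) * (X - (1ℚ + 1ℚ) * u)
      e₂ = solve-∀ ℚring
      e₃ : ∀ a b k h x → a * ((b * h) * ((k * x) * ((k * x) * (k * x)))) ≡ ((a * b * ((k * k) * k)) * h) * (x * (x * x))
      e₃ = solve-∀ ℚring
      e₄ : ∀ h → h + (1ℚ + 1ℚ + 1ℚ + (1ℚ + 1ℚ + 1ℚ)) * h ≡ (1ℚ + (1ℚ + 1ℚ + 1ℚ + (1ℚ + 1ℚ + 1ℚ))) * h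
      e₄ = solve-∀ ℚring
      0≤n³ : 0ℚ ≤ (toℚ 3 * X) * ((toℚ 3 * X) * (toℚ 3 * X))
      0≤n³ = 0≤* (0≤* (0≤toℚ 3) 0≤X) (0≤sq (toℚ 3 * X))
      X³≤ : X * (X * X) ≤ (c * η) * (X * (X * X))
      X³≤ = ≤-trans (≤-by (0≤* (0≤sq X) (≤⇒0≤- 2Tf≤X)) (trans (e₁ (toℚ 4) q X (T * f))
          (trans (cong (λ s → (1ℚ + 1ℚ) * (s * ((X - T * f) * X))) 4q≡X) (e₂ X (T * f)))))
        (≤-trans (*-monoˡ 8ℚ 0≤8ℚ upper)
        (≤-trans (*-monoˡ 8ℚ 0≤8ℚ (*-monoʳ _ 0≤n³ (≤-trans (+-monoˡ-≤ _ ε₁≤η) (≤-eq (e₄ η)))))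
          (≤-eq (e₃ 8ℚ (toℚ 7) (toℚ 3) η X))))

    module Contradiction (𝓗 : Graph3 → Set) (hered : Hereditary 𝓗) (trip : ∀ k → 1 ℕ.≤ k → InTrip 𝓗 (kU k))
      (ε₁ : ℚ) (0<ε₁ : 0ℚ < ε₁) (ε₁<ε* : ε₁ < ε*) (R N : ℕ) (1≤N : 1 ℕ.≤ N) (2R≤N : R ℕ.+ R ℕ.≤ N) where

      module _ (n₀ : ℕ) where
        base m : ℕ
        -- A multiple of N, to make the groups equal, with a factor that pushes the number of
        -- vertices above n₀. Then `m` is 2^N times as large, so that every set of groups labels
        -- equally many rows.
        base = N ℕ.* suc n₀
        m = doubled N base

        n₀<m : n₀ ℕ.< m
        n₀<m = ℕ.≤-trans (ℕ.≤-trans (ℕ.≤-reflexive (sym (ℕ.*-identityˡ (suc n₀)))) (ℕ.*-mono-≤ 1≤N ℕ.≤-refl)) (base≤doubled N base)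

        pattern' : Fin m → Fin m → Bool
        pattern' x y = label N base y (group N N (suc n₀) x)

        1≤k : 1 ℕ.≤ m ℕ.+ m ℕ.* suc m
        1≤k = ℕ.≤-trans (ℕ.s≤s ℕ.z≤n) (ℕ.≤-trans n₀<m (ℕ.m≤m+n m (m ℕ.* suc m)))

        H : Graph3
        H = proj₁ (copyOf trip (m ℕ.+ m ℕ.* suc m) 1≤k)

        module G = Realise pattern' (proj₂ (proj₂ (copyOf trip (m ℕ.+ m ℕ.* suc m) 1≤k)))

        𝓗G : 𝓗 G.induced
        𝓗G = hered G.induced H (proj₁ (proj₂ (copyOf trip (m ℕ.+ m ℕ.* suc m) 1≤k))) G.induced-embeds

        n : ℕ
        n = 3 ℕ.* m

        n₀≤n : n₀ ℕ.≤ n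
        n₀≤n = ℕ.≤-trans (ℕ.<⇒≤ n₀<m) (ℕ.m≤m+n m (m ℕ.+ (m ℕ.+ 0)))

        class : Fin 3 → Fin n → Bool
        class i x = eqF (proj₁ (remQuot {3} m x)) i

        a b c : Fin n → Bool
        a = class zero
        b = class (suc zero)
        c = class (suc (suc zero))

        gr : Fin n → Fin N
        gr x = group N N (suc n₀) (proj₂ (remQuot {3} m x))

        lab : Fin n → Fin N → Bool
        lab y = label N base (proj₂ (remQuot {3} m y))

        size-class : ∀ i → size (class i) ≡ toℚ m
        size-class i = trans (∑-cong λ x → sym (*-identityʳ (ind (class i x))))
          (trans (∑-class 3 m i λ _ → 1ℚ) (trans (∑-const m 1ℚ) (*-identityʳ (toℚ m))))

        X f q : ℚ
        X = toℚ m
        f = recip N * X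
        q = recip 4 * X

        Nf≡X : toℚ N * f ≡ X
        Nf≡X = trans (sym (*-assoc (toℚ N) (recip N) X)) (trans (cong (_* X) (recip-inverse N 1≤N)) (*-identityˡ X))

        4q≡X : toℚ 4 * q ≡ X
        4q≡X = trans (sym (*-assoc (toℚ 4) (recip 4) X)) (trans (cong (_* X) (recip-inverse 4 (ℕ.s≤s ℕ.z≤n))) (*-identityˡ X))

        0≤f : 0ℚ ≤ f
        0≤f = 0≤* (0≤recip N) (0≤toℚ m)

        0≤q : 0ℚ ≤ q
        0≤q = 0≤* (0≤recip 4) (0≤toℚ m)

        fibres : ∀ p → (∑ n λ x → ind (a x) * ind (eqF p (gr x))) ≤ f
        fibres p = ≤-trans (≤-eq (∑-class 3 m zero λ x → ind (eqF p (group N N (suc n₀) x))))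
          (*-cancel (toℚ N) (<-≤-trans 0<1 (toℚ-mono 1≤N)) (≤-eq (trans (group-fibre N N (suc n₀) p) (sym Nf≡X))))

        pairs : ∀ p p' → q * (1ℚ - ind (eqF p p')) ≤ (∑ n λ y → ind (b y) * (ind (lab y p) * ind (not (lab y p'))))
        pairs p p' with eqF p p' in eq
        ... | true = ≤-trans (≤-eq (*-zeroʳ q)) (0≤∑ λ y → 0≤* (0≤ind (b y)) (0≤* (0≤ind (lab y p)) (0≤ind (not (lab y p')))))
        ... | false = ≤-trans (≤-eq (*-identityʳ q)) (≤-trans (*-cancel (toℚ 4) (0<toℚ 3) (≤-eq (trans 4q≡X (sym
              (label-quarter N base p p' ind (λ l → ind (not l)) refl refl eq)))))
            (≤-eq (sym (∑-class 3 m (suc zero) λ y → ind (label N base y p) * ind (not (label N base y p'))))))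

        mixing-bound : ∀ {t ℓ} (P : Decomp n t ℓ) → IsRegular P (Graph3.E G.induced) ε₁ (ε₂ N 1≤N ℓ) →
          q * (size a - toℚ t * f) * size c ≤ (ε₁ + (1ℚ + 1ℚ + 1ℚ + (1ℚ + 1ℚ + 1ℚ)) * η) * (toℚ n * (toℚ n * toℚ n))
        mixing-bound {t} {ℓ} P reg = ≤-trans (*-monoʳ (size c) (0≤size c) (∑-mixing≥ P gr lab a b 0≤f 0≤q fibres pairs))
          (∑-homogeneous P {gr = gr} {lab = lab} HE≡ (constants N 1≤N 0<ε₁ ε₁<ε* ℓ) (ℓσ≤η N 1≤N ℓ) reg
            (mixing P gr lab a b 0≤f 0≤q fibres pairs)
            (mixing≤ P gr lab a b 0≤f 0≤q fibres pairs)
            (mixing≤' P gr lab a b 0≤f 0≤q fibres pairs))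
          where
          HE≡ : ∀ u w z → a u ≡ true → b w ≡ true → c z ≡ true → Graph3.E G.induced u w z ≡ lab w (gr u)
          HE≡ u w z = G.class-edge (G.split u) (G.split w) (G.split z)

        2tf≤X : ∀ {t} → t ℕ.≤ R → (1ℚ + 1ℚ) * (toℚ t * f) ≤ X
        2tf≤X {t} t≤R = ≤-trans (≤-eq (e (toℚ t) f)) (≤-trans (*-monoʳ f 0≤f (≤-trans (≤-eq (sym (toℚ-+ t t)))
          (toℚ-mono (ℕ.≤-trans (ℕ.+-mono-≤ t≤R t≤R) 2R≤N)))) (≤-eq Nf≡X))
          where
          e : ∀ t f → (1ℚ + 1ℚ) * (t * f) ≡ (t + t) * f
          e = solve-∀ ℚring

        impossible : ∀ {t ℓ} → t ℕ.≤ R → (P : Decomp n t ℓ) →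
          IsRegular P (Graph3.E G.induced) ε₁ (ε₂ N 1≤N ℓ) → ⊥
        impossible {t} {ℓ} t≤R P reg = density-contradiction X (toℚ t) f q ε₁ 0<X 0≤f 4q≡X (2tf≤X t≤R) (≤-trans (<⇒≤ ε₁<ε*) ε*≤η)
          (transport (size-class zero) (size-class (suc (suc zero))) (toℚ-* 3 m) (mixing-bound P reg))
          where
          0<X : 0ℚ < X
          0<X = <-≤-trans (0<toℚ n₀) (toℚ-mono n₀<m)
          transport : ∀ {s s' k k' x} → s ≡ x → s' ≡ x → k ≡ k' →
            q * (s - toℚ t * f) * s' ≤ (ε₁ + (1ℚ + 1ℚ + 1ℚ + (1ℚ + 1ℚ + 1ℚ)) * η) * (k * (k * k)) →
            q * (x - toℚ t * f) * x ≤ (ε₁ + (1ℚ + 1ℚ + 1ℚ + (1ℚ + 1ℚ + 1ℚ)) * η) * (k' * (k' * k'))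
          transport refl refl refl p = p

      too-few-parts : ∀ T L n₀ → T ℕ.≤ R → Works 𝓗 ε₁ (ε₂ N 1≤N) T L n₀ → ⊥
      too-few-parts T L n₀ T≤R works =
        let t , ℓ , _ , t≤T , _ , _ , P , _ , reg = works (G.induced n₀) (𝓗G n₀) (n₀≤n n₀)
        in impossible n₀ (ℕ.≤-trans t≤T T≤R) P reg

    -- N = 2R + 1, where R bounds `Wow m` for all m up to the denominator of ε. The successor makes
    -- N ≥ 1 immediate.
    groups : ∀ ε → 0ℚ < ε → ℕ
    groups ε 0<ε = suc (R ℕ.+ R)
      where
      R = wowBound (suc (proj₁ (denominator-bound ε 0<ε)))

    1≤groups : ∀ ε 0<ε → 1 ℕ.≤ groups ε 0<ε
    1≤groups ε 0<ε = ℕ.s≤s ℕ.z≤n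

    errors : ∀ ε → 0ℚ < ε → ℕ → ℚ
    errors ε 0<ε = ε₂ (groups ε 0<ε) (1≤groups ε 0<ε)

    errors-bounds : ∀ ε 0<ε ℓ → (0ℚ < errors ε 0<ε ℓ) × (errors ε 0<ε ℓ ≤ 1ℚ)
    errors-bounds ε 0<ε ℓ = 0<ε₂ (groups ε 0<ε) (1≤groups ε 0<ε) ℓ , ε₂≤1 (groups ε 0<ε) (1≤groups ε 0<ε) ℓ

    -- If T < Wow m, then T ≤ R because m is at most the denominator of ε₁. The error function
    -- depends on ε₁ alone, and the 3-graph refuting `Works` is built only after n₀ is known, so no
    -- L and n₀ can rescue such a T.
    Wow≤parts : ∀ {𝓗} → Hereditary 𝓗 → (∀ k → 1 ℕ.≤ k → InTrip 𝓗 (kU k)) →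
      ∀ {ε₁} (0<ε₁ : 0ℚ < ε₁) → ε₁ < ε* → ∀ {T L n₀} → Works 𝓗 ε₁ (errors ε₁ 0<ε₁) T L n₀ →
      ∀ {m} → IsCeilRoot7 1ℚ ε₁ m → Wow m ℕ.≤ T
    Wow≤parts {𝓗} hered trip {ε₁} 0<ε₁ ε₁<ε* {T} {L} {n₀} works {m} ceil = ℕ.≮⇒≥ λ T<Wow →
      Contradiction.too-few-parts 𝓗 hered trip ε₁ 0<ε₁ ε₁<ε* (wowBound (suc d)) (groups ε₁ 0<ε₁) (1≤groups ε₁ 0<ε₁)
        (ℕ.n≤1+n _) T L n₀ (ℕ.≤-trans (ℕ.<⇒≤ T<Wow) (Wow≤wowBound (ceil≤ {ε₁} {m} {d} 0<ε₁ 1≤ ceil))) works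
      where
      d = proj₁ (denominator-bound ε₁ 0<ε₁)
      1≤ = proj₂ (denominator-bound ε₁ 0<ε₁)

  open LowerBound public

open Proof
open import Data.Nat using (ℕ; _≤_)
open import Data.Rational using (ℚ; 0ℚ; 1ℚ; _<_) renaming (_≤_ to _≤ℚ_)
open import Data.Product using (Σ; _×_; _,_)

theorem1p8 : (𝓗 : Graph3 → Set) → Hereditary 𝓗 →
    (∀ k → 1 ≤ k → InTrip 𝓗 (kU k)) →
    Σ ℚ λ c → Σ ℚ λ ε* → (0ℚ < c) × (0ℚ < ε*) ×
    (∀ ε₁ → 0ℚ < ε₁ → ε₁ < ε* →
    Σ (ℕ → ℚ) λ ε₂ → (∀ ℓ → (0ℚ < ε₂ ℓ) × (ε₂ ℓ ≤ℚ 1ℚ)) ×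
    (∀ T L n₀ → 1 ≤ L → Works 𝓗 ε₁ ε₂ T L n₀ →
    ∀ m → IsCeilRoot7 c ε₁ m → Wow m ≤ T))
theorem1p8 𝓗 hered trip = 1ℚ , ε* , 0<1 , 0<ε* , λ ε₁ 0<ε₁ ε₁<ε* →
  errors ε₁ 0<ε₁ , errors-bounds ε₁ 0<ε₁ , λ T L n₀ _ works m ceil → Wow≤parts hered trip 0<ε₁ ε₁<ε* works ceil
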